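{- There is an absolute constant $C > 0$ such that for every $n \geq 2$ and every simple graph $G$ on $n$ vertices, $$\max\{\lambda(G), \lambda(\bar{G})\} \geq 1 - C\, n^{ -1/3},$$ where $\bar{G}$ is the complement of $G$.
   Context: For a simple graph $G$ on $n$ vertices, $L(G) = D(G) - A(G)$ is its Laplacian matrix ($A(G)$ the adjacency matrix, $D(G)$ the diagonal degree matrix), with eigenvalues $0 = \lambda_1(G) \leq \lambda_2(G) \leq \cdots \leq \lambda_n(G)$. The algebraic connectivity is $\lambda(G) := \lambda_2(G)$. The paper states the result as $\max\{\lambda(G), \lambda(\bar{G})\} \geq 1 - O(n^{ -1/3})$. -}

module Defs where

open import Algebra.Bundles using (CommutativeRing)
open import Data.Bool using (Bool; false; true; not; _∧_; if_then_else_)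
open import Data.Bool.Properties using (∧-zeroʳ)
open import Data.Fin as Fin using (Fin; fromℕ<)
import Data.Fin.Properties as Fin
open import Data.Integer as ℤ using (+_; -[1+_])
import Data.Integer.Properties as ℤ
open import Data.Nat as ℕ using (ℕ; zero; suc)
import Data.Nat.Properties as ℕ
open import Data.Nat.Coprimality using (1-coprimeTo) renaming (sym to coprime-sym)
open import Data.Product using (∃-syntax; _×_; _,_; _,′_; proj₁; proj₂)
open import Data.Rational as ℚ using (ℚ; 0ℚ; 1ℚ; ½; mkℚ; ∣_∣)
import Data.Rational.Properties as ℚ
open import Data.Rational.Solver using () renaming (module +-*-Solver to ℚ-Solver)
open import Data.Rational.Unnormalised as ℚᵘ using (mkℚᵘ)
import Data.Rational.Unnormalised.Properties as ℚᵘ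
open import Data.Sum using (inj₁; inj₂)
open import Data.Vec.Functional using (Vector)
open import Function using (case_of_)
open import Level using (0ℓ)
open import Relation.Binary.PropositionalEquality
  using (_≡_; refl; sym; trans; cong; cong₂; subst; subst₂)
open import Relation.Nullary using (yes; no; contradiction)
open import Relation.Nullary.Decidable using (⌊_⌋)

private
  half : ∀ {ε} → 0ℚ ℚ.< ε → 0ℚ ℚ.< ½ ℚ.* ε
  half {ε} 0<ε = ℚ.positive⁻¹ (½ ℚ.* ε)
    {{ℚ.pos*pos⇒pos ½ ε {{ℚ.positive 0<ε}}}}

  halves : ∀ ε → ½ ℚ.* ε ℚ.+ ½ ℚ.* ε ≡ ε
  halves ε = trans (sym (ℚ.*-distribʳ-+ ε ½ ½)) (ℚ.*-identityˡ ε)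

  +-halves : ∀ {a b ε} → a ℚ.< ½ ℚ.* ε → b ℚ.< ½ ℚ.* ε → a ℚ.+ b ℚ.< ε
  +-halves {ε = ε} a< b< = subst (_ ℚ.<_) (halves ε) (ℚ.+-mono-< a< b<)

  ∣-∣-sym : ∀ p q → ∣ p ℚ.- q ∣ ≡ ∣ q ℚ.- p ∣
  ∣-∣-sym p q = trans (sym (ℚ.∣-p∣≡∣p∣ (p ℚ.- q))) (cong ∣_∣ lem)
    where
    open ℚ-Solver
    lem : ℚ.- (p ℚ.- q) ≡ q ℚ.- p
    lem = solve 2 (λ p q → :- (p :- q) := q :- p) refl p q

  ∣0∣< : ∀ p {ε} → 0ℚ ℚ.< ε → ∣ p ℚ.- p ∣ ℚ.< ε
  ∣0∣< p 0<ε = subst (ℚ._< _) (cong ∣_∣ (sym (ℚ.+-inverseʳ p))) 0<ε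

  p≤∣p∣ : ∀ p → p ℚ.≤ ∣ p ∣
  p≤∣p∣ p with ℚ.≤-total 0ℚ p
  ... | inj₁ 0≤p = ℚ.≤-reflexive (sym (ℚ.0≤p⇒∣p∣≡p 0≤p))
  ... | inj₂ p≤0 = ℚ.≤-trans p≤0 (ℚ.0≤∣p∣ p)

  ∣-∣<-elim : ∀ {p q ε} → ∣ p ℚ.- q ∣ ℚ.< ε → p ℚ.< q ℚ.+ ε
  ∣-∣<-elim {p} {q} {ε} h = subst (ℚ._< q ℚ.+ ε)
    (solve 2 (λ p q → q :+ (p :- q) := p) refl p q)
    (ℚ.+-monoʳ-< q (ℚ.≤-<-trans (p≤∣p∣ (p ℚ.- q)) h))
    where open ℚ-Solver

  ∣-∣<-intro : ∀ {p q ε} → p ℚ.< q ℚ.+ ε → q ℚ.< p ℚ.+ ε → ∣ p ℚ.- q ∣ ℚ.< ε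
  ∣-∣<-intro {p} {q} {ε} p< q< with ℚ.∣p∣≡p∨∣p∣≡-p (p ℚ.- q)
  ... | inj₁ eq = subst₂ ℚ._<_ (sym eq)
    (solve 2 (λ q ε → q :+ ε :- q := ε) refl q ε) (ℚ.+-monoˡ-< (ℚ.- q) p<)
    where open ℚ-Solver
  ... | inj₂ eq = subst₂ ℚ._<_
    (trans (solve 2 (λ p q → q :- p := :- (p :- q)) refl p q) (sym eq))
    (solve 2 (λ p ε → p :+ ε :- p := ε) refl p ε) (ℚ.+-monoˡ-< (ℚ.- p) q<)
    where open ℚ-Solver

  ∣-∣-triangle : ∀ p q r → ∣ p ℚ.- r ∣ ℚ.≤ ∣ p ℚ.- q ∣ ℚ.+ ∣ q ℚ.- r ∣
  ∣-∣-triangle p q r = subst (λ x → ∣ x ∣ ℚ.≤ ∣ p ℚ.- q ∣ ℚ.+ ∣ q ℚ.- r ∣)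
    (solve 3 (λ p q r → (p :- q) :+ (q :- r) := p :- r) refl p q r)
    (ℚ.∣p+q∣≤∣p∣+∣q∣ (p ℚ.- q) (q ℚ.- r))
    where open ℚ-Solver

  +-close : ∀ {p p′ q q′ ε} → ∣ p ℚ.- p′ ∣ ℚ.< ½ ℚ.* ε → ∣ q ℚ.- q′ ∣ ℚ.< ½ ℚ.* ε →
            ∣ (p ℚ.+ q) ℚ.- (p′ ℚ.+ q′) ∣ ℚ.< ε
  +-close {p} {p′} {q} {q′} {ε} hp hq = subst (λ x → ∣ x ∣ ℚ.< ε)
    (solve 4 (λ p p′ q q′ → (p :- p′) :+ (q :- q′) := (p :+ q) :- (p′ :+ q′)) refl p p′ q q′)
    (ℚ.≤-<-trans (ℚ.∣p+q∣≤∣p∣+∣q∣ (p ℚ.- p′) (q ℚ.- q′)) (+-halves hp hq))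
    where open ℚ-Solver

  neg-close : ∀ {p p′ ε} → ∣ p ℚ.- p′ ∣ ℚ.< ε → ∣ (ℚ.- p) ℚ.- (ℚ.- p′) ∣ ℚ.< ε
  neg-close {p} {p′} {ε} h = subst (ℚ._< ε)
    (trans (∣-∣-sym p p′)
      (cong ∣_∣ (solve 2 (λ p p′ → p′ :- p := (:- p) :- (:- p′)) refl p p′))) h
    where open ℚ-Solver

  ⊔-close : ∀ {p p′ q q′ ε} → ∣ p ℚ.- p′ ∣ ℚ.< ε → ∣ q ℚ.- q′ ∣ ℚ.< ε →
            ∣ (p ℚ.⊔ q) ℚ.- (p′ ℚ.⊔ q′) ∣ ℚ.< ε
  ⊔-close {p} {p′} {q} {q′} {ε} hp hq = ∣-∣<-intro (lem {p} {p′} {q} {q′} hp hq)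
    (lem {p′} {p} {q′} {q} (subst (ℚ._< ε) (∣-∣-sym p p′) hp) (subst (ℚ._< ε) (∣-∣-sym q q′) hq))
    where
    lem : ∀ {p p′ q q′} → ∣ p ℚ.- p′ ∣ ℚ.< ε → ∣ q ℚ.- q′ ∣ ℚ.< ε →
          p ℚ.⊔ q ℚ.< (p′ ℚ.⊔ q′) ℚ.+ ε
    lem {p} {p′} {q} {q′} hp hq with ℚ.⊔-sel p q
    ... | inj₁ eq rewrite eq =
      ℚ.<-≤-trans (∣-∣<-elim hp) (ℚ.+-monoˡ-≤ ε (ℚ.p≤p⊔q p′ q′))
    ... | inj₂ eq rewrite eq =
      ℚ.<-≤-trans (∣-∣<-elim hq) (ℚ.+-monoˡ-≤ ε (ℚ.p≤q⊔p p′ q′))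

  shrink : ∀ {B ε} → 0ℚ ℚ.< B → 0ℚ ℚ.< ε → ∃[ δ ] (0ℚ ℚ.< δ × B ℚ.* δ ≡ ε)
  shrink {B} {ε} 0<B 0<ε = (1/B ℚ.* ε) ,
    ℚ.positive⁻¹ (1/B ℚ.* ε) {{ℚ.pos*pos⇒pos 1/B {{ℚ.1/pos⇒pos B {{B⁺}}}} ε {{ℚ.positive 0<ε}}}} ,
    trans (sym (ℚ.*-assoc B 1/B ε))
      (trans (cong (ℚ._* ε) (ℚ.*-inverseʳ B {{B≠0}})) (ℚ.*-identityˡ ε))
    where
    B⁺ = ℚ.positive 0<B
    B≠0 = ℚ.pos⇒nonZero B {{B⁺}}
    1/B = (ℚ.1/ B) {{B≠0}}

  scale : ∀ {a B b δ ε} → 0ℚ ℚ.< B → a ℚ.≤ B → B ℚ.* δ ≡ ε → 0ℚ ℚ.≤ b → b ℚ.< δ →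
          a ℚ.* b ℚ.< ε
  scale {a} {B} {b} {δ} 0<B a≤B eq 0≤b b<δ = subst (a ℚ.* b ℚ.<_) eq
    (ℚ.≤-<-trans (ℚ.*-monoʳ-≤-nonNeg b {{ℚ.nonNegative 0≤b}} a≤B)
                 (ℚ.*-monoʳ-<-pos B {{ℚ.positive 0<B}} b<δ))

  *-close : ∀ {p p′ q q′ B δ ε} → 0ℚ ℚ.< B → B ℚ.* δ ≡ ½ ℚ.* ε →
            ∣ p ∣ ℚ.≤ B → ∣ q′ ∣ ℚ.≤ B →
            ∣ p ℚ.- p′ ∣ ℚ.< δ → ∣ q ℚ.- q′ ∣ ℚ.< δ →
            ∣ (p ℚ.* q) ℚ.- (p′ ℚ.* q′) ∣ ℚ.< ε
  *-close {p} {p′} {q} {q′} {B} {δ} {ε} 0<B eq p≤ q′≤ hp hq = subst (λ x → ∣ x ∣ ℚ.< ε)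
    (solve 4 (λ p p′ q q′ → p :* (q :- q′) :+ q′ :* (p :- p′) := p :* q :- p′ :* q′)
      refl p p′ q q′)
    (ℚ.≤-<-trans (ℚ.∣p+q∣≤∣p∣+∣q∣ (p ℚ.* (q ℚ.- q′)) (q′ ℚ.* (p ℚ.- p′)))
      (+-halves
        (subst (ℚ._< ½ ℚ.* ε) (sym (ℚ.∣p*q∣≡∣p∣*∣q∣ p (q ℚ.- q′)))
          (scale 0<B p≤ eq (ℚ.0≤∣p∣ (q ℚ.- q′)) hq))
        (subst (ℚ._< ½ ℚ.* ε) (sym (ℚ.∣p*q∣≡∣p∣*∣q∣ q′ (p ℚ.- p′)))
          (scale 0<B q′≤ eq (ℚ.0≤∣p∣ (p ℚ.- p′)) hp))))
    where open ℚ-Solver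

-- The real numbers are Cauchy sequences of rationals; equality of reals is _≈_.

Eventually : (ℕ → Set) → Set
Eventually P = ∃[ N ] (∀ k → N ℕ.≤ k → P k)

Cauchy : (ℕ → ℚ) → Set
Cauchy s = ∀ ε → 0ℚ ℚ.< ε → ∃[ N ] (∀ k l → N ℕ.≤ k → N ℕ.≤ l → ∣ s k ℚ.- s l ∣ ℚ.< ε)

record ℝ : Set where
  constructor mkℝ
  field
    seq    : ℕ → ℚ
    cauchy : Cauchy seq

open ℝ public

infix 4 _≈_ _≤_ _<_

_≈_ : ℝ → ℝ → Set
x ≈ y = ∀ ε → 0ℚ ℚ.< ε → Eventually λ k → ∣ seq x k ℚ.- seq y k ∣ ℚ.< ε

_≤_ : ℝ → ℝ → Set
x ≤ y = ∀ ε → 0ℚ ℚ.< ε → Eventually λ k → seq x k ℚ.< seq y k ℚ.+ ε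

_<_ : ℝ → ℝ → Set
x < y = ∃[ ε ] (0ℚ ℚ.< ε × Eventually λ k → seq x k ℚ.+ ε ℚ.< seq y k)

infix  8 -_
infixl 7 _*_
infixl 6 _+_ _-_ _⊔_

private
  ⊔ˡ : ∀ {m n k} → m ℕ.⊔ n ℕ.≤ k → m ℕ.≤ k
  ⊔ˡ {m} {n} = ℕ.m⊔n≤o⇒m≤o m n

  ⊔ʳ : ∀ {m n k} → m ℕ.⊔ n ℕ.≤ k → n ℕ.≤ k
  ⊔ʳ {m} {n} = ℕ.m⊔n≤o⇒n≤o m n

  bound : ∀ x → ∃[ B ] (0ℚ ℚ.< B × Eventually λ k → ∣ seq x k ∣ ℚ.≤ B)
  bound x = case cauchy x 1ℚ (ℚ.positive⁻¹ 1ℚ) of λ where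
   (N , c) → (∣ seq x N ∣ ℚ.+ 1ℚ) ,
    ℚ.+-mono-≤-< (ℚ.0≤∣p∣ (seq x N)) (ℚ.positive⁻¹ 1ℚ) ,
    N , λ k N≤k → ℚ.≤-trans
      (subst (λ p → ∣ p ∣ ℚ.≤ ∣ seq x N ∣ ℚ.+ ∣ seq x k ℚ.- seq x N ∣)
        (solve 2 (λ p q → q :+ (p :- q) := p) refl (seq x k) (seq x N))
        (ℚ.∣p+q∣≤∣p∣+∣q∣ (seq x N) (seq x k ℚ.- seq x N)))
      (ℚ.+-monoʳ-≤ ∣ seq x N ∣ (ℚ.<⇒≤ (c k N N≤k ℕ.≤-refl)))
    where open ℚ-Solver

  common-bound : ∀ x y → ∃[ B ] (0ℚ ℚ.< B × Eventually λ k → ∣ seq x k ∣ ℚ.≤ B × ∣ seq y k ∣ ℚ.≤ B)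
  common-bound x y = case (bound x ,′ bound y) of λ where
   ((B , 0<B , N , h) , (B′ , _ , N′ , h′)) → (B ℚ.⊔ B′) ,
    ℚ.<-≤-trans 0<B (ℚ.p≤p⊔q B B′) , N ℕ.⊔ N′ , λ k N≤k →
    ℚ.≤-trans (h k (⊔ˡ {N} {N′} N≤k)) (ℚ.p≤p⊔q B B′) ,
    ℚ.≤-trans (h′ k (⊔ʳ {N} {N′} N≤k)) (ℚ.p≤q⊔p B B′)

  abstract
    fromℚ-cauchy : ∀ q → Cauchy (λ _ → q)
    fromℚ-cauchy q ε 0<ε = 0 , λ _ _ _ _ → ∣0∣< q 0<ε

    +-cauchy : ∀ x y → Cauchy (λ k → seq x k ℚ.+ seq y k)
    +-cauchy x y ε 0<ε =
      case (cauchy x (½ ℚ.* ε) (half {ε} 0<ε) ,′ cauchy y (½ ℚ.* ε) (half {ε} 0<ε)) of λ where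
        ((N , c) , (N′ , c′)) → N ℕ.⊔ N′ , λ k l N≤k N≤l →
          +-close {seq x k} {seq x l} {seq y k} {seq y l} {ε}
            (c k l (⊔ˡ {N} {N′} N≤k) (⊔ˡ {N} {N′} N≤l)) (c′ k l (⊔ʳ {N} {N′} N≤k) (⊔ʳ {N} {N′} N≤l))

    neg-cauchy : ∀ x → Cauchy (λ k → ℚ.- seq x k)
    neg-cauchy x ε 0<ε =
      case cauchy x ε 0<ε of λ where
        (N , c) → N , λ k l N≤k N≤l → neg-close {seq x k} {seq x l} {ε} (c k l N≤k N≤l)

    *-cauchy : ∀ x y → Cauchy (λ k → seq x k ℚ.* seq y k)
    *-cauchy x y ε 0<ε =
      case common-bound x y of λ where
        (B , 0<B , M , b) → case shrink {B} {½ ℚ.* ε} 0<B (half {ε} 0<ε) of λ where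
          (δ , 0<δ , eq) → case (cauchy x δ 0<δ ,′ cauchy y δ 0<δ) of λ where
            ((N , c) , (N′ , c′)) → M ℕ.⊔ (N ℕ.⊔ N′) , λ k l ≤k ≤l →
              *-close {seq x k} {seq x l} {seq y k} {seq y l} {B} {δ} {ε} 0<B eq
                (proj₁ (b k (⊔ˡ {M} {N ℕ.⊔ N′} ≤k))) (proj₂ (b l (⊔ˡ {M} {N ℕ.⊔ N′} ≤l)))
                (c k l (⊔ˡ {N} {N′} (⊔ʳ {M} {N ℕ.⊔ N′} ≤k)) (⊔ˡ {N} {N′} (⊔ʳ {M} {N ℕ.⊔ N′} ≤l)))
                (c′ k l (⊔ʳ {N} {N′} (⊔ʳ {M} {N ℕ.⊔ N′} ≤k)) (⊔ʳ {N} {N′} (⊔ʳ {M} {N ℕ.⊔ N′} ≤l)))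

    ⊔-cauchy : ∀ x y → Cauchy (λ k → seq x k ℚ.⊔ seq y k)
    ⊔-cauchy x y ε 0<ε =
      case (cauchy x ε 0<ε ,′ cauchy y ε 0<ε) of λ where
        ((N , c) , (N′ , c′)) → N ℕ.⊔ N′ , λ k l N≤k N≤l →
          ⊔-close {seq x k} {seq x l} {seq y k} {seq y l} {ε}
            (c k l (⊔ˡ {N} {N′} N≤k) (⊔ˡ {N} {N′} N≤l)) (c′ k l (⊔ʳ {N} {N′} N≤k) (⊔ʳ {N} {N′} N≤l))

fromℚ : ℚ → ℝ
fromℚ q = mkℝ (λ _ → q) (fromℚ-cauchy q)

fromℕ : ℕ → ℝ
fromℕ n = fromℚ (+ n ℚ./ 1)

0ℝ 1ℝ : ℝ
0ℝ = fromℚ 0ℚ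
1ℝ = fromℚ 1ℚ

_+_ : ℝ → ℝ → ℝ
x + y = mkℝ (λ k → seq x k ℚ.+ seq y k) (+-cauchy x y)

-_ : ℝ → ℝ
- x = mkℝ (λ k → ℚ.- seq x k) (neg-cauchy x)

_-_ : ℝ → ℝ → ℝ
x - y = x + (- y)

_*_ : ℝ → ℝ → ℝ
x * y = mkℝ (λ k → seq x k ℚ.* seq y k) (*-cauchy x y)

_⊔_ : ℝ → ℝ → ℝ
x ⊔ y = mkℝ (λ k → seq x k ℚ.⊔ seq y k) (⊔-cauchy x y)

≈-pointwise : ∀ {x y} → (∀ k → seq x k ≡ seq y k) → x ≈ y
≈-pointwise {x} {y} eq ε 0<ε = 0 , λ k _ →
  subst (λ p → ∣ seq x k ℚ.- p ∣ ℚ.< ε) (eq k) (∣0∣< (seq x k) 0<ε)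

≈-refl : ∀ {x} → x ≈ x
≈-refl {x} = ≈-pointwise {x} {x} (λ _ → refl)

≈-sym : ∀ {x y} → x ≈ y → y ≈ x
≈-sym {x} {y} x≈y ε 0<ε = case x≈y ε 0<ε of λ where
  (N , h) → N , λ k N≤k → subst (ℚ._< ε) (∣-∣-sym (seq x k) (seq y k)) (h k N≤k)

≈-trans : ∀ {x y z} → x ≈ y → y ≈ z → x ≈ z
≈-trans {x} {y} {z} x≈y y≈z ε 0<ε = case (x≈y (½ ℚ.* ε) (half {ε} 0<ε) ,′ y≈z (½ ℚ.* ε) (half {ε} 0<ε)) of λ where
  ((N , h) , (N′ , h′)) → N ℕ.⊔ N′ , λ k N≤k →
   ℚ.≤-<-trans (∣-∣-triangle (seq x k) (seq y k) (seq z k))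
    (+-halves {ε = ε} (h k (⊔ˡ {N} {N′} N≤k)) (h′ k (⊔ʳ {N} {N′} N≤k)))

+-cong : ∀ {x x′ y y′} → x ≈ x′ → y ≈ y′ → x + y ≈ x′ + y′
+-cong {x} {x′} {y} {y′} x≈ y≈ ε 0<ε = case (x≈ (½ ℚ.* ε) (half {ε} 0<ε) ,′ y≈ (½ ℚ.* ε) (half {ε} 0<ε)) of λ where
  ((N , h) , (N′ , h′)) → N ℕ.⊔ N′ , λ k N≤k →
   +-close {seq x k} {seq x′ k} {seq y k} {seq y′ k} {ε} (h k (⊔ˡ {N} {N′} N≤k)) (h′ k (⊔ʳ {N} {N′} N≤k))

-‿cong : ∀ {x y} → x ≈ y → - x ≈ - y
-‿cong {x} {y} x≈y ε 0<ε = case x≈y ε 0<ε of λ where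
  (N , h) → N , λ k N≤k → neg-close {seq x k} {seq y k} {ε} (h k N≤k)

*-cong : ∀ {x x′ y y′} → x ≈ x′ → y ≈ y′ → x * y ≈ x′ * y′
*-cong {x} {x′} {y} {y′} x≈ y≈ ε 0<ε = case common-bound x y′ of λ where
 (B , 0<B , M , b) → case shrink {B} {½ ℚ.* ε} 0<B (half {ε} 0<ε) of λ where
  (δ , 0<δ , eq) → case (x≈ δ 0<δ ,′ y≈ δ 0<δ) of λ where
   ((N , h) , (N′ , h′)) → M ℕ.⊔ (N ℕ.⊔ N′) , λ k ≤k →
    *-close {seq x k} {seq x′ k} {seq y k} {seq y′ k} {B} {δ} {ε} 0<B eq
    (proj₁ (b k (⊔ˡ {M} {N ℕ.⊔ N′} ≤k))) (proj₂ (b k (⊔ˡ {M} {N ℕ.⊔ N′} ≤k)))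
    (h k (⊔ˡ {N} {N′} (⊔ʳ {M} {N ℕ.⊔ N′} ≤k))) (h′ k (⊔ʳ {N} {N′} (⊔ʳ {M} {N ℕ.⊔ N′} ≤k)))

ℝ-commutativeRing : CommutativeRing 0ℓ 0ℓ
ℝ-commutativeRing = record
  { Carrier = ℝ ; _≈_ = _≈_ ; _+_ = _+_ ; _*_ = _*_ ; -_ = -_ ; 0# = 0ℝ ; 1# = 1ℝ
  ; isCommutativeRing = record
    { isRing = record
      { +-isAbelianGroup = record
        { isGroup = record
          { isMonoid = record
            { isSemigroup = record
              { isMagma = record
                { isEquivalence = record
                  { refl  = λ {x} → ≈-refl {x}
                  ; sym   = λ {x y} → ≈-sym {x} {y}
                  ; trans = λ {x y z} → ≈-trans {x} {y} {z} }
                ; ∙-cong = λ {x x′ y y′} → +-cong {x} {x′} {y} {y′} }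
              ; assoc = λ x y z → ≈-pointwise {(x + y) + z} {x + (y + z)}
                  λ k → ℚ.+-assoc (seq x k) (seq y k) (seq z k) }
            ; identity = (λ x → ≈-pointwise {0ℝ + x} {x} λ k → ℚ.+-identityˡ (seq x k))
                       , (λ x → ≈-pointwise {x + 0ℝ} {x} λ k → ℚ.+-identityʳ (seq x k)) }
          ; inverse = (λ x → ≈-pointwise { - x + x} {0ℝ} λ k → ℚ.+-inverseˡ (seq x k))
                    , (λ x → ≈-pointwise {x + - x} {0ℝ} λ k → ℚ.+-inverseʳ (seq x k))
          ; ⁻¹-cong = λ {x y} → -‿cong {x} {y} }
        ; comm = λ x y → ≈-pointwise {x + y} {y + x} λ k → ℚ.+-comm (seq x k) (seq y k) }
      ; *-cong = λ {x x′ y y′} → *-cong {x} {x′} {y} {y′}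
      ; *-assoc = λ x y z → ≈-pointwise {(x * y) * z} {x * (y * z)}
          λ k → ℚ.*-assoc (seq x k) (seq y k) (seq z k)
      ; *-identity = (λ x → ≈-pointwise {1ℝ * x} {x} λ k → ℚ.*-identityˡ (seq x k))
                   , (λ x → ≈-pointwise {x * 1ℝ} {x} λ k → ℚ.*-identityʳ (seq x k))
      ; distrib = (λ x y z → ≈-pointwise {x * (y + z)} {x * y + x * z}
                    λ k → ℚ.*-distribˡ-+ (seq x k) (seq y k) (seq z k))
                , (λ x y z → ≈-pointwise {(y + z) * x} {y * x + z * x}
                    λ k → ℚ.*-distribʳ-+ (seq x k) (seq y k) (seq z k)) }
    ; *-comm = λ x y → ≈-pointwise {x * y} {y * x} λ k → ℚ.*-comm (seq x k) (seq y k) } }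

open import Algebra.Properties.Semiring.Sum (CommutativeRing.semiring ℝ-commutativeRing)
  using (sum-syntax) public

-- n^(-1/3) is the limit of ρ n t / t as t → ∞, where ρ n t is the largest
-- r ≤ t with r³ n ≤ t³.

cube : ℕ → ℕ
cube r = r ℕ.* r ℕ.* r

ρ-below : (n t r : ℕ) → ℕ
ρ-below n t zero    = zero
ρ-below n t (suc r) = if ⌊ cube (suc r) ℕ.* n ℕ.≤? cube t ⌋ then suc r else ρ-below n t r

ρ : (n t : ℕ) → ℕ
ρ n t = ρ-below n t t

private
  cube-mono-≤ : ∀ {r s} → r ℕ.≤ s → cube r ℕ.≤ cube s
  cube-mono-≤ r≤s = ℕ.*-mono-≤ (ℕ.*-mono-≤ r≤s r≤s) r≤s

  cube-mono-< : ∀ {r s} → r ℕ.< s → cube r ℕ.< cube s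
  cube-mono-< r<s = ℕ.*-mono-< (ℕ.*-mono-< r<s r<s) r<s

  ρ-below-spec : ∀ n t r → cube t ℕ.< cube (suc r) ℕ.* n →
    cube (ρ-below n t r) ℕ.* n ℕ.≤ cube t × cube t ℕ.< cube (suc (ρ-below n t r)) ℕ.* n
  ρ-below-spec n t zero    h = ℕ.z≤n , h
  ρ-below-spec n t (suc r) h with cube (suc r) ℕ.* n ℕ.≤? cube t
  ... | yes ≤t = ≤t , h
  ... | no ≰t  = ρ-below-spec n t r (ℕ.≰⇒> ≰t)

  ρ-spec : ∀ m t → cube (ρ (suc m) t) ℕ.* suc m ℕ.≤ cube t ×
                   cube t ℕ.< cube (suc (ρ (suc m) t)) ℕ.* suc m
  ρ-spec m t = ρ-below-spec (suc m) t t
    (ℕ.<-≤-trans (cube-mono-< (ℕ.n<1+n t)) (ℕ.m≤m*n (cube (suc t)) (suc m)))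

  ι : ℕ → ℚ
  ι m = + m ℚ./ 1

  ι′ : ℕ → ℚ
  ι′ m = mkℚ (+ m) 0 (coprime-sym (1-coprimeTo m))

  ι≡ : ∀ m → ι m ≡ ι′ m
  ι≡ m = ℚ.↥p/↧p≡p (ι′ m)

  ι-mono-≤ : ∀ {m n} → m ℕ.≤ n → ι m ℚ.≤ ι n
  ι-mono-≤ {m} {n} m≤n = subst₂ ℚ._≤_ (sym (ι≡ m)) (sym (ι≡ n))
    (ℚ.*≤* (ℤ.*-monoʳ-≤-nonNeg (+ 1) (ℤ.+≤+ m≤n)))

  ι-mono-< : ∀ {m n} → m ℕ.< n → ι m ℚ.< ι n
  ι-mono-< {m} {n} m<n = subst₂ ℚ._<_ (sym (ι≡ m)) (sym (ι≡ n))
    (ℚ.*<* (ℤ.*-monoʳ-<-pos (+ 1) (ℤ.+<+ m<n)))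

  ι-* : ∀ m n → ι (m ℕ.* n) ≡ ι m ℚ.* ι n
  ι-* m n = trans (cong (ℚ._/ 1) (ℤ.pos-* m n)) (sym (cong₂ ℚ._*_ (ι≡ m) (ι≡ n)))

  ι-suc : ∀ m → ι (suc m) ≡ ι m ℚ.+ 1ℚ
  ι-suc m = trans (cong (λ z → z ℚ./ 1) lem) (sym (cong (ℚ._+ 1ℚ) (ι≡ m)))
    where
    lem : + suc m ≡ + m ℤ.* + 1 ℤ.+ + 1 ℤ.* + 1
    lem = sym (trans (cong (ℤ._+ + 1) (ℤ.*-identityʳ (+ m))) (cong +_ (ℕ.+-comm m 1)))

  h : ℕ → ℚ
  h k = + 1 ℚ./ suc k

  toℚᵘ-/ : ∀ i k → ℚ.toℚᵘ (i ℚ./ suc k) ℚᵘ.≃ mkℚᵘ i k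
  toℚᵘ-/ i k = ℚ.toℚᵘ-fromℚᵘ (mkℚᵘ i k)

  ι*h : ∀ m k → + m ℚ./ suc k ≡ ι m ℚ.* h k
  ι*h m k = ℚ.toℚᵘ-injective (ℚᵘ.≃-trans (toℚᵘ-/ (+ m) k)
    (ℚᵘ.≃-trans (ℚᵘ.*≡* lem)
    (ℚᵘ.≃-sym (ℚᵘ.≃-trans (ℚ.toℚᵘ-homo-* (ι m) (h k))
      (ℚᵘ.*-cong (toℚᵘ-/ (+ m) 0) (toℚᵘ-/ (+ 1) k))))))
    where
    lem : + m ℤ.* + (suc k ℕ.+ 0) ≡ (+ m ℤ.* + 1) ℤ.* + suc k
    lem = cong₂ ℤ._*_ (sym (ℤ.*-identityʳ (+ m))) (cong +_ (ℕ.+-identityʳ (suc k)))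

  t*h : ∀ k → ι (suc k) ℚ.* h k ≡ 1ℚ
  t*h k = trans (sym (ι*h (suc k) k)) (ℚ.toℚᵘ-injective
    (ℚᵘ.≃-trans (toℚᵘ-/ (+ suc k) k) (ℚᵘ.*≡* (ℤ.*-comm (+ suc k) (+ 1)))))

  0<h : ∀ k → 0ℚ ℚ.< h k
  0<h k = ℚ.positive⁻¹ (h k) {{ℚ.normalize-pos 1 (suc k)}}

  h-small : ∀ ε → 0ℚ ℚ.< ε → Eventually λ k → h k ℚ.< ε
  h-small (mkℚ (+ zero) d _) (ℚ.*<* (ℤ.+<+ ()))
  h-small (mkℚ -[1+ _ ] d _) (ℚ.*<* ())
  h-small ε@(mkℚ (+ suc p) d _) _ = suc d , λ k d<k →
    ℚ.toℚᵘ-cancel-< (ℚᵘ.<-respˡ-≃ (ℚᵘ.≃-sym (toℚᵘ-/ (+ 1) k))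
      (ℚᵘ.*<* (ℤ.+<+ (subst (ℕ._< suc p ℕ.* suc k) (sym (ℕ.+-identityʳ (suc d)))
        (ℕ.<-≤-trans (ℕ.s≤s d<k) (ℕ.m≤m+n (suc k) (p ℕ.* suc k)))))))

  cubeℚ : ℚ → ℚ
  cubeℚ q = q ℚ.* q ℚ.* q

  cubeℚ-mono : ∀ {p q} → 0ℚ ℚ.≤ p → p ℚ.≤ q → cubeℚ p ℚ.≤ cubeℚ q
  cubeℚ-mono {p} {q} 0≤p p≤q = mul (mul p≤q p≤q (ℚ.nonNegative 0≤p) q⁺) p≤q (ℚ.nonNegative 0≤p)
      (ℚ.nonNeg*nonNeg⇒nonNeg q {{q⁺}} q {{q⁺}})
    where
    q⁺ = ℚ.nonNegative (ℚ.≤-trans 0≤p p≤q)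
    mul : ∀ {a b c d} → a ℚ.≤ b → c ℚ.≤ d → ℚ.NonNegative c → ℚ.NonNegative b →
          a ℚ.* c ℚ.≤ b ℚ.* d
    mul {a} {b} {c} {d} a≤b c≤d c⁺ b⁺ =
      ℚ.≤-trans (ℚ.*-monoʳ-≤-nonNeg c {{c⁺}} a≤b) (ℚ.*-monoˡ-≤-nonNeg b {{b⁺}} c≤d)

  ι-cube : ∀ r n k → ι (cube r ℕ.* n) ℚ.* cubeℚ (h k) ≡ ι n ℚ.* cubeℚ (ι r ℚ.* h k)
  ι-cube r n k = trans
    (cong (ℚ._* cubeℚ (h k)) (trans (ι-* (cube r) n)
      (cong (ℚ._* ι n) (trans (ι-* (r ℕ.* r) r) (cong (ℚ._* ι r) (ι-* r r))))))
    (solve 3 (λ r n h → r :* r :* r :* n :* (h :* h :* h) :=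
                        n :* ((r :* h) :* (r :* h) :* (r :* h)))
      refl (ι r) (ι n) (h k))
    where open ℚ-Solver

  ι-cube-t : ∀ k → ι (cube (suc k)) ℚ.* cubeℚ (h k) ≡ 1ℚ
  ι-cube-t k = trans (cong (ℚ._* cubeℚ (h k)) (cong ι (sym (ℕ.*-identityʳ (cube (suc k))))))
    (trans (ι-cube (suc k) 1 k) (cong (λ q → ι 1 ℚ.* cubeℚ q) (t*h k)))

  0<cubeh : ∀ k → ℚ.Positive (cubeℚ (h k))
  0<cubeh k = ℚ.pos*pos⇒pos (h k ℚ.* h k) {{ℚ.pos*pos⇒pos (h k) {{h⁺}} (h k) {{h⁺}}}} (h k) {{h⁺}}
    where h⁺ = ℚ.positive (0<h k)

  q : ℕ → ℕ → ℚ
  q m k = + ρ (suc m) (suc k) ℚ./ suc k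

  0≤q : ∀ m k → 0ℚ ℚ.≤ q m k
  0≤q m k = ℚ.nonNegative⁻¹ (q m k) {{ℚ.normalize-nonNeg (ρ (suc m) (suc k)) (suc k)}}

  q-lower : ∀ m k → ι (suc m) ℚ.* cubeℚ (q m k) ℚ.≤ 1ℚ
  q-lower m k = subst₂ ℚ._≤_
    (trans (ι-cube r (suc m) k) (cong (λ z → ι (suc m) ℚ.* cubeℚ z) (sym (ι*h r k))))
    (ι-cube-t k)
    (ℚ.*-monoʳ-≤-nonNeg (cubeℚ (h k)) {{ℚ.pos⇒nonNeg (cubeℚ (h k)) {{0<cubeh k}}}}
      (ι-mono-≤ (proj₁ (ρ-spec m (suc k)))))
    where r = ρ (suc m) (suc k)

  q-upper : ∀ m k → 1ℚ ℚ.< ι (suc m) ℚ.* cubeℚ (q m k ℚ.+ h k)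
  q-upper m k = subst₂ ℚ._<_ (ι-cube-t k)
    (trans (ι-cube (suc r) (suc m) k) (cong (λ z → ι (suc m) ℚ.* cubeℚ z) eq))
    (ℚ.*-monoˡ-<-pos (cubeℚ (h k)) {{0<cubeh k}} (ι-mono-< (proj₂ (ρ-spec m (suc k)))))
    where
    r = ρ (suc m) (suc k)
    eq : ι (suc r) ℚ.* h k ≡ q m k ℚ.+ h k
    eq = trans (cong (ℚ._* h k) (ι-suc r)) (trans (ℚ.*-distribʳ-+ (h k) (ι r) 1ℚ)
      (cong₂ ℚ._+_ (sym (ι*h r k)) (ℚ.*-identityˡ (h k))))

  ι⁺ : ∀ m → ℚ.NonNegative (ι m)
  ι⁺ m = ℚ.normalize-nonNeg m 1

  cubeℚ-cancel : ∀ n a b → ℚ.NonNegative n → 0ℚ ℚ.≤ b →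
    n ℚ.* cubeℚ a ℚ.≤ 1ℚ → 1ℚ ℚ.< n ℚ.* cubeℚ b → a ℚ.< b
  cubeℚ-cancel n a b n⁺ 0≤b a≤ b> = ℚ.≰⇒> λ b≤a → ℚ.<-irrefl refl
    (ℚ.<-≤-trans b> (ℚ.≤-trans (ℚ.*-monoˡ-≤-nonNeg n {{n⁺}} (cubeℚ-mono 0≤b b≤a)) a≤))

  q-step : ∀ m k l → q m k ℚ.< q m l ℚ.+ h l
  q-step m k l = cubeℚ-cancel (ι (suc m)) (q m k) (q m l ℚ.+ h l) (ι⁺ (suc m))
    (ℚ.+-mono-≤ {0ℚ} {q m l} {0ℚ} {h l} (0≤q m l) (ℚ.<⇒≤ (0<h l))) (q-lower m k) (q-upper m l)

  abstract
    ^-⅓-cauchy : ∀ m → Cauchy (q m)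
    ^-⅓-cauchy m ε 0<ε =
      case h-small ε 0<ε of λ where
        (N , s) → N , λ k l N≤k N≤l → ∣-∣<-intro {q m k} {q m l}
          (ℚ.<-trans (q-step m k l) (ℚ.+-monoʳ-< (q m l) (s l N≤l)))
          (ℚ.<-trans (q-step m l k) (ℚ.+-monoʳ-< (q m k) (s k N≤k)))

infix 9 _^-⅓

-- The value at n = 0 is a convention.
_^-⅓ : ℕ → ℝ
zero  ^-⅓ = 0ℝ
suc m ^-⅓ = mkℝ (λ k → + ρ (suc m) (suc k) ℚ./ suc k) (^-⅓-cauchy m)

private
  cubeℚ-expand : ∀ n a b → ℚ.NonNegative n → 0ℚ ℚ.≤ a → 0ℚ ℚ.≤ b → a ℚ.≤ 1ℚ → b ℚ.≤ 1ℚ →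
    n ℚ.* cubeℚ (a ℚ.+ b) ℚ.≤ n ℚ.* cubeℚ a ℚ.+ n ℚ.* ι 7 ℚ.* b
  cubeℚ-expand n a b n⁺ 0≤a 0≤b a≤1 b≤1 = subst₂ ℚ._≤_
    (solve 3 (λ n a b → n :* (a :* a :* a) :+ n :* b :* (a :* a :+ a :* a :+ a :* a :+ a :* b :+ a :* b :+ a :* b :+ b :* b)
       := n :* ((a :+ b) :* (a :+ b) :* (a :+ b))) refl n a b)
    (solve 4 (λ n a b c → n :* (a :* a :* a) :+ n :* b :* c
       := n :* (a :* a :* a) :+ n :* c :* b) refl n a b (ι 7))
    (ℚ.+-monoʳ-≤ (n ℚ.* cubeℚ a)
      (ℚ.*-monoˡ-≤-nonNeg (n ℚ.* b) {{ℚ.nonNeg*nonNeg⇒nonNeg n {{n⁺}} b {{b⁺}}}} sum≤7))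
    where
    open ℚ-Solver
    a⁺ = ℚ.nonNegative 0≤a
    b⁺ = ℚ.nonNegative 0≤b
    ≤1*≤1 : ∀ a b → a ℚ.≤ 1ℚ → b ℚ.≤ 1ℚ → ℚ.NonNegative b → a ℚ.* b ℚ.≤ 1ℚ
    ≤1*≤1 a b a≤1 b≤1 b⁺ = ℚ.≤-trans (ℚ.*-monoʳ-≤-nonNeg b {{b⁺}} a≤1)
      (subst (ℚ._≤ 1ℚ) (sym (ℚ.*-identityˡ b)) b≤1)
    sum-bound : ∀ x y z → x ℚ.≤ 1ℚ → y ℚ.≤ 1ℚ → z ℚ.≤ 1ℚ →
      x ℚ.+ x ℚ.+ x ℚ.+ y ℚ.+ y ℚ.+ y ℚ.+ z ℚ.≤ ι 7
    sum-bound x y z x≤ y≤ z≤ =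
      +≤ (+≤ (+≤ (+≤ (+≤ (+≤ x≤ x≤) x≤) y≤) y≤) y≤) z≤
      where
      +≤ : ∀ {a b c d} → a ℚ.≤ b → c ℚ.≤ d → a ℚ.+ c ℚ.≤ b ℚ.+ d
      +≤ = ℚ.+-mono-≤
    sum≤7 : a ℚ.* a ℚ.+ a ℚ.* a ℚ.+ a ℚ.* a ℚ.+ a ℚ.* b ℚ.+ a ℚ.* b ℚ.+ a ℚ.* b ℚ.+ b ℚ.* b ℚ.≤ ι 7
    sum≤7 = sum-bound (a ℚ.* a) (a ℚ.* b) (b ℚ.* b)
      (≤1*≤1 a a a≤1 a≤1 a⁺) (≤1*≤1 a b a≤1 b≤1 b⁺) (≤1*≤1 b b b≤1 b≤1 b⁺)

  q≤1 : ∀ m k → q m k ℚ.≤ 1ℚ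
  q≤1 m k = subst₂ ℚ._≤_ (sym (ι*h r k)) (t*h k)
    (ℚ.*-monoʳ-≤-nonNeg (h k) {{ℚ.nonNegative (ℚ.<⇒≤ (0<h k))}} (ι-mono-≤ (ρ-below-≤ (suc k))))
    where
    r = ρ (suc m) (suc k)
    ρ-below-≤ : ∀ s → ρ-below (suc m) (suc k) s ℕ.≤ s
    ρ-below-≤ zero = ℕ.z≤n
    ρ-below-≤ (suc s) with ⌊ cube (suc s) ℕ.* suc m ℕ.≤? cube (suc k) ⌋
    ... | true  = ℕ.≤-refl
    ... | false = ℕ.m≤n⇒m≤1+n (ρ-below-≤ s)

  h≤1 : ∀ k → h k ℚ.≤ 1ℚ
  h≤1 k = subst₂ ℚ._≤_ (ℚ.*-identityˡ (h k)) (t*h k)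
    (ℚ.*-monoʳ-≤-nonNeg (h k) {{ℚ.nonNegative (ℚ.<⇒≤ (0<h k))}} (ι-mono-≤ {1} {suc k} (ℕ.s≤s ℕ.z≤n)))

  ι7⁺ : ∀ m → ℚ.Positive (ι (suc m) ℚ.* ι 7)
  ι7⁺ m = ℚ.pos*pos⇒pos (ι (suc m)) {{ℚ.normalize-pos (suc m) 1}} (ι 7)

  squeeze : ∀ a b c d ε → 0ℚ ℚ.< ε → a ℚ.≤ 1ℚ → 1ℚ ℚ.< b → b ℚ.≤ a ℚ.+ c ℚ.* d →
    ∀ δ → ℚ.Positive c → c ℚ.* δ ≡ ε → d ℚ.< δ → ∣ a ℚ.- 1ℚ ∣ ℚ.< ε
  squeeze a b c d ε 0<ε a≤1 1<b b≤ δ c⁺ eq d<δ = ∣-∣<-intro {a} {1ℚ}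
    (ℚ.≤-<-trans a≤1 (subst (ℚ._< 1ℚ ℚ.+ ε) (ℚ.+-identityʳ 1ℚ) (ℚ.+-monoʳ-< 1ℚ 0<ε)))
    (ℚ.<-trans 1<b (ℚ.≤-<-trans b≤ (ℚ.+-monoʳ-< a
      (subst (c ℚ.* d ℚ.<_) eq (ℚ.*-monoʳ-<-pos c {{c⁺}} d<δ)))))

^-⅓-cubed : ∀ m → fromℕ (suc m) * (suc m ^-⅓ * suc m ^-⅓ * suc m ^-⅓) ≈ 1ℝ
^-⅓-cubed m ε 0<ε = case shrink {ι (suc m) ℚ.* ι 7} {ε} (ℚ.positive⁻¹ (ι (suc m) ℚ.* ι 7) {{ι7⁺ m}}) 0<ε of λ where
  (δ , 0<δ , eq) → case h-small δ 0<δ of λ where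
    (N , s) → N , λ k N≤k →
      squeeze (ι (suc m) ℚ.* cubeℚ (q m k)) (ι (suc m) ℚ.* cubeℚ (q m k ℚ.+ h k)) (ι (suc m) ℚ.* ι 7) (h k) ε
        0<ε (q-lower m k) (q-upper m k)
        (cubeℚ-expand (ι (suc m)) (q m k) (h k) (ι⁺ (suc m)) (0≤q m k) (ℚ.<⇒≤ (0<h k)) (q≤1 m k) (h≤1 k))
        δ (ι7⁺ m) eq (s k N≤k)
Matrix : ℕ → Set
Matrix n = Fin n → Fin n → ℝ

_·_ : ∀ {n} → Matrix n → Vector ℝ n → Vector ℝ n
_·_ {n} M v i = ∑[ j < n ] (M i j * v j)

LinearlyIndependent : ∀ {m n} → (Fin m → Vector ℝ n) → Set
LinearlyIndependent {m} {n} v = (c : Vector ℝ m) →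
  (∀ k → ∑[ i < m ] (c i * v i k) ≈ 0ℝ) → ∀ i → c i ≈ 0ℝ

-- The n real eigenvalues of a diagonalisable matrix, listed in increasing order
-- and with multiplicity; the multiplicities are accounted for by requiring the
-- n corresponding eigenvectors to be linearly independent.
record Spectrum {n : ℕ} (M : Matrix n) : Set where
  field
    eigenvalue  : Fin n → ℝ
    eigenvector : Fin n → Vector ℝ n
    isEigen     : ∀ i k → (M · eigenvector i) k ≈ eigenvalue i * eigenvector i k
    independent : LinearlyIndependent eigenvector
    sorted      : ∀ i j → i Fin.≤ j → eigenvalue i ≤ eigenvalue j

record SimpleGraph (n : ℕ) : Set where
  field
    adjacent  : Fin n → Fin n → Bool
    symmetric : ∀ i j → adjacent i j ≡ adjacent j i
    loopless  : ∀ i → adjacent i i ≡ false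

open SimpleGraph public

complement : ∀ {n} → SimpleGraph n → SimpleGraph n
complement G .adjacent i j = not (adjacent G i j) ∧ not ⌊ i Fin.≟ j ⌋
complement G .symmetric i j = cong₂ (λ a b → not a ∧ not b) (symmetric G i j) ≟-sym
  where
  ≟-sym : ⌊ i Fin.≟ j ⌋ ≡ ⌊ j Fin.≟ i ⌋
  ≟-sym with i Fin.≟ j | j Fin.≟ i
  ... | yes _   | yes _   = refl
  ... | no _    | no _    = refl
  ... | yes i≡j | no j≢i  = contradiction (sym i≡j) j≢i
  ... | no i≢j  | yes j≡i = contradiction (sym j≡i) i≢j
complement G .loopless i with i Fin.≟ i
... | yes _  = ∧-zeroʳ (not (adjacent G i i))
... | no i≢i = contradiction refl i≢i

adjacencyMatrix : ∀ {n} → SimpleGraph n → Matrix n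
adjacencyMatrix G i j = if adjacent G i j then 1ℝ else 0ℝ

degreeMatrix : ∀ {n} → SimpleGraph n → Matrix n
degreeMatrix {n} G i j =
  if ⌊ i Fin.≟ j ⌋ then ∑[ k < n ] adjacencyMatrix G i k else 0ℝ

laplacian : ∀ {n} → SimpleGraph n → Matrix n
laplacian G i j = degreeMatrix G i j - adjacencyMatrix G i j

-- The second smallest eigenvalue (index 1, counting from 0).
algebraicConnectivity : ∀ {n} (G : SimpleGraph n) → 2 ℕ.≤ n → Spectrum (laplacian G) → ℝ
algebraicConnectivity G 2≤n σ = Spectrum.eigenvalue σ (fromℕ< 2≤n)

{-# OPTIONS --safe #-}

-- Let x and y be eigenvectors of G and of its complement that are orthogonal to the constants and
-- belong to eigenvalues below 1 - ε. Scale them to norm 1, so that a typical entry has size n^(-1/2).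
-- Every pair of vertices is an edge of G or of the complement, and the energies of x and y are small.
-- Hence x and y are nowhere both large: otherwise such a vertex would pay at each of the
-- (at least n / 2) core vertices, where both are of typical size. Say that x peaks at i if
-- x i ² > 384 / (ε n). A peak i of x has a neighbour j at which y is high, y j ² > 24 / n: the energy
-- of y would otherwise exceed 1 - ε already at i, unless i has degree of order ε n, which a peak
-- cannot have. The edges from the peaks to the high vertices of y, together with those from the high
-- vertices to the core, therefore carry almost the whole norm of x, which contradicts the energy
-- bound, unless x has variance above ε / 4 on the vertices that are peaks of neither vector. The
-- same applies to y. But the product of the two variances is O(1 / (ε n)), since on these vertices
-- the differences of x and of y are O((ε n)^(-1/2)) and each pair is charged by x or by y. Hence
-- ε³ n is bounded.
module Submission where

open import Algebra.Bundles using (CommutativeRing)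
import Algebra.Properties.Semiring.Sum as SemiringSum
open import Data.Bool as Bool using (Bool; true; false; not; if_then_else_)
import Data.Bool.Properties as Bool
open import Data.Empty using (⊥; ⊥-elim)
open import Data.Fin as Fin using (Fin; zero; suc)
import Data.Fin.Properties as Fin
import Data.Integer as ℤ
import Data.Integer.Properties as ℤ
open import Data.List using ([]; _∷_)
open import Data.Nat as ℕ using (ℕ; zero; suc)
import Data.Nat.Coprimality as Coprime
import Data.Nat.Properties as ℕ
open import Data.Product using (_×_; _,_; proj₁; proj₂; ∃-syntax)
open import Data.Rational as ℚ using (ℚ; 0ℚ; 1ℚ)
import Data.Rational.Properties as ℚ
open import Data.Sum using (inj₁; inj₂)
open import Data.Vec.Functional as Vec using (Vector)
open import Function using (_∘_)
open import Relation.Binary.PropositionalEquality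
  using (_≡_; _≢_; refl; sym; trans; cong; cong₂; subst; subst₂)
open import Relation.Nullary using (¬_; Dec; yes; no; contradiction)
open import Relation.Nullary.Decidable using (dec⇒maybe; _×-dec_; ⌊_⌋; isYes≗does)
open import Tactic.RingSolver using (solve; solve-∀)
open import Tactic.RingSolver.Core.AlmostCommutativeRing using (fromCommutativeRing)

-- Inequalities and finite sums over the rationals.

module Arithmetic where
  open import Data.Rational public using (_+_; _*_; _-_; -_; _≤_; _<_)
  open SemiringSum (CommutativeRing.semiring ℚ.+-*-commutativeRing) public
    using (sum; sum-syntax; sum-cong-≗; *-distribˡ-sum; ∑-comm; sum-replicate-zero)

  ring = fromCommutativeRing ℚ.+-*-commutativeRing (λ q → dec⇒maybe (0ℚ ℚ.≟ q))

  infix 9 #_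

  #_ : ℕ → ℚ
  # n = ℤ.+ n ℚ./ 1

  0≤# : ∀ n → 0ℚ ≤ # n
  0≤# n = ℚ.nonNegative⁻¹ (# n) {{ℚ.normalize-nonNeg n 1}}

  0<#suc : ∀ n → 0ℚ < # (suc n)
  0<#suc n = ℚ.positive⁻¹ (# (suc n)) {{ℚ.normalize-pos (suc n) 1}}

  0≤+ : ∀ {p q} → 0ℚ ≤ p → 0ℚ ≤ q → 0ℚ ≤ p + q
  0≤+ {p} {q} 0≤p 0≤q = ℚ.+-mono-≤ {0ℚ} {p} {0ℚ} {q} 0≤p 0≤q

  0≤* : ∀ {p q} → 0ℚ ≤ p → 0ℚ ≤ q → 0ℚ ≤ p * q
  0≤* {p} {q} 0≤p 0≤q = ℚ.nonNegative⁻¹ (p * q)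
    {{ℚ.nonNeg*nonNeg⇒nonNeg p {{ℚ.nonNegative 0≤p}} q {{ℚ.nonNegative 0≤q}}}}

  0<* : ∀ {p q} → 0ℚ < p → 0ℚ < q → 0ℚ < p * q
  0<* {p} {q} 0<p 0<q = ℚ.positive⁻¹ (p * q)
    {{ℚ.pos*pos⇒pos p {{ℚ.positive 0<p}} q {{ℚ.positive 0<q}}}}

  0<+ : ∀ {p q} → 0ℚ < p → 0ℚ ≤ q → 0ℚ < p + q
  0<+ {p} {q} 0<p 0≤q = ℚ.+-mono-<-≤ {0ℚ} {p} {0ℚ} {q} 0<p 0≤q

  0≤sq : ∀ p → 0ℚ ≤ p * p
  0≤sq p with ℚ.≤-total 0ℚ p
  ... | inj₁ 0≤p = 0≤* 0≤p 0≤p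
  ... | inj₂ p≤0 = ℚ.nonNegative⁻¹ (p * p)
    {{ℚ.nonPos*nonPos⇒nonPos p {{ℚ.nonPositive p≤0}} p {{ℚ.nonPositive p≤0}}}}

  0≤- : ∀ {p q} → p ≤ q → 0ℚ ≤ q - p
  0≤- {p} {q} p≤q = subst (_≤ q - p) (ℚ.+-inverseʳ p) (ℚ.+-monoˡ-≤ (- p) p≤q)

  0<- : ∀ {p q} → p < q → 0ℚ < q - p
  0<- {p} {q} p<q = subst (_< q - p) (ℚ.+-inverseʳ p) (ℚ.+-monoˡ-< (- p) p<q)

  -- Polynomial inequalities are proved in this form: the slack `r` is written as a combination of
  -- products of nonnegative terms, and the ring solver checks the identity.
  ≤-by : ∀ {p q r} → 0ℚ ≤ r → q ≡ p + r → p ≤ q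
  ≤-by {p} 0≤r refl = subst (_≤ p + _) (ℚ.+-identityʳ p) (ℚ.+-monoʳ-≤ p 0≤r)

  <-by : ∀ {p q r} → 0ℚ < r → q ≡ p + r → p < q
  <-by {p} 0<r refl = subst (_< p + _) (ℚ.+-identityʳ p) (ℚ.+-monoʳ-< p 0<r)

  -- The refuting counterpart of `≤-by`: a positive combination of the hypotheses that vanishes
  -- identically.
  absurd-by : ∀ {p} → 0ℚ < p → p ≡ 0ℚ → ⊥
  absurd-by 0<p p≡0 = ℚ.<-irrefl (sym p≡0) 0<p

  cancel : ∀ {r p q} → 0ℚ < r → r * p ≤ r * q → p ≤ q
  cancel {r} 0<r = ℚ.*-cancelˡ-≤-pos r {{ℚ.positive 0<r}}

  χ : Bool → ℚ
  χ true  = 1ℚ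
  χ false = 0ℚ

  0≤χ : ∀ b → 0ℚ ≤ χ b
  0≤χ true  = 0≤# 1
  0≤χ false = 0≤# 0

  χ≤1 : ∀ b → χ b ≤ 1ℚ
  χ≤1 true  = ℚ.≤-refl
  χ≤1 false = 0≤# 1

  [_] : ∀ {P : Set} → Dec P → ℚ
  [ P? ] = χ (Dec.does P?)

  [_]≡1 : ∀ {P : Set} (P? : Dec P) → P → [ P? ] ≡ 1ℚ
  [ yes _ ]≡1 _ = refl
  [ no ¬p ]≡1 p = contradiction p ¬p

  0≤[_] : ∀ {P : Set} (P? : Dec P) → 0ℚ ≤ [ P? ]
  0≤[ P? ] = 0≤χ (Dec.does P?)

  [_]≤1 : ∀ {P : Set} (P? : Dec P) → [ P? ] ≤ 1ℚ
  [ P? ]≤1 = χ≤1 (Dec.does P?)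

  gate : ∀ {P : Set} (P? : Dec P) {p q} → (P → p ≤ q) → [ P? ] * p ≤ [ P? ] * q
  gate (yes p) {x} {y} h =
    subst₂ _≤_ (sym (ℚ.*-identityˡ x)) (sym (ℚ.*-identityˡ y)) (h p)
  gate (no _) {x} {y} h = ℚ.≤-reflexive (trans (ℚ.*-zeroˡ x) (sym (ℚ.*-zeroˡ y)))

  sum-mono : ∀ {n} {f g : Vector ℚ n} → (∀ i → f i ≤ g i) → sum f ≤ sum g
  sum-mono {zero}  f≤g = ℚ.≤-refl
  sum-mono {suc n} f≤g = ℚ.+-mono-≤ (f≤g zero) (sum-mono (f≤g ∘ suc))

  sum-nonneg : ∀ {n} {f : Vector ℚ n} → (∀ i → 0ℚ ≤ f i) → 0ℚ ≤ sum f
  sum-nonneg {n} {f} 0≤f = subst (_≤ sum f) (sum-replicate-zero n) (sum-mono 0≤f)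

  term≤sum : ∀ {n} {f : Vector ℚ n} → (∀ i → 0ℚ ≤ f i) → ∀ i → f i ≤ sum f
  term≤sum {f = f} 0≤f zero = ≤-by (sum-nonneg (0≤f ∘ suc)) refl
  term≤sum {f = f} 0≤f (suc i) = ≤-by (0≤+ (0≤f zero) (0≤- (term≤sum (0≤f ∘ suc) i)))
    (lemma (f zero) (f (suc i)) (sum (f ∘ suc)))
    where
    lemma : ∀ a b s → a + s ≡ b + (a + (s - b))
    lemma = solve-∀ ring

  sum-linear : ∀ {k n} (c : Vector ℚ k) (f : Fin k → Vector ℚ n) →
    ∑[ j < n ] ∑[ t < k ] (c t * f t j) ≡ ∑[ t < k ] (c t * sum (f t))
  sum-linear c f = trans (∑-comm (λ j t → c t * f t j))
    (sum-cong-≗ λ t → sym (*-distribˡ-sum (c t) (f t)))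

  -- Sums a pointwise inequality that is linear in several families. On explicit lists the sum over
  -- `t` reduces to `c₀ * s₀ + (… + 0ℚ)`, which is where the trailing `0ℚ` in later statements comes
  -- from.
  sum-≤ : ∀ {k n} (l : ℚ) {g : Vector ℚ n} (c : Vector ℚ k) (f : Fin k → Vector ℚ n) →
    (∀ j → l * g j ≤ ∑[ t < k ] (c t * f t j)) →
    l * sum g ≤ ∑[ t < k ] (c t * sum (f t))
  sum-≤ l {g} c f h =
    subst₂ _≤_ (sym (*-distribˡ-sum l g)) (sum-linear c f) (sum-mono h)

  sum-≡ : ∀ {k n} {g : Vector ℚ n} (c : Vector ℚ k) (f : Fin k → Vector ℚ n) →
    (∀ j → g j ≡ ∑[ t < k ] (c t * f t j)) → sum g ≡ ∑[ t < k ] (c t * sum (f t))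
  sum-≡ c f h = trans (sum-cong-≗ h) (sum-linear c f)

  sum-select : ∀ {n} (i : Fin n) (f : Vector ℚ n) → ∑[ j < n ] ([ i Fin.≟ j ] * f j) ≡ f i
  sum-select {suc n} zero f = trans (cong₂ _+_ (ℚ.*-identityˡ (f zero))
      (trans (sum-cong-≗ λ j → ℚ.*-zeroˡ (f (suc j))) (sum-replicate-zero n)))
    (ℚ.+-identityʳ (f zero))
  sum-select {suc n} (suc i) f = trans
    (cong₂ _+_ (ℚ.*-zeroˡ (f zero)) (sum-select i (f ∘ suc)))
    (ℚ.+-identityˡ (f (suc i)))

  -- The double sum meets each cut pair in both orders. For weights `a`, `b` in the unit interval,
  -- `1 - a (1 - b) - b (1 - a) = a b + (1 - a) (1 - b)` is nonnegative.
  cut : ∀ {n} (f : Fin n → Fin n → ℚ) → (∀ i j → f i j ≡ f j i) → (∀ i j → 0ℚ ≤ f i j) →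
    (w : Vector ℚ n) → (∀ i → 0ℚ ≤ w i) → (∀ i → w i ≤ 1ℚ) →
    # 2 * ∑[ i < n ] ∑[ j < n ] (w i * (1ℚ - w j) * f i j) ≤ ∑[ i < n ] ∑[ j < n ] f i j
  cut {n} f f-sym 0≤f w 0≤w w≤1 = ≤-by (0≤- both) (lemma S (sum λ i → sum (f i)) S′ S≡S′)
    where
    S = ∑[ i < n ] ∑[ j < n ] (w i * (1ℚ - w j) * f i j)
    S′ = ∑[ i < n ] ∑[ j < n ] (w j * (1ℚ - w i) * f i j)
    S≡S′ : S ≡ S′
    S≡S′ = trans (∑-comm λ i j → w i * (1ℚ - w j) * f i j)
      (sum-cong-≗ λ j → sum-cong-≗ λ i → cong (w i * (1ℚ - w j) *_) (f-sym i j))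
    pointwise : ∀ a b p → 0ℚ ≤ a → 0ℚ ≤ b → a ≤ 1ℚ → b ≤ 1ℚ → 0ℚ ≤ p →
      1ℚ * (a * (1ℚ - b) * p) ≤ 1ℚ * p + (- 1ℚ * (b * (1ℚ - a) * p) + 0ℚ)
    pointwise a b p 0≤a 0≤b a≤1 b≤1 0≤p = ≤-by
      (0≤+ (0≤* (0≤* 0≤a 0≤b) 0≤p) (0≤* (0≤* (0≤- a≤1) (0≤- b≤1)) 0≤p))
      (solve (a ∷ b ∷ p ∷ []) ring)
    both : 1ℚ * S ≤ 1ℚ * (∑[ i < n ] ∑[ j < n ] f i j) + (- 1ℚ * S′ + 0ℚ)
    both = sum-≤ 1ℚ (1ℚ Vec.∷ - 1ℚ Vec.∷ Vec.[])
      ((λ i → sum (f i)) Vec.∷ (λ i → ∑[ j < n ] (w j * (1ℚ - w i) * f i j)) Vec.∷ Vec.[])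
      λ i → sum-≤ 1ℚ (1ℚ Vec.∷ - 1ℚ Vec.∷ Vec.[])
        (f i Vec.∷ (λ j → w j * (1ℚ - w i) * f i j) Vec.∷ Vec.[])
        λ j → pointwise (w i) (w j) (f i j) (0≤w i) (0≤w j) (w≤1 i) (w≤1 j) (0≤f i j)
    lemma : ∀ s e s′ → s ≡ s′ → e ≡ # 2 * s + ((1ℚ * e + (- 1ℚ * s′ + 0ℚ)) - 1ℚ * s)
    lemma s e .s refl = solve (s ∷ e ∷ []) ring

-- Energies and pairs of low-energy vectors.

module Energy where
  open Arithmetic

  -- Twice the Laplacian quadratic form of x on the graph with adjacency relation e.
  energy : ∀ {n} → (Fin n → Fin n → Bool) → Vector ℚ n → ℚ
  energy {n} e x = ∑[ i < n ] ∑[ j < n ] (χ (e i j) * ((x i - x j) * (x i - x j)))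

  norm² : ∀ {n} → Vector ℚ n → ℚ
  norm² {n} x = ∑[ i < n ] (x i * x i)

  card : ℕ → ℚ
  card n = ∑[ i < n ] 1ℚ

  0≤card : ∀ n → 0ℚ ≤ card n
  0≤card n = sum-nonneg {n} λ _ → 0≤# 1

  -- Rational stand-ins for the two eigenvectors: approximations satisfy no exact eigenvalue
  -- equation, so only the sums and the Rayleigh quotients are kept. The second relation is the
  -- plain negation of `edge`, loops included, because diagonal terms contribute nothing to an
  -- energy.
  record LowPair (n : ℕ) : Set where
    field
      edge     : Fin n → Fin n → Bool
      edge-sym : ∀ i j → edge i j ≡ edge j i
      x y      : Vector ℚ n
      ε        : ℚ
      0<ε      : 0ℚ < ε
      sum-x    : sum x ≡ 0ℚ
      sum-y    : sum y ≡ 0ℚ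
      0<norm-x : 0ℚ < norm² x
      0<norm-y : 0ℚ < norm² y
      energy-x : energy edge x ≤ # 2 * ((1ℚ - ε) * norm² x)
      energy-y : energy (λ i j → not (edge i j)) y ≤ # 2 * ((1ℚ - ε) * norm² y)

  swap : ∀ {n} → LowPair n → LowPair n
  swap P = record
    { edge = λ i j → not (edge i j) ; edge-sym = λ i j → cong not (edge-sym i j)
    ; x = y ; y = x ; ε = ε ; 0<ε = 0<ε ; sum-x = sum-y ; sum-y = sum-x
    ; 0<norm-x = 0<norm-y ; 0<norm-y = 0<norm-x ; energy-x = energy-y
    ; energy-y = subst (_≤ # 2 * ((1ℚ - ε) * norm² x)) (sum-cong-≗ λ i → sum-cong-≗ λ j →
        cong (λ b → χ b * ((x i - x j) * (x i - x j))) (sym (Bool.not-involutive (edge i j)))) energy-x }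
    where
    open LowPair P

  Δ²-sym : ∀ p q → (p - q) * (p - q) ≡ (q - p) * (q - p)
  Δ²-sym = solve-∀ ring

  0≤energy-term : ∀ b p → 0ℚ ≤ χ b * (p * p)
  0≤energy-term b p = 0≤* (0≤χ b) (0≤sq p)

  -- The cut around the single vertex `i`.
  row : ∀ {n} (e : Fin n → Fin n → Bool) (x : Vector ℚ n) → (∀ i j → e i j ≡ e j i) →
    ∀ i → # 2 * ∑[ j < n ] (χ (e i j) * ((x i - x j) * (x i - x j))) ≤ energy e x
  row {n} e x e-sym i = subst (λ s → # 2 * s ≤ energy e x) select
    (cut f f-sym (λ k j → 0≤energy-term (e k j) (x k - x j)) δ
      (λ k → 0≤[ i Fin.≟ k ]) (λ k → [ i Fin.≟ k ]≤1))
    where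
    f : Fin n → Fin n → ℚ
    f k j = χ (e k j) * ((x k - x j) * (x k - x j))
    f-sym : ∀ k j → f k j ≡ f j k
    f-sym k j = cong₂ (λ b d → χ b * d) (e-sym k j) (Δ²-sym (x k) (x j))
    δ : Vector ℚ n
    δ k = [ i Fin.≟ k ]
    vanish : ∀ c p → 1ℚ * (1ℚ - 1ℚ) * (c * ((p - p) * (p - p))) ≡ 1ℚ * (c * ((p - p) * (p - p)))
    vanish = solve-∀ ring
    keep : ∀ p → 1ℚ * (1ℚ - 0ℚ) * p ≡ 1ℚ * p
    keep = solve-∀ ring
    zero* : ∀ p q → 0ℚ * p * q ≡ 0ℚ * q
    zero* = solve-∀ ring
    pointwise : ∀ k j → δ k * (1ℚ - δ j) * f k j ≡ δ k * f k j
    pointwise k j with i Fin.≟ k | i Fin.≟ j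
    ... | yes refl | yes refl = vanish (χ (e i i)) (x i)
    ... | yes refl | no _     = keep (f i j)
    ... | no _     | yes _    = zero* (1ℚ - 1ℚ) (f k j)
    ... | no _     | no _     = zero* (1ℚ - 0ℚ) (f k j)
    select : ∑[ k < n ] ∑[ j < n ] (δ k * (1ℚ - δ j) * f k j) ≡ sum (f i)
    select = trans
      (sum-cong-≗ λ k → trans (sum-cong-≗ (pointwise k)) (sym (*-distribˡ-sum (δ k) (f k))))
      (sum-select i λ k → sum (f k))

  -- A vertex j at which z is large can have only few w-neighbours among the vertices where z is
  -- small, since each of them costs at least 8 Z / n.
  few-core-neighbours : ∀ {n} (z u w : Vector ℚ n) j → 0ℚ < norm² z →
    # 24 * norm² z ≤ card n * (z j * z j) →
    (∀ k → 0ℚ ≤ u k) → (∀ k → u k ≤ 1ℚ) → (∀ k → 0ℚ ≤ w k) →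
    (∀ k → u k * (card n * (z k * z k)) ≤ u k * (# 4 * norm² z)) →
    ∑[ k < n ] (w k * ((z j - z k) * (z j - z k))) ≤ norm² z →
    # 8 * ∑[ k < n ] (u k * w k) ≤ card n
  few-core-neighbours {n} z u w j 0<Z large 0≤u u≤1 0≤w small row≤ =
    cancel (0<* (0<#suc 1) 0<Z) (≤-by
      (0≤+ (0≤- summed) (0≤* (0≤* (0≤# 2) 0≤ν) (0≤- row≤)))
      (final (norm² z) (card n) (∑[ k < n ] (u k * w k)) (∑[ k < n ] (w k * ((z j - z k) * (z j - z k))))))
    where
    0≤ν : 0ℚ ≤ card n
    0≤ν = 0≤card n
    -- `2 (p - q)² = p² - 2 q² + (p - 2 q)²`, so a large `p` and a small `q` give at least
    -- `(24 - 2 · 4) Z / ν`.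
    pointwise : ∀ Z ν u w p q → 0ℚ ≤ ν → # 24 * Z ≤ ν * (p * p) → 0ℚ ≤ u → u ≤ 1ℚ → 0ℚ ≤ w →
      u * (ν * (q * q)) ≤ u * (# 4 * Z) →
      # 16 * Z * (u * w) ≤ # 2 * ν * (w * ((p - q) * (p - q))) + 0ℚ
    pointwise Z ν u w p q 0≤ν large 0≤u u≤1 0≤w small = ≤-by
      (0≤+ (0≤+ (0≤* (0≤* (0≤* (0≤* (0≤# 2) 0≤w) (0≤- u≤1)) 0≤ν) (0≤sq (p - q)))
                (0≤* (0≤* (0≤* 0≤w 0≤u) 0≤ν) (0≤sq (p - # 2 * q))))
           (0≤+ (0≤* (0≤* 0≤w 0≤u) (0≤- large)) (0≤* (0≤* (0≤# 2) 0≤w) (0≤- small))))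
      (solve (Z ∷ ν ∷ u ∷ w ∷ p ∷ q ∷ []) ring)
    summed : # 16 * norm² z * ∑[ k < n ] (u k * w k) ≤
      # 2 * card n * ∑[ k < n ] (w k * ((z j - z k) * (z j - z k))) + 0ℚ
    summed = sum-≤ (# 16 * norm² z) (# 2 * card n Vec.∷ Vec.[])
      ((λ k → w k * ((z j - z k) * (z j - z k))) Vec.∷ Vec.[])
      λ k → pointwise (norm² z) (card n) (u k) (w k) (z j) (z k) 0≤ν large
        (0≤u k) (u≤1 k) (0≤w k) (small k)
    final : ∀ Z ν s r → # 2 * Z * ν ≡
      # 2 * Z * (# 8 * s) + ((# 2 * ν * r + 0ℚ - # 16 * Z * s) + # 2 * ν * (Z - r))
    final = solve-∀ ring

-- High vertices, peaks and the core.

module Vertices {n : ℕ} (P : Energy.LowPair n) where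
  open Arithmetic
  open Energy
  open LowPair P

  X Y ν : ℚ
  X = norm² x
  Y = norm² y
  ν = card n

  a b : Fin n → Fin n → ℚ
  a i j = χ (edge i j)
  b i j = χ (not (edge i j))

  rowX rowY : Fin n → ℚ
  rowX i = ∑[ j < n ] (a i j * ((x i - x j) * (x i - x j)))
  rowY i = ∑[ j < n ] (b i j * ((y i - y j) * (y i - y j)))

  -- The thresholds `24 X / ν` and `384 X / (ε ν)` for the squared entries, cleared of denominators
  -- and homogeneous in `X`, so that no vector has to be normalised.
  HighX HighY PeakX PeakY : Fin n → Set
  HighX i = # 24 * X < ν * (x i * x i)
  HighY i = # 24 * Y < ν * (y i * y i)
  PeakX i = # 384 * X < ε * ν * (x i * x i)
  PeakY i = # 384 * Y < ε * ν * (y i * y i)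

  highY? : ∀ i → Dec (HighY i)
  highY? i = # 24 * Y ℚ.<? ν * (y i * y i)

  peakX? : ∀ i → Dec (PeakX i)
  peakX? i = # 384 * X ℚ.<? ε * ν * (x i * x i)

  peakY? : ∀ i → Dec (PeakY i)
  peakY? i = # 384 * Y ℚ.<? ε * ν * (y i * y i)

  lowX? : ∀ i → Dec (ν * (x i * x i) ≤ # 4 * X)
  lowX? i = ν * (x i * x i) ℚ.≤? # 4 * X

  lowY? : ∀ i → Dec (ν * (y i * y i) ≤ # 4 * Y)
  lowY? i = ν * (y i * y i) ℚ.≤? # 4 * Y

  lowX lowY core : Vector ℚ n
  lowX i = [ lowX? i ]
  lowY i = [ lowY? i ]
  core i = lowX i * lowY i

  0≤ν : 0ℚ ≤ ν
  0≤ν = 0≤card n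

  0≤ε : 0ℚ ≤ ε
  0≤ε = ℚ.<⇒≤ 0<ε

  0≤X : 0ℚ ≤ X
  0≤X = ℚ.<⇒≤ 0<norm-x

  0≤Y : 0ℚ ≤ Y
  0≤Y = ℚ.<⇒≤ 0<norm-y

  0<ν : 0ℚ < ν
  0<ν = nonempty n x 0<norm-x
    where
    nonempty : ∀ m (z : Vector ℚ m) → 0ℚ < norm² z → 0ℚ < card m
    nonempty zero    z 0<0 = contradiction 0<0 (ℚ.<-irrefl refl)
    nonempty (suc m) z _   = 0<+ (0<#suc 0) (0≤card m)

  a+b : ∀ i j → a i j + b i j ≡ 1ℚ
  a+b i j with edge i j
  ... | true  = refl
  ... | false = refl

  0≤a : ∀ i j → 0ℚ ≤ a i j
  0≤a i j = 0≤χ (edge i j)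

  0≤b : ∀ i j → 0ℚ ≤ b i j
  0≤b i j = 0≤χ (not (edge i j))

  rowX≤ : ∀ i → rowX i ≤ (1ℚ - ε) * X
  rowX≤ i = cancel (0<#suc 1) (ℚ.≤-trans (row edge x edge-sym i) energy-x)

  rowY≤ : ∀ i → rowY i ≤ (1ℚ - ε) * Y
  rowY≤ i = cancel (0<#suc 1)
    (ℚ.≤-trans (row (λ i j → not (edge i j)) y (λ i j → cong not (edge-sym i j)) i) energy-y)

  ε≤1 : ε ≤ 1ℚ
  ε≤1 = cancel (0<* (0<#suc 1) 0<norm-x) (≤-by (ℚ.≤-trans 0≤energy energy-x) (lemma X ε))
    where
    0≤energy : 0ℚ ≤ energy edge x
    0≤energy = sum-nonneg λ i → sum-nonneg λ j → 0≤energy-term (edge i j) (x i - x j)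
    lemma : ∀ X ε → # 2 * X * 1ℚ ≡ # 2 * X * ε + # 2 * ((1ℚ - ε) * X)
    lemma = solve-∀ ring

  0≤core : ∀ i → 0ℚ ≤ core i
  0≤core i = 0≤* 0≤[ lowX? i ]
                 0≤[ lowY? i ]

  core≤1 : ∀ i → core i ≤ 1ℚ
  core≤1 i = ≤-by (0≤+ (0≤- l≤1) (0≤* 0≤[ lowX? i ] (0≤- m≤1))) (lemma (lowX i) (lowY i))
    where
    l≤1 = [ lowX? i ]≤1
    m≤1 = [ lowY? i ]≤1
    lemma : ∀ l m → 1ℚ ≡ l * m + ((1ℚ - l) + l * (1ℚ - m))
    lemma = solve-∀ ring

  core-lowX : ∀ i → core i * (ν * (x i * x i)) ≤ core i * (# 4 * X)
  core-lowX i = ≤-by (0≤* 0≤[ lowY? i ]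
      (0≤- (gate (lowX? i) λ h → h)))
    (lemma (lowX i) (lowY i) (ν * (x i * x i)) (# 4 * X))
    where
    lemma : ∀ l m p q → l * m * q ≡ l * m * p + m * (l * q - l * p)
    lemma = solve-∀ ring

  core-lowY : ∀ i → core i * (ν * (y i * y i)) ≤ core i * (# 4 * Y)
  core-lowY i = ≤-by (0≤* 0≤[ lowX? i ]
      (0≤- (gate (lowY? i) λ h → h)))
    (lemma (lowX i) (lowY i) (ν * (y i * y i)) (# 4 * Y))
    where
    lemma : ∀ l m p q → l * m * q ≡ l * m * p + l * (m * q - m * p)
    lemma = solve-∀ ring

  -- Markov's inequality for x² and for y², each with a loss of at most n / 4 vertices.
  core-large : ν ≤ # 2 * sum core
  core-large = cancel (0<* (0<* (0<#suc 1) 0<norm-x) 0<norm-y)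
    (≤-by (0≤- summed) (final X Y ν (sum core)))
    where
    markov : ∀ {p q} → 0ℚ ≤ p → (p≤q? : Dec (p ≤ q)) → q ≤ q * [ p≤q? ] + p
    markov {p} {q} 0≤p (yes _) = ≤-by 0≤p (lem p q)
      where
      lem : ∀ p q → q * 1ℚ + p ≡ q + p
      lem = solve-∀ ring
    markov {p} {q} 0≤p (no p≰q) = ≤-by (ℚ.<⇒≤ (0<- (ℚ.≰⇒> p≰q))) (lem p q)
      where
      lem : ∀ p q → q * 0ℚ + p ≡ q + (p - q)
      lem = solve-∀ ring
    -- The union bound `1 ≤ l m + (1 - l) + (1 - m)` times `4 X Y`; Markov's inequality replaces
    -- `4 X (1 - l)` by `ν p` and `4 Y (1 - m)` by `ν q`.
    pointwise : ∀ X Y ν p q l m → 0ℚ ≤ X → 0ℚ ≤ Y → l ≤ 1ℚ → m ≤ 1ℚ →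
      # 4 * X ≤ # 4 * X * l + ν * p → # 4 * Y ≤ # 4 * Y * m + ν * q →
      # 4 * X * Y * 1ℚ ≤ # 4 * X * Y * (l * m) + (ν * Y * p + (ν * X * q + 0ℚ))
    pointwise X Y ν p q l m 0≤X 0≤Y l≤1 m≤1 hx hy = ≤-by
      (0≤+ (0≤+ (0≤* 0≤Y (0≤- hx)) (0≤* 0≤X (0≤- hy)))
           (0≤* (0≤* (0≤* (0≤# 4) 0≤X) 0≤Y) (0≤* (0≤- l≤1) (0≤- m≤1))))
      (solve (X ∷ Y ∷ ν ∷ p ∷ q ∷ l ∷ m ∷ []) ring)
    summed : # 4 * X * Y * ν ≤ # 4 * X * Y * sum core + (ν * Y * X + (ν * X * Y + 0ℚ))
    summed = sum-≤ (# 4 * X * Y) (# 4 * X * Y Vec.∷ ν * Y Vec.∷ ν * X Vec.∷ Vec.[])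
      (core Vec.∷ (λ i → x i * x i) Vec.∷ (λ i → y i * y i) Vec.∷ Vec.[])
      λ i → pointwise X Y ν (x i * x i) (y i * y i) (lowX i) (lowY i) 0≤X 0≤Y
        [ lowX? i ]≤1
        [ lowY? i ]≤1
        (markov (0≤* 0≤ν (0≤sq (x i))) (lowX? i))
        (markov (0≤* 0≤ν (0≤sq (y i))) (lowY? i))
    final : ∀ X Y ν s → # 2 * X * Y * (# 2 * s) ≡ # 2 * X * Y * ν +
      (# 4 * X * Y * s + (ν * Y * X + (ν * X * Y + 0ℚ)) - # 4 * X * Y * ν)
    final = solve-∀ ring

  ≤norm : ∀ {r Z} → 0ℚ ≤ Z → r ≤ (1ℚ - ε) * Z → r ≤ Z
  ≤norm {r} {Z} 0≤Z r≤ = ℚ.≤-trans r≤ (≤-by (0≤* 0≤ε 0≤Z) (lemma ε Z))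
    where
    lemma : ∀ ε Z → Z ≡ (1ℚ - ε) * Z + ε * Z
    lemma = solve-∀ ring

  coreA coreB : Fin n → ℚ
  coreA i = ∑[ k < n ] (core k * a i k)
  coreB i = ∑[ k < n ] (core k * b i k)

  few-core-X : ∀ i → HighX i → # 8 * coreA i ≤ ν
  few-core-X i high = few-core-neighbours x core (a i) i 0<norm-x (ℚ.<⇒≤ high)
    0≤core core≤1 (0≤a i) core-lowX (≤norm 0≤X (rowX≤ i))

  few-core-Y : ∀ i → HighY i → # 8 * coreB i ≤ ν
  few-core-Y i high = few-core-neighbours y core (b i) i 0<norm-y (ℚ.<⇒≤ high)
    0≤core core≤1 (0≤b i) core-lowY (≤norm 0≤Y (rowY≤ i))

  core-split : ∀ i → sum core ≡ 1ℚ * coreA i + (1ℚ * coreB i + 0ℚ)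
  core-split i = sum-≡ (1ℚ Vec.∷ 1ℚ Vec.∷ Vec.[])
    ((λ k → core k * a i k) Vec.∷ (λ k → core k * b i k) Vec.∷ Vec.[])
    λ k → lemma (core k) (a i k) (b i k) (a+b i k)
    where
    lemma : ∀ c p q → p + q ≡ 1ℚ → c ≡ 1ℚ * (c * p) + (1ℚ * (c * q) + 0ℚ)
    lemma c p q p+q≡1 = trans (sym (ℚ.*-identityʳ c)) (trans (cong (c *_) (sym p+q≡1))
      (solve (c ∷ p ∷ q ∷ []) ring))

  -- Such a vertex would have at most `ν / 8` core neighbours in the graph and at most as many in
  -- its negation, but together these are the whole core, of size at least `ν / 2`.
  HighX⇒¬HighY : ∀ i → HighX i → ¬ HighY i
  HighX⇒¬HighY i highX highY = absurd-by
    (0<+ (0<* (0<#suc 1) 0<ν)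
      (0≤+ (0≤+ (0≤- (few-core-X i highX)) (0≤- (few-core-Y i highY)))
           (0≤* (0≤# 4) (0≤- core-large))))
    (lemma ν (sum core) (coreA i) (coreB i) (core-split i))
    where
    lemma : ∀ ν s p q → s ≡ 1ℚ * p + (1ℚ * q + 0ℚ) →
      # 2 * ν + (((ν - # 8 * p) + (ν - # 8 * q)) + # 4 * (# 2 * s - ν)) ≡ 0ℚ
    lemma ν .(1ℚ * p + (1ℚ * q + 0ℚ)) p q refl = solve (ν ∷ p ∷ q ∷ []) ring

-- Neighbours and number of the peaks.

module Peaks {n : ℕ} (P : Energy.LowPair n) where
  open Arithmetic
  open Energy
  open LowPair P
  open Vertices P

  PeakX⇒HighX : ∀ i → PeakX i → HighX i
  PeakX⇒HighX i peak = <-by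
    (0<+ (0<- peak) (0≤+ (0≤* (0≤# 360) 0≤X) (0≤* (0≤- ε≤1) (0≤* 0≤ν (0≤sq (x i))))))
    (lemma X ε ν (x i * x i))
    where
    lemma : ∀ X ε ν p → ν * p ≡
      # 24 * X + ((ε * ν * p - # 384 * X) + (# 360 * X + (1ℚ - ε) * (ν * p)))
    lemma = solve-∀ ring

  sum-Δ² : ∀ (z : Vector ℚ n) p → sum z ≡ 0ℚ →
    ∑[ j < n ] ((p - z j) * (p - z j)) ≡ ν * (p * p) + norm² z
  sum-Δ² z p sum-z = trans
    (sum-≡ (p * p Vec.∷ - (# 2 * p) Vec.∷ 1ℚ Vec.∷ Vec.[])
      ((λ _ → 1ℚ) Vec.∷ z Vec.∷ (λ j → z j * z j) Vec.∷ Vec.[]) λ j → pointwise p (z j))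
    (final (sum z) sum-z)
    where
    pointwise : ∀ p q → (p - q) * (p - q) ≡
      p * p * 1ℚ + (- (# 2 * p) * q + (1ℚ * (q * q) + 0ℚ))
    pointwise = solve-∀ ring
    expand : ∀ ν p N → p * p * ν + (- (# 2 * p) * 0ℚ + (1ℚ * N + 0ℚ)) ≡ ν * (p * p) + N
    expand = solve-∀ ring
    final : ∀ s → s ≡ 0ℚ →
      p * p * ν + (- (# 2 * p) * s + (1ℚ * norm² z + 0ℚ)) ≡ ν * (p * p) + norm² z
    final .0ℚ refl = expand ν p (norm² z)

  degree : Fin n → ℚ
  degree i = ∑[ j < n ] (a i j * 1ℚ)

  -- Sum `x i ² ≤ 2 (x i - x j)² + 2 x j ²` over the neighbours `j`: the first part is at most `2 X`
  -- by the energy bound, the second by the norm.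
  degree*x²≤ : ∀ i → degree i * (x i * x i) ≤ # 4 * X
  degree*x²≤ i = ≤-by (0≤+ (0≤- summed) (0≤* (0≤# 2) (0≤- (≤norm 0≤X (rowX≤ i)))))
    (final X (degree i) (x i * x i) (rowX i))
    where
    pointwise : ∀ e p q → p * p * (χ e * 1ℚ) ≤
      # 2 * (χ e * ((p - q) * (p - q))) + (# 2 * (q * q) + 0ℚ)
    pointwise true p q = ≤-by (0≤sq (p - # 2 * q)) (solve (p ∷ q ∷ []) ring)
    pointwise false p q = ≤-by (0≤* (0≤# 2) (0≤sq q)) (solve (p ∷ q ∷ []) ring)
    summed : x i * x i * degree i ≤ # 2 * rowX i + (# 2 * X + 0ℚ)
    summed = sum-≤ (x i * x i) (# 2 Vec.∷ # 2 Vec.∷ Vec.[])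
      ((λ j → a i j * ((x i - x j) * (x i - x j))) Vec.∷ (λ j → x j * x j) Vec.∷ Vec.[])
      λ j → pointwise (edge i j) (x i) (x j)
    final : ∀ X d p r → # 4 * X ≡ d * p + ((# 2 * r + (# 2 * X + 0ℚ) - p * d) + # 2 * (X - r))
    final = solve-∀ ring

  -- If y were small on all neighbours of i, then i would be almost dominating in the complement
  -- unless its degree is of order ε n; but a large degree forces x i to be small.
  peak-neighbour : ∀ i → PeakX i → ∃[ j ] (edge i j ≡ true × HighY j)
  peak-neighbour i peak with Fin.any? (λ j → (edge i j Bool.≟ true) ×-dec highY? j)
  ... | yes j = j
  -- The degree would be at least `ε ν / 96`, and `degree*x²≤` then gives `ε ν x i ² ≤ 96 · 4 X`.
  -- This fixes the constant `384` in the definition of a peak.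
  ... | no ¬j = ⊥-elim (absurd-by
      (0<+ (0<- peak) (0≤+ (0≤* (0≤- εν≤degree) (0≤sq (x i))) (0≤* (0≤# 96) (0≤- (degree*x²≤ i)))))
      (final X (ε * ν) (degree i) (x i * x i)))
    where
    final : ∀ X k d p → (k * p - # 384 * X) + ((# 96 * d - k) * p + # 96 * (# 4 * X - d * p)) ≡ 0ℚ
    final = solve-∀ ring
    lowYᵢ : ν * (y i * y i) ≤ # 24 * Y
    lowYᵢ = ℚ.≮⇒≥ (HighX⇒¬HighY i (PeakX⇒HighX i peak))
    rowA : ℚ
    rowA = ∑[ j < n ] (a i j * ((y i - y j) * (y i - y j)))
    pointwise : ∀ ν Y e p q → 0ℚ ≤ ν → ν * (p * p) ≤ # 24 * Y → (e ≡ true → ν * (q * q) ≤ # 24 * Y) →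
      ν * (χ e * ((p - q) * (p - q))) ≤ # 96 * Y * (χ e * 1ℚ) + 0ℚ
    pointwise ν Y true p q 0≤ν p≤ q≤ = ≤-by
      (0≤+ (0≤+ (0≤* (0≤# 2) (0≤- p≤)) (0≤* (0≤# 2) (0≤- (q≤ refl)))) (0≤* 0≤ν (0≤sq (p + q))))
      (solve (ν ∷ Y ∷ p ∷ q ∷ []) ring)
    pointwise ν Y false p q 0≤ν _ _ = ≤-by (0≤# 0) (solve (ν ∷ Y ∷ p ∷ q ∷ []) ring)
    rowA≤ : ν * rowA ≤ # 96 * Y * degree i + 0ℚ
    rowA≤ = sum-≤ ν (# 96 * Y Vec.∷ Vec.[]) ((λ j → a i j * 1ℚ) Vec.∷ Vec.[])
      λ j → pointwise ν Y (edge i j) (y i) (y j) 0≤ν lowYᵢ λ eᵢⱼ → ℚ.≮⇒≥ λ highYⱼ → ¬j (j , eᵢⱼ , highYⱼ)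
    split : ν * (y i * y i) + Y ≡ 1ℚ * rowA + (1ℚ * rowY i + 0ℚ)
    split = trans (sym (sum-Δ² y (y i) sum-y))
      (sum-≡ (1ℚ Vec.∷ 1ℚ Vec.∷ Vec.[])
        ((λ j → a i j * ((y i - y j) * (y i - y j))) Vec.∷ (λ j → b i j * ((y i - y j) * (y i - y j))) Vec.∷ Vec.[])
        λ j → lemma (edge i j) ((y i - y j) * (y i - y j)))
      where
      lemma : ∀ e p → p ≡ 1ℚ * (χ e * p) + (1ℚ * (χ (not e) * p) + 0ℚ)
      lemma true p = solve (p ∷ []) ring
      lemma false p = solve (p ∷ []) ring
    -- By `split`, `rowA` is at least `Y - rowY i`, hence at least `ε Y`. Each neighbour contributes
    -- at most `(2 · 24 + 2 · 24) Y / ν` to it.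
    εν≤degree : ε * ν ≤ # 96 * degree i
    εν≤degree = cancel 0<norm-y (≤-by
      (0≤+ (0≤- rowA≤) (0≤* 0≤ν (0≤+ (0≤- (rowY≤ i)) (0≤* 0≤ν (0≤sq (y i))))))
      (lemma Y ε ν (degree i) rowA (rowY i) (ν * (y i * y i)) split))
      where
      lemma : ∀ Y ε ν d r s q → q + Y ≡ 1ℚ * r + (1ℚ * s + 0ℚ) →
        Y * (# 96 * d) ≡ Y * (ε * ν) + ((# 96 * Y * d + 0ℚ - ν * r) + ν * ((1ℚ - ε) * Y - s + q))
      lemma Y ε ν d r s q eq = trans (expand Y ε ν d r s q)
        (trans (cong (λ t → Y * (ε * ν) + ((# 96 * Y * d + 0ℚ - ν * r) + ν * ((1ℚ - ε) * Y - s + q))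
                  + ν * (t - (q + Y))) (sym eq))
          (collapse (Y * (ε * ν) + ((# 96 * Y * d + 0ℚ - ν * r) + ν * ((1ℚ - ε) * Y - s + q))) ν (q + Y)))
        where
        expand : ∀ Y ε ν d r s q → Y * (# 96 * d) ≡
          Y * (ε * ν) + ((# 96 * Y * d + 0ℚ - ν * r) + ν * ((1ℚ - ε) * Y - s + q))
            + ν * ((1ℚ * r + (1ℚ * s + 0ℚ)) - (q + Y))
        expand = solve-∀ ring
        collapse : ∀ p ν t → p + ν * (t - t) ≡ p
        collapse = solve-∀ ring

  -- Markov's inequality for `x²` at the peak threshold.
  peak-count : # 384 * ∑[ i < n ] ([ peakX? i ] * 1ℚ) ≤ ε * ν
  peak-count = cancel 0<norm-x (≤-by (0≤- summed) (final X (ε * ν) (∑[ i < n ] ([ peakX? i ] * 1ℚ))))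
    where
    pointwise : ∀ {k X p} → 0ℚ ≤ X → 0ℚ ≤ k * p → (P? : Dec (# 384 * X < k * p)) →
      # 384 * X * ([ P? ] * 1ℚ) ≤ k * p + 0ℚ
    pointwise {k} {X} {p} 0≤X 0≤kp (yes h) = ≤-by (0≤- (ℚ.<⇒≤ h)) (solve (k ∷ X ∷ p ∷ []) ring)
    pointwise {k} {X} {p} 0≤X 0≤kp (no _)  = ≤-by 0≤kp (solve (k ∷ X ∷ p ∷ []) ring)
    summed : # 384 * X * ∑[ i < n ] ([ peakX? i ] * 1ℚ) ≤ ε * ν * X + 0ℚ
    summed = sum-≤ (# 384 * X) (ε * ν Vec.∷ Vec.[]) ((λ i → x i * x i) Vec.∷ Vec.[])
      λ i → pointwise {ε * ν} {X} {x i * x i} 0≤X (0≤* (0≤* 0≤ε 0≤ν) (0≤sq (x i))) (peakX? i)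
    final : ∀ X k s → X * k ≡ X * (# 384 * s) + (k * X + 0ℚ - # 384 * X * s)
    final = solve-∀ ring

-- The calm vertices must carry variance.

module Concentration where
  open Arithmetic
  open Energy

  not-low : ∀ {X p} → 0ℚ ≤ X → # 24 * X < p → ¬ (p ≤ # 4 * X)
  not-low {X} {p} 0≤X 24X< ≤4X = absurd-by
    (0<+ (0<- 24X<) (0≤+ (0≤- ≤4X) (0≤* (0≤# 20) 0≤X))) (solve (X ∷ p ∷ []) ring)

  -- Used with `A` a peak of `x`, `B` a high vertex of `y`, and `L`, `M` the two conditions of the
  -- core. Arbitrary decisions are taken as arguments so that the case analysis makes the indicators
  -- compute.
  exclusive : ∀ {A B L M : Set} (A? : Dec A) (B? : Dec B) (L? : Dec L) (M? : Dec M) →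
    (A → ¬ B) → (A → ¬ L) → (B → ¬ M) → [ A? ] + [ L? ] * [ M? ] + [ B? ] ≤ 1ℚ
  exclusive (yes a) (yes b) _ _ a⇒¬b _ _ = contradiction b (a⇒¬b a)
  exclusive (yes a) (no _) (yes l) _ _ a⇒¬l _ = contradiction l (a⇒¬l a)
  exclusive (yes _) (no _) (no _) M? _ _ _ = ℚ.≤-reflexive (lemma [ M? ])
    where
    lemma : ∀ m → 1ℚ + 0ℚ * m + 0ℚ ≡ 1ℚ
    lemma = solve-∀ ring
  exclusive (no _) (yes b) _ (yes m) _ _ b⇒¬m = contradiction m (b⇒¬m b)
  exclusive (no _) (yes _) L? (no _) _ _ _ = ℚ.≤-reflexive (lemma [ L? ])
    where
    lemma : ∀ l → 0ℚ + l * 0ℚ + 1ℚ ≡ 1ℚ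
    lemma = solve-∀ ring
  exclusive (no _) (no _) L? M? _ _ _ =
    ≤-by (0≤+ (0≤- [ L? ]≤1) (0≤* 0≤[ L? ] (0≤- [ M? ]≤1))) (lemma [ L? ] [ M? ])
    where
    lemma : ∀ l m → 1ℚ ≡ 0ℚ + l * m + 0ℚ + ((1ℚ - l) + l * (1ℚ - m))
    lemma = solve-∀ ring

  -- What the argument uses about the indicator of the vertices that are peaks of neither vector.
  -- These properties pass to `swap P` with the same `r`, so that both variances refer to one
  -- weight.
  record Calm {n} (P : LowPair n) (r : Vector ℚ n) : Set where
    open Vertices P
    field
      nonneg : ∀ i → 0ℚ ≤ r i
      r≤1    : ∀ i → r i ≤ 1ℚ
      core≤r : ∀ i → core i ≤ r i
      cover  : ∀ i → 1ℚ ≤ r i + [ peakX? i ] + [ peakY? i ]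

  Calm-swap : ∀ {n} {P : LowPair n} {r} → Calm P r → Calm (swap P) r
  Calm-swap {P = P} {r} calm = record
    { nonneg = nonneg
    ; r≤1 = r≤1
    ; core≤r = λ i → subst (_≤ r i) (ℚ.*-comm (lowX i) (lowY i)) (core≤r i)
    ; cover = λ i → subst (1ℚ ≤_) (lemma (r i) [ peakX? i ] [ peakY? i ]) (cover i) }
    where
    open Vertices P
    open Calm calm
    lemma : ∀ p q s → p + q + s ≡ p + s + q
    lemma = solve-∀ ring

  -- When `c` satisfies `IsMean`, this is the variance of `z` under the weights `r`, without the
  -- division by `sum r`.
  spread : ∀ {n} → Vector ℚ n → Vector ℚ n → ℚ → ℚ
  spread {n} r z c = ∑[ i < n ] (r i * ((z i - c) * (z i - c)))

  IsMean : ∀ {n} → Vector ℚ n → Vector ℚ n → ℚ → Set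
  IsMean {n} r z c = sum r * c ≡ ∑[ i < n ] (r i * z i)

  module _ {n} {P : LowPair n} {r : Vector ℚ n} (calm : Calm P r) where
    open LowPair P
    open Vertices P
    open Peaks P
    open Calm calm
    private
      module Swapped = Peaks (swap P)

    module _ (c : ℚ) (mean : IsMean r x c) where

      F : ℚ
      F = spread r x c

      0≤F : 0ℚ ≤ F
      0≤F = sum-nonneg λ i → 0≤* (nonneg i) (0≤sq (x i - c))

      -- The variance `S - c² sum r` is nonnegative, `S` is at most `X`, and `sum r` is at least the
      -- core size, hence at least `ν / 2`.
      mean²≤ : ν * (c * c) ≤ # 2 * X
      mean²≤ = ≤-by
        (0≤+ (0≤+ (0≤* (0≤# 2) (0≤- S≤X)) (0≤* (0≤# 2) 0≤F))
          (0≤* (0≤+ (0≤- core-large) (0≤* (0≤# 2) (0≤- (sum-mono core≤r)))) (0≤sq c)))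
        (final X S (∑[ i < n ] (r i * x i)) mean F F≡)
        where
        S = ∑[ i < n ] (r i * (x i * x i))
        S≤X : S ≤ X
        S≤X = sum-mono λ i → ≤-by (0≤* (0≤- (r≤1 i)) (0≤sq (x i))) (lemma (r i) (x i * x i))
          where
          lemma : ∀ r p → p ≡ r * p + (1ℚ - r) * p
          lemma = solve-∀ ring
        F≡ : F ≡ 1ℚ * S + (- (# 2 * c) * ∑[ i < n ] (r i * x i) + (c * c * sum r + 0ℚ))
        F≡ = sum-≡ (1ℚ Vec.∷ - (# 2 * c) Vec.∷ c * c Vec.∷ Vec.[])
          ((λ i → r i * (x i * x i)) Vec.∷ (λ i → r i * x i) Vec.∷ r Vec.∷ Vec.[])
          λ i → lemma (r i) (x i) c
          where
          lemma : ∀ r p c → r * ((p - c) * (p - c)) ≡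
            1ℚ * (r * (p * p)) + (- (# 2 * c) * (r * p) + (c * c * r + 0ℚ))
          lemma = solve-∀ ring
        final : ∀ X S M → sum r * c ≡ M → ∀ F → F ≡ 1ℚ * S + (- (# 2 * c) * M + (c * c * sum r + 0ℚ)) →
          # 2 * X ≡ ν * (c * c) + (# 2 * (X - S) + # 2 * F
            + (# 2 * sum core - ν + # 2 * (sum r - sum core)) * (c * c))
        final X S .(sum r * c) refl .(1ℚ * S + (- (# 2 * c) * (sum r * c) + (c * c * sum r + 0ℚ))) refl =
          lemma X S (sum r) c ν (sum core)
          where
          lemma : ∀ X S r c ν k → # 2 * X ≡ ν * (c * c) + (# 2 * (X - S)
            + # 2 * (1ℚ * S + (- (# 2 * c) * (r * c) + (c * c * r + 0ℚ)))
            + (# 2 * k - ν + # 2 * (r - k)) * (c * c))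
          lemma = solve-∀ ring

      f : Fin n → Fin n → ℚ
      f i j = a i j * ((x i - x j) * (x i - x j))

      0≤f : ∀ i j → 0ℚ ≤ f i j
      0≤f i j = 0≤energy-term (edge i j) (x i - x j)

      f-sym : ∀ i j → f i j ≡ f j i
      f-sym i j = cong₂ (λ e d → χ e * d) (edge-sym i j) (Δ²-sym (x i) (x j))

      peak high : Vector ℚ n
      peak i = [ peakX? i ]
      high i = [ highY? i ]

      peakRow coreRow : Fin n → ℚ
      peakRow i = ∑[ j < n ] (high j * f i j)
      coreRow j = ∑[ k < n ] (core k * f j k)

      peakEnergy coreEnergy : ℚ
      peakEnergy = ∑[ i < n ] (peak i * peakRow i)
      coreEnergy = ∑[ j < n ] (high j * coreRow j)

      0≤coreTerm : ∀ j → 0ℚ ≤ high j * coreRow j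
      0≤coreTerm j = 0≤* 0≤[ highY? j ] (sum-nonneg λ k → 0≤* (0≤core k) (0≤f j k))

      0≤coreEnergy : 0ℚ ≤ coreEnergy
      0≤coreEnergy = sum-nonneg 0≤coreTerm

      -- Both energies count only edges leaving the set of vertices at which y is high.
      energies≤ : peakEnergy + coreEnergy ≤ (1ℚ - ε) * X
      energies≤ = cancel (0<#suc 1) (ℚ.≤-trans
        (≤-by (0≤* (0≤# 2) (0≤- summed)) (final peakEnergy coreEnergy across))
        (ℚ.≤-trans (cut f f-sym 0≤f high (λ i → 0≤[ highY? i ]) (λ i → [ highY? i ]≤1)) energy-x))
        where
        across = ∑[ j < n ] ∑[ k < n ] (high j * (1ℚ - high k) * f j k)
        transposed : peakEnergy ≡ ∑[ j < n ] ∑[ k < n ] (peak k * (high j * f j k))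
        transposed = trans (sum-cong-≗ λ i → *-distribˡ-sum (peak i) (λ j → high j * f i j))
          (trans (∑-comm λ i j → peak i * (high j * f i j))
            (sum-cong-≗ λ j → sum-cong-≗ λ i → cong (λ t → peak i * (high j * t)) (f-sym i j)))
        disjoint : ∀ k → peak k + core k + high k ≤ 1ℚ
        disjoint k = exclusive (peakX? k) (highY? k) (lowX? k) (lowY? k)
          (λ p → HighX⇒¬HighY k (PeakX⇒HighX k p))
          (λ p → not-low 0≤X (PeakX⇒HighX k p))
          (λ p → not-low 0≤Y p)
        -- A vertex that is a peak or in the core is not high, and it is only one of the two. So
        -- `p + k ≤ 1 - h′`, and both kinds of edge fit into one cut.
        pointwise : ∀ p h k h′ t → p + k + h′ ≤ 1ℚ → 0ℚ ≤ h → 0ℚ ≤ t →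
          1ℚ * (p * (h * t)) ≤ 1ℚ * (h * (1ℚ - h′) * t) + (- h * (k * t) + 0ℚ)
        pointwise p h k h′ t ≤1 0≤h 0≤t = ≤-by (0≤* (0≤* 0≤h 0≤t) (0≤- ≤1))
          (solve (p ∷ h ∷ k ∷ h′ ∷ t ∷ []) ring)
        assoc : ∀ s h c → 1ℚ * s + (- h * c + 0ℚ) ≡ 1ℚ * s + (- 1ℚ * (h * c) + 0ℚ)
        assoc = solve-∀ ring
        summed : 1ℚ * peakEnergy ≤ 1ℚ * across + (- 1ℚ * coreEnergy + 0ℚ)
        summed = subst (λ t → 1ℚ * t ≤ 1ℚ * across + (- 1ℚ * coreEnergy + 0ℚ)) (sym transposed)
          (sum-≤ 1ℚ (1ℚ Vec.∷ - 1ℚ Vec.∷ Vec.[])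
            ((λ j → ∑[ k < n ] (high j * (1ℚ - high k) * f j k)) Vec.∷ (λ j → high j * coreRow j) Vec.∷ Vec.[])
            λ j → subst (1ℚ * ∑[ k < n ] (peak k * (high j * f j k)) ≤_)
              (assoc (∑[ k < n ] (high j * (1ℚ - high k) * f j k)) (high j) (coreRow j))
              (sum-≤ 1ℚ (1ℚ Vec.∷ - high j Vec.∷ Vec.[])
                ((λ k → high j * (1ℚ - high k) * f j k) Vec.∷ (λ k → core k * f j k) Vec.∷ Vec.[])
                λ k → pointwise (peak k) (high j) (core k) (high k) (f j k)
                  (disjoint k) 0≤[ highY? j ] (0≤f j k)))
        final : ∀ p c s → # 2 * s ≡ # 2 * (p + c) + # 2 * (1ℚ * s + (- 1ℚ * c + 0ℚ) - 1ℚ * p)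
        final = solve-∀ ring

      -- At least `ν / 2 - ν / 8` core vertices are neighbours of `j` in the graph. Average `(x j -
      -- c)² ≤ 2 (x j - x k)² + 2 (x k - c)²` over them.
      high-near-mean : ∀ j → HighY j → # 3 * ν * ((x j - c) * (x j - c)) ≤ # 16 * (coreEnergy + F)
      high-near-mean j highⱼ = ≤-by
        (0≤+ (0≤+ (0≤* (0≤# 8) (0≤- summed)) (0≤* (0≤# 16) (0≤- row≤)))
          (0≤* (0≤+ (0≤- (few-core-Y j highⱼ)) (0≤* (0≤# 4) (0≤- core-large))) (0≤sq (x j - c))))
        (final ν ((x j - c) * (x j - c)) (sum core) (coreA j) (coreB j) (core-split j) (coreRow j) coreEnergy F)
        where
        pointwise : ∀ e κ r p q c → κ ≤ r → 0ℚ ≤ κ →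
          (p - c) * (p - c) * (κ * χ e) ≤
          # 2 * (κ * (χ e * ((p - q) * (p - q)))) + (# 2 * (r * ((q - c) * (q - c))) + 0ℚ)
        pointwise true κ r p q c κ≤r 0≤κ = ≤-by
          (0≤+ (0≤* 0≤κ (0≤sq (p - # 2 * q + c))) (0≤* (0≤* (0≤# 2) (0≤- κ≤r)) (0≤sq (q - c))))
          (solve (κ ∷ r ∷ p ∷ q ∷ c ∷ []) ring)
        pointwise false κ r p q c κ≤r 0≤κ = ≤-by
          (0≤* (0≤* (0≤# 2) (ℚ.≤-trans 0≤κ κ≤r)) (0≤sq (q - c)))
          (solve (κ ∷ r ∷ p ∷ q ∷ c ∷ []) ring)
        summed : (x j - c) * (x j - c) * coreA j ≤ # 2 * coreRow j + (# 2 * F + 0ℚ)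
        summed = sum-≤ ((x j - c) * (x j - c)) (# 2 Vec.∷ # 2 Vec.∷ Vec.[])
          ((λ k → core k * f j k) Vec.∷ (λ k → r k * ((x k - c) * (x k - c))) Vec.∷ Vec.[])
          λ k → pointwise (edge j k) (core k) (r k) (x j) (x k) c (core≤r k) (0≤core k)
        row≤ : coreRow j ≤ coreEnergy
        row≤ = subst (_≤ coreEnergy)
          (trans (cong (_* coreRow j) ([ highY? j ]≡1 highⱼ)) (ℚ.*-identityˡ (coreRow j)))
          (term≤sum 0≤coreTerm j)
        final : ∀ ν d s p q → s ≡ 1ℚ * p + (1ℚ * q + 0ℚ) → ∀ t e F →
          # 16 * (e + F) ≡ # 3 * ν * d + (# 8 * (# 2 * t + (# 2 * F + 0ℚ) - d * p) + # 16 * (e - t)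
            + ((ν - # 8 * q) + # 4 * (# 2 * s - ν)) * d)
        final ν d .(1ℚ * p + (1ℚ * q + 0ℚ)) p q refl t e F =
          solve (ν ∷ d ∷ p ∷ q ∷ t ∷ e ∷ F ∷ []) ring

      -- Go from `x i` to `x j` at a high neighbour `j`, then to `c`. The squares are split as
      -- `(1 + ε / 4)` and `(1 + 4 / ε)`: the first factor must stay close to 1 so that the saving
      -- `ε` in the energy bound survives; the second is affordable because peaks are few.
      peak-deviation : ∀ i → PeakX i → # 12 * (ε * ν) * ((x i - c) * (x i - c)) ≤
        # 3 * (ε * ν) * (# 4 + ε) * peakRow i + # 320 * (coreEnergy + F)
      peak-deviation i peakᵢ with peak-neighbour i peakᵢ
      ... | j , eᵢⱼ , highⱼ = ≤-by
        (0≤+ (0≤+ (0≤* (0≤* (0≤# 3) 0≤ν) (0≤- (weighted ε c (x i) (x j) 0≤ε ε≤1)))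
                  (0≤* (0≤# 20) (0≤- (high-near-mean j highⱼ))))
             (0≤* (0≤* (0≤* (0≤# 3) (0≤* 0≤ε 0≤ν)) (0≤+ (0≤# 4) 0≤ε)) (0≤- edge≤)))
        (final ε ν ((x i - c) * (x i - c)) ((x i - x j) * (x i - x j)) ((x j - c) * (x j - c))
          (peakRow i) (coreEnergy + F))
        where
        weighted : ∀ ε c p q → 0ℚ ≤ ε → ε ≤ 1ℚ → # 4 * (ε * ((p - c) * (p - c))) ≤
          ε * (# 4 + ε) * ((p - q) * (p - q)) + # 20 * ((q - c) * (q - c))
        weighted ε c p q 0≤ε ε≤1 = ≤-by
          (0≤+ (0≤sq (ε * (p - q) - # 4 * (q - c)))
               (0≤* (0≤* (0≤# 4) (0≤- ε≤1)) (0≤sq (q - c))))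
          (solve (ε ∷ c ∷ p ∷ q ∷ []) ring)
        edge≤ : (x i - x j) * (x i - x j) ≤ peakRow i
        edge≤ = subst (_≤ peakRow i)
          (trans (cong₂ (λ h e → h * (χ e * ((x i - x j) * (x i - x j)))) ([ highY? j ]≡1 highⱼ) eᵢⱼ)
            (lemma ((x i - x j) * (x i - x j))))
          (term≤sum (λ k → 0≤* 0≤[ highY? k ] (0≤f i k)) j)
          where
          lemma : ∀ p → 1ℚ * (1ℚ * p) ≡ p
          lemma = solve-∀ ring
        final : ∀ ε ν p q s t g → # 3 * (ε * ν) * (# 4 + ε) * t + # 320 * g ≡ # 12 * (ε * ν) * p
          + (# 3 * ν * (ε * (# 4 + ε) * q + # 20 * s - # 4 * (ε * p)) + # 20 * (# 16 * g - # 3 * ν * s)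
          + # 3 * (ε * ν) * (# 4 + ε) * (t - q))
        final = solve-∀ ring

      peakSpread peakYSpread : ℚ
      peakSpread  = ∑[ i < n ] (peak i * ((x i - c) * (x i - c)))
      peakYSpread = ∑[ i < n ] ([ peakY? i ] * ((x i - c) * (x i - c)))

      -- Sum `peak-deviation` over the peaks. Their number is at most `ε ν / 384`, so the error
      -- terms `320 (coreEnergy + F)` add up to at most `ε ν (coreEnergy + F)`.
      peakSpread≤ : # 12 * peakSpread ≤ # 3 * (# 4 + ε) * peakEnergy + (coreEnergy + F)
      peakSpread≤ = cancel (0<* 0<ε 0<ν) (≤-by
        (0≤+ (0≤- summed) (0≤* (0≤+ 0≤coreEnergy 0≤F) (0≤+ (0≤- peak-count) (0≤* (0≤# 64) 0≤count))))
        (final (ε * ν) (# 3 * (# 4 + ε)) peakSpread peakEnergy (coreEnergy + F) count (# 3 * (ε * ν) * (# 4 + ε))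
          (reassoc (ε * ν) (# 4 + ε))))
        where
        count = ∑[ i < n ] (peak i * 1ℚ)
        0≤count : 0ℚ ≤ count
        0≤count = sum-nonneg λ i → 0≤* 0≤[ peakX? i ] (0≤# 1)
        gated : ∀ h k g l p t → h * (k * p) ≤ h * (l * t + g) →
          k * (h * p) ≤ l * (h * t) + (g * (h * 1ℚ) + 0ℚ)
        gated h k g l p t le = ≤-by (0≤- le) (solve (h ∷ k ∷ g ∷ l ∷ p ∷ t ∷ []) ring)
        summed : # 12 * (ε * ν) * peakSpread ≤
          # 3 * (ε * ν) * (# 4 + ε) * peakEnergy + (# 320 * (coreEnergy + F) * count + 0ℚ)
        summed = sum-≤ (# 12 * (ε * ν))
          (# 3 * (ε * ν) * (# 4 + ε) Vec.∷ # 320 * (coreEnergy + F) Vec.∷ Vec.[])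
          ((λ i → peak i * peakRow i) Vec.∷ (λ i → peak i * 1ℚ) Vec.∷ Vec.[])
          λ i → gated (peak i) (# 12 * (ε * ν)) (# 320 * (coreEnergy + F)) (# 3 * (ε * ν) * (# 4 + ε))
            ((x i - c) * (x i - c)) (peakRow i) (gate (peakX? i) (peak-deviation i))
        reassoc : ∀ k l → # 3 * k * l ≡ k * (# 3 * l)
        reassoc = solve-∀ ring
        final : ∀ k l p e g s m → m ≡ k * l → k * (l * e + g) ≡ k * (# 12 * p) +
          (m * e + (# 320 * g * s + 0ℚ) - # 12 * k * p + g * (k - # 384 * s + # 64 * s))
        final k l p e g s .(k * l) refl = solve (k ∷ l ∷ p ∷ e ∷ g ∷ s ∷ []) ring

      -- At a peak of `y` the vector `x` is not high, so its squared distance from `c` is at most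
      -- `(2 · 24 + 2 · 2) X / ν`; the peaks of `y` number at most `ε ν / 384`.
      peakYSpread≤ : # 384 * peakYSpread ≤ # 52 * (ε * X)
      peakYSpread≤ = cancel 0<ν (≤-by
        (0≤+ (0≤* (0≤# 384) (0≤- summed)) (0≤* (0≤* (0≤# 52) 0≤X) (0≤- Swapped.peak-count)))
        (final ν ε X peakYSpread (∑[ i < n ] ([ peakY? i ] * 1ℚ))))
        where
        deviation : ∀ i → PeakY i → ν * ((x i - c) * (x i - c)) ≤ # 52 * X
        deviation i peakᵢ = bound ν X (x i) c 0≤ν
          (ℚ.≮⇒≥ λ highX → HighX⇒¬HighY i highX (Swapped.PeakX⇒HighX i peakᵢ)) mean²≤
          where
          bound : ∀ ν X p c → 0ℚ ≤ ν → ν * (p * p) ≤ # 24 * X → ν * (c * c) ≤ # 2 * X →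
            ν * ((p - c) * (p - c)) ≤ # 52 * X
          bound ν X p c 0≤ν p≤ c≤ = ≤-by
            (0≤+ (0≤+ (0≤* (0≤# 2) (0≤- p≤)) (0≤* (0≤# 2) (0≤- c≤))) (0≤* 0≤ν (0≤sq (p + c))))
            (solve (ν ∷ X ∷ p ∷ c ∷ []) ring)
        gated : ∀ h ν g p → h * (ν * p) ≤ h * g → ν * (h * p) ≤ g * (h * 1ℚ) + 0ℚ
        gated h ν g p le = ≤-by (0≤- le) (solve (h ∷ ν ∷ g ∷ p ∷ []) ring)
        summed : ν * peakYSpread ≤ # 52 * X * ∑[ i < n ] ([ peakY? i ] * 1ℚ) + 0ℚ
        summed = sum-≤ ν (# 52 * X Vec.∷ Vec.[]) ((λ i → [ peakY? i ] * 1ℚ) Vec.∷ Vec.[])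
          λ i → gated [ peakY? i ] ν (# 52 * X) ((x i - c) * (x i - c)) (gate (peakY? i) (deviation i))
        final : ∀ ν ε X s t → ν * (# 52 * (ε * X)) ≡ ν * (# 384 * s) +
          (# 384 * (# 52 * X * t + 0ℚ - ν * s) + # 52 * X * (ε * ν - # 384 * t))
        final = solve-∀ ring

      norm≤spreads : X + ν * (c * c) ≤ F + peakSpread + peakYSpread
      norm≤spreads = ≤-by (0≤- summed)
        (final X (ν * (c * c)) (∑[ j < n ] ((c - x j) * (c - x j))) (sum-Δ² x c sum-x) F peakSpread peakYSpread)
        where
        pointwise : ∀ r p q s c → 1ℚ ≤ r + p + q → 1ℚ * ((c - s) * (c - s)) ≤
          1ℚ * (r * ((s - c) * (s - c))) +
          (1ℚ * (p * ((s - c) * (s - c))) + (1ℚ * (q * ((s - c) * (s - c))) + 0ℚ))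
        pointwise r p q s c 1≤ = ≤-by (0≤* (0≤- 1≤) (0≤sq (s - c)))
          (solve (r ∷ p ∷ q ∷ s ∷ c ∷ []) ring)
        summed : 1ℚ * ∑[ j < n ] ((c - x j) * (c - x j)) ≤
          1ℚ * F + (1ℚ * peakSpread + (1ℚ * peakYSpread + 0ℚ))
        summed = sum-≤ 1ℚ (1ℚ Vec.∷ 1ℚ Vec.∷ 1ℚ Vec.∷ Vec.[])
          ((λ i → r i * ((x i - c) * (x i - c))) Vec.∷ (λ i → peak i * ((x i - c) * (x i - c))) Vec.∷
           (λ i → [ peakY? i ] * ((x i - c) * (x i - c))) Vec.∷ Vec.[])
          λ i → pointwise (r i) (peak i) [ peakY? i ] (x i) c (cover i)
        final : ∀ X m s → s ≡ m + X → ∀ F p q → F + p + q ≡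
          X + m + (1ℚ * F + (1ℚ * p + (1ℚ * q + 0ℚ)) - 1ℚ * s)
        final X m .(m + X) refl F p q = solve (X ∷ m ∷ F ∷ p ∷ q ∷ []) ring

      -- The energy bound (1 - ε) X leaves too little room once the calm part of x varies little.
      not-concentrated : ¬ (# 4 * F ≤ ε * X)
      -- With everything multiplied by 384, the peaks contribute at most `96 (4 + ε) (1 - ε) X =
      -- (384 - 288 ε - 96 ε²)
      -- X`, apart from the term in `F`. All terms in `F` together give at most `416 F ≤ 104 ε
      -- X`, and the peaks of `y` give `52 ε X`. The total falls short of `384 X` by at least `132 ε
      -- X`.
      not-concentrated small = absurd-by
        (0<+ (0<* (0<* (0<#suc 131) 0<ε) 0<norm-x)
          (0≤+ (0≤* (0≤# 96) (0≤* (0≤sq ε) 0≤X))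
          (0≤+ (0≤* (0≤# 384) (0≤- norm≤spreads))
          (0≤+ (0≤* (0≤# 384) (0≤* 0≤ν (0≤sq c)))
          (0≤+ (0≤* (0≤# 32) (0≤- peakSpread≤))
          (0≤+ (0≤- peakYSpread≤)
          (0≤+ (0≤* (0≤* (0≤# 96) (0≤+ (0≤# 4) 0≤ε)) (0≤- energies≤))
          (0≤+ (0≤* (0≤# 104) (0≤- small))
               (0≤* (0≤+ (0≤# 352) (0≤* (0≤# 96) 0≤ε)) 0≤coreEnergy)))))))))
        (final ε X (ν * (c * c)) F peakSpread peakYSpread peakEnergy coreEnergy)
        where
        final : ∀ ε X m F p q e d →
          # 132 * ε * X + (# 96 * (ε * ε * X) + (# 384 * (F + p + q - (X + m)) + (# 384 * m
          + (# 32 * (# 3 * (# 4 + ε) * e + (d + F) - # 12 * p) + ((# 52 * (ε * X) - # 384 * q)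
          + (# 96 * (# 4 + ε) * ((1ℚ - ε) * X - (e + d)) + (# 104 * (ε * X - # 4 * F)
          + (# 352 + # 96 * ε) * d))))))) ≡ 0ℚ
        final = solve-∀ ring

-- Product of two variances as a double sum.

module Product where
  open Arithmetic
  open Energy
  open Concentration

  -- Expanding the double sum, every term that is linear in p or in q vanishes, and the others are
  -- nonnegative: the sum is 2 (∑ r) (∑ r p² q²) + 2 (∑ r p²) (∑ r q²) + 4 (∑ r p q)².
  spread-product : ∀ {n} (r p q : Vector ℚ n) → (∀ i → 0ℚ ≤ r i) →
    ∑[ i < n ] (r i * p i) ≡ 0ℚ → ∑[ i < n ] (r i * q i) ≡ 0ℚ →
    # 2 * (∑[ i < n ] (r i * (p i * p i)) * ∑[ i < n ] (r i * (q i * q i))) ≤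
    ∑[ i < n ] ∑[ j < n ] (r i * r j * ((p i - p j) * (p i - p j) * ((q i - q j) * (q i - q j))))
  spread-product {n} r p q 0≤r sum-p sum-q = ≤-by
    (0≤+ (0≤* (0≤# 4) (0≤sq s₄)) (0≤* (0≤* (0≤# 2) (sum-nonneg λ i → 0≤* (0≤r i) (0≤# 1)))
      (sum-nonneg λ i → 0≤* (0≤r i) (0≤* (0≤sq (p i)) (0≤sq (q i))))))
    (trans expand (collect s₀ s₁ sum-q s₂ s₃ sum-p s₄ s₅ s₆ s₇ s₈))
    where
    -- The mixed moments: index `3 a + b` stands for `r p^a q^b`.
    f₀ f₁ f₂ f₃ f₄ f₅ f₆ f₇ f₈ : Vector ℚ n
    f₀ i = r i * 1ℚ
    f₁ i = r i * q i
    f₂ i = r i * (q i * q i)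
    f₃ i = r i * p i
    f₄ i = r i * (p i * q i)
    f₅ i = r i * (p i * (q i * q i))
    f₆ i = r i * (p i * p i)
    f₇ i = r i * (p i * p i * q i)
    f₈ i = r i * (p i * p i * (q i * q i))
    s₀ = sum f₀
    s₁ = sum f₁
    s₂ = sum f₂
    s₃ = sum f₃
    s₄ = sum f₄
    s₅ = sum f₅
    s₆ = sum f₆
    s₇ = sum f₇
    s₈ = sum f₈
    fs : Fin 9 → Vector ℚ n
    fs = f₀ Vec.∷ f₁ Vec.∷ f₂ Vec.∷ f₃ Vec.∷ f₄ Vec.∷ f₅ Vec.∷ f₆ Vec.∷ f₇ Vec.∷ f₈ Vec.∷ Vec.[]
    inner : ∀ r p q r′ p′ q′ → r * r′ * ((p - p′) * (p - p′) * ((q - q′) * (q - q′))) ≡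
      r * (p * p * (q * q)) * (r′ * 1ℚ) + (- # 2 * (r * (p * p * q)) * (r′ * q′)
      + (r * (p * p) * (r′ * (q′ * q′)) + (- # 2 * (r * (p * (q * q))) * (r′ * p′)
      + (# 4 * (r * (p * q)) * (r′ * (p′ * q′)) + (- # 2 * (r * p) * (r′ * (p′ * (q′ * q′)))
      + (r * (q * q) * (r′ * (p′ * p′)) + (- # 2 * (r * q) * (r′ * (p′ * p′ * q′))
      + (r * 1ℚ * (r′ * (p′ * p′ * (q′ * q′))) + 0ℚ))))))))
    inner = solve-∀ ring
    outer : ∀ s₀ s₁ s₂ s₃ s₄ s₅ s₆ s₇ s₈ f₀ f₁ f₂ f₃ f₄ f₅ f₆ f₇ f₈ →
      f₈ * s₀ + (- # 2 * f₇ * s₁ + (f₆ * s₂ + (- # 2 * f₅ * s₃ + (# 4 * f₄ * s₄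
      + (- # 2 * f₃ * s₅ + (f₂ * s₆ + (- # 2 * f₁ * s₇ + (f₀ * s₈ + 0ℚ)))))))) ≡
      s₈ * f₀ + (- # 2 * s₇ * f₁ + (s₆ * f₂ + (- # 2 * s₅ * f₃ + (# 4 * s₄ * f₄
      + (- # 2 * s₃ * f₅ + (s₂ * f₆ + (- # 2 * s₁ * f₇ + (s₀ * f₈ + 0ℚ))))))))
    outer = solve-∀ ring
    expand : ∑[ i < n ] ∑[ j < n ] (r i * r j * ((p i - p j) * (p i - p j) * ((q i - q j) * (q i - q j)))) ≡
      s₈ * s₀ + (- # 2 * s₇ * s₁ + (s₆ * s₂ + (- # 2 * s₅ * s₃ + (# 4 * s₄ * s₄
      + (- # 2 * s₃ * s₅ + (s₂ * s₆ + (- # 2 * s₁ * s₇ + (s₀ * s₈ + 0ℚ))))))))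
    expand = sum-≡ (s₈ Vec.∷ - # 2 * s₇ Vec.∷ s₆ Vec.∷ - # 2 * s₅ Vec.∷ # 4 * s₄ Vec.∷
        - # 2 * s₃ Vec.∷ s₂ Vec.∷ - # 2 * s₁ Vec.∷ s₀ Vec.∷ Vec.[]) fs
      λ i → trans
        (sum-≡ (f₈ i Vec.∷ - # 2 * f₇ i Vec.∷ f₆ i Vec.∷ - # 2 * f₅ i Vec.∷ # 4 * f₄ i Vec.∷
            - # 2 * f₃ i Vec.∷ f₂ i Vec.∷ - # 2 * f₁ i Vec.∷ f₀ i Vec.∷ Vec.[]) fs
          λ j → inner (r i) (p i) (q i) (r j) (p j) (q j))
        (outer s₀ s₁ s₂ s₃ s₄ s₅ s₆ s₇ s₈ (f₀ i) (f₁ i) (f₂ i) (f₃ i) (f₄ i) (f₅ i) (f₆ i) (f₇ i) (f₈ i))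
    collect : ∀ s₀ s₁ → s₁ ≡ 0ℚ → ∀ s₂ s₃ → s₃ ≡ 0ℚ → ∀ s₄ s₅ s₆ s₇ s₈ →
      s₈ * s₀ + (- # 2 * s₇ * s₁ + (s₆ * s₂ + (- # 2 * s₅ * s₃ + (# 4 * s₄ * s₄
      + (- # 2 * s₃ * s₅ + (s₂ * s₆ + (- # 2 * s₁ * s₇ + (s₀ * s₈ + 0ℚ)))))))) ≡
      # 2 * (s₆ * s₂) + (# 4 * (s₄ * s₄) + # 2 * s₀ * s₈)
    collect s₀ .0ℚ refl s₂ .0ℚ refl s₄ s₅ s₆ s₇ s₈ =
      solve (s₀ ∷ s₂ ∷ s₄ ∷ s₅ ∷ s₆ ∷ s₇ ∷ s₈ ∷ []) ring

-- The bound on `ε³ n` for a low pair.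

module LowPairs where
  open Arithmetic
  open Energy
  open Concentration
  open Product

  centred : ∀ {n} (r z : Vector ℚ n) c → IsMean r z c → ∑[ i < n ] (r i * (z i - c)) ≡ 0ℚ
  centred {n} r z c mean = trans
    (sum-≡ (1ℚ Vec.∷ - c Vec.∷ Vec.[]) ((λ i → r i * z i) Vec.∷ r Vec.∷ Vec.[])
      λ i → lemma (r i) (z i) c)
    (final (sum r) (∑[ i < n ] (r i * z i)) mean)
    where
    lemma : ∀ r z c → r * (z - c) ≡ 1ℚ * (r * z) + (- c * r + 0ℚ)
    lemma = solve-∀ ring
    final : ∀ s t → s * c ≡ t → 1ℚ * t + (- c * s + 0ℚ) ≡ 0ℚ
    final s .(s * c) refl = solve (s ∷ c ∷ []) ring

  mean-exists : ∀ {n} (r z : Vector ℚ n) → 0ℚ < sum r → ∃[ c ] IsMean r z c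
  mean-exists {n} r z 0<r = 1/r * total , trans (sym (ℚ.*-assoc (sum r) 1/r total))
    (trans (cong (_* total) (ℚ.*-inverseʳ (sum r) {{r≢0}})) (ℚ.*-identityˡ total))
    where
    r≢0 = ℚ.pos⇒nonZero (sum r) {{ℚ.positive 0<r}}
    1/r = (ℚ.1/ sum r) {{r≢0}}
    total = ∑[ i < n ] (r i * z i)

  module _ {n} (P : LowPair n) where
    open LowPair P
    open Vertices P
    private
      module PeaksX = Peaks P
      module PeaksY = Peaks (swap P)

    calm : Vector ℚ n
    calm i = (1ℚ - [ peakX? i ]) * (1ℚ - [ peakY? i ])

    calm-Calm : Calm P calm
    calm-Calm = record
      { nonneg = λ i → 0≤* (0≤- [ peakX? i ]≤1) (0≤- [ peakY? i ]≤1)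
      ; r≤1 = λ i → ≤-by
          (0≤+ 0≤[ peakX? i ] (0≤* (0≤- [ peakX? i ]≤1) 0≤[ peakY? i ]))
          (bounded [ peakX? i ] [ peakY? i ])
      ; core≤r = λ i → core≤ (peakX? i) (peakY? i) (lowX? i) (lowY? i)
          (λ p → not-low 0≤X (PeaksX.PeakX⇒HighX i p)) (λ p → not-low 0≤Y (PeaksY.PeakX⇒HighX i p))
      ; cover = λ i → ≤-by (0≤* 0≤[ peakX? i ] 0≤[ peakY? i ]) (covered [ peakX? i ] [ peakY? i ]) }
      where
      bounded : ∀ p q → 1ℚ ≡ (1ℚ - p) * (1ℚ - q) + (p + (1ℚ - p) * q)
      bounded = solve-∀ ring
      covered : ∀ p q → (1ℚ - p) * (1ℚ - q) + p + q ≡ 1ℚ + p * q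
      covered = solve-∀ ring
      core≤ : ∀ {A B L M : Set} (A? : Dec A) (B? : Dec B) (L? : Dec L) (M? : Dec M) →
        (A → ¬ L) → (B → ¬ M) → [ L? ] * [ M? ] ≤ (1ℚ - [ A? ]) * (1ℚ - [ B? ])
      core≤ (yes a) _ (yes l) _ a⇒¬l _ = contradiction l (a⇒¬l a)
      core≤ (yes _) B? (no _) M? _ _ = ℚ.≤-reflexive (lemma [ M? ] [ B? ])
        where
        lemma : ∀ m b → 0ℚ * m ≡ (1ℚ - 1ℚ) * (1ℚ - b)
        lemma = solve-∀ ring
      core≤ (no _) (yes b) _ (yes m) _ b⇒¬m = contradiction m (b⇒¬m b)
      core≤ (no _) (yes _) L? (no _) _ _ = ℚ.≤-reflexive (ℚ.*-zeroʳ [ L? ])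
      core≤ (no _) (no _) L? M? _ _ =
        ≤-by (0≤+ (0≤- [ L? ]≤1) (0≤* 0≤[ L? ] (0≤- [ M? ]≤1))) (lemma [ L? ] [ M? ])
        where
        lemma : ∀ l m → 1ℚ * 1ℚ ≡ l * m + ((1ℚ - l) + l * (1ℚ - m))
        lemma = solve-∀ ring

    calm-X : ∀ i → calm i * (ε * ν * (x i * x i)) ≤ calm i * (# 384 * X)
    calm-X i = ≤-by (0≤* (0≤- [ peakY? i ]≤1) (0≤- (tame (peakX? i))))
      (lemma [ peakX? i ] [ peakY? i ] (ε * ν * (x i * x i)) (# 384 * X))
      where
      tame : ∀ {u p} (p? : Dec (u < p)) → (1ℚ - [ p? ]) * p ≤ (1ℚ - [ p? ]) * u
      tame {u} {p} (yes _) = ℚ.≤-reflexive (lem u p)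
        where
        lem : ∀ u p → (1ℚ - 1ℚ) * p ≡ (1ℚ - 1ℚ) * u
        lem = solve-∀ ring
      tame {u} {p} (no u≮p) = ≤-by (0≤- (ℚ.≮⇒≥ u≮p)) (lem u p)
        where
        lem : ∀ u p → (1ℚ - 0ℚ) * u ≡ (1ℚ - 0ℚ) * p + (u - p)
        lem = solve-∀ ring
      lemma : ∀ a b p u → (1ℚ - a) * (1ℚ - b) * u ≡
        (1ℚ - a) * (1ℚ - b) * p + (1ℚ - b) * ((1ℚ - a) * u - (1ℚ - a) * p)
      lemma = solve-∀ ring

  module _ {n} (P : LowPair n) where
    open LowPair P
    open Vertices P

    calm-Y : ∀ i → calm P i * (ε * ν * (y i * y i)) ≤ calm P i * (# 384 * Y)
    calm-Y i = subst (λ t → t * (ε * ν * (y i * y i)) ≤ t * (# 384 * Y))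
      (ℚ.*-comm (1ℚ - [ peakY? i ]) (1ℚ - [ peakX? i ])) (calm-X (swap P) i)

    -- Between calm vertices squared differences of `x` are at most `4 · 384 X / (ε ν)`, and
    -- similarly for `y`. On an edge this bounds the factor from `y`, and the factor from `x` is
    -- charged to the energy of `x`; on a non-edge the roles are exchanged. The charges total at
    -- most `1536 · 4 X Y`, and `spread-product` halves this.
    calm-spreads : ∀ c d → IsMean (calm P) x c → IsMean (calm P) y d →
      ε * ν * (spread (calm P) x c * spread (calm P) y d) ≤ # 3072 * (X * Y)
    calm-spreads c d mean-x mean-y = cancel (0<#suc 1) (≤-by
      (0≤+ (0≤+ (0≤* (0≤* 0≤ε 0≤ν)
                  (0≤- (spread-product r (λ i → x i - c) (λ i → y i - d) nonneg
                    (centred r x c mean-x) (centred r y d mean-y))))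
                (0≤- summed))
           (0≤+ (0≤+ (0≤* (0≤* (0≤# 1536) 0≤Y) (0≤- energy-x)) (0≤* (0≤* (0≤# 1536) 0≤X) (0≤- energy-y)))
                (0≤* (0≤# 6144) (0≤* 0≤ε (0≤* 0≤X 0≤Y)))))
      (final ε X Y (ε * ν) (spread r x c * spread r y d) W
        (energy edge x) (energy (λ i j → not (edge i j)) y)))
      where
      open Calm (calm-Calm P)
      r = calm P
      W = ∑[ i < n ] ∑[ j < n ] (r i * r j *
        ((x i - c - (x j - c)) * (x i - c - (x j - c)) * ((y i - d - (y j - d)) * (y i - d - (y j - d)))))
      bounded : ∀ k Z r s q q′ → 0ℚ ≤ k → 0ℚ ≤ Z → 0ℚ ≤ r → 0ℚ ≤ s → r ≤ 1ℚ → s ≤ 1ℚ →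
        r * (k * (q * q)) ≤ r * (# 384 * Z) → s * (k * (q′ * q′)) ≤ s * (# 384 * Z) →
        r * s * (k * ((q - q′) * (q - q′))) ≤ # 1536 * Z
      bounded k Z r s q q′ 0≤k 0≤Z 0≤r 0≤s r≤1 s≤1 hr hs = ≤-by
        (0≤+ (0≤+ (0≤* (0≤* (0≤# 2) 0≤s) (0≤- hr)) (0≤* (0≤* (0≤# 2) 0≤r) (0≤- hs)))
             (0≤+ (0≤* (0≤* 0≤r 0≤s) (0≤* 0≤k (0≤sq (q + q′))))
                  (0≤* (0≤* (0≤# 1536) 0≤Z) (0≤+ (0≤- r≤1) (0≤* 0≤r (0≤- s≤1))))))
        (solve (k ∷ Z ∷ r ∷ s ∷ q ∷ q′ ∷ []) ring)
      pointwise : ∀ e k X Y r s p p′ q q′ →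
        r * s * (k * ((p - p′) * (p - p′))) ≤ # 1536 * X →
        r * s * (k * ((q - q′) * (q - q′))) ≤ # 1536 * Y →
        k * (r * s * ((p - c - (p′ - c)) * (p - c - (p′ - c)) * ((q - d - (q′ - d)) * (q - d - (q′ - d))))) ≤
        # 1536 * Y * (χ e * ((p - p′) * (p - p′))) + (# 1536 * X * (χ (not e) * ((q - q′) * (q - q′))) + 0ℚ)
      pointwise true k X Y r s p p′ q q′ hX hY = ≤-by (0≤* (0≤sq (p - p′)) (0≤- hY)) (lemma k X Y r s p p′ q q′ c d)
        where
        lemma : ∀ k X Y r s p p′ q q′ c d →
          # 1536 * Y * (1ℚ * ((p - p′) * (p - p′))) + (# 1536 * X * (0ℚ * ((q - q′) * (q - q′))) + 0ℚ) ≡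
          k * (r * s * ((p - c - (p′ - c)) * (p - c - (p′ - c)) * ((q - d - (q′ - d)) * (q - d - (q′ - d)))))
          + (p - p′) * (p - p′) * (# 1536 * Y - r * s * (k * ((q - q′) * (q - q′))))
        lemma = solve-∀ ring
      pointwise false k X Y r s p p′ q q′ hX hY = ≤-by (0≤* (0≤sq (q - q′)) (0≤- hX)) (lemma k X Y r s p p′ q q′ c d)
        where
        lemma : ∀ k X Y r s p p′ q q′ c d →
          # 1536 * Y * (0ℚ * ((p - p′) * (p - p′))) + (# 1536 * X * (1ℚ * ((q - q′) * (q - q′))) + 0ℚ) ≡
          k * (r * s * ((p - c - (p′ - c)) * (p - c - (p′ - c)) * ((q - d - (q′ - d)) * (q - d - (q′ - d)))))
          + (q - q′) * (q - q′) * (# 1536 * X - r * s * (k * ((p - p′) * (p - p′))))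
        lemma = solve-∀ ring
      summed : ε * ν * W ≤ # 1536 * Y * energy edge x + (# 1536 * X * energy (λ i j → not (edge i j)) y + 0ℚ)
      summed = sum-≤ (ε * ν) (# 1536 * Y Vec.∷ # 1536 * X Vec.∷ Vec.[])
        (rowX Vec.∷ rowY Vec.∷ Vec.[])
        λ i → sum-≤ (ε * ν) (# 1536 * Y Vec.∷ # 1536 * X Vec.∷ Vec.[])
          ((λ j → a i j * ((x i - x j) * (x i - x j))) Vec.∷ (λ j → b i j * ((y i - y j) * (y i - y j))) Vec.∷ Vec.[])
          λ j → pointwise (edge i j) (ε * ν) X Y (r i) (r j) (x i) (x j) (y i) (y j)
            (bounded (ε * ν) X (r i) (r j) (x i) (x j) (0≤* 0≤ε 0≤ν) 0≤X (nonneg i) (nonneg j) (r≤1 i) (r≤1 j)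
              (calm-X P i) (calm-X P j))
            (bounded (ε * ν) Y (r i) (r j) (y i) (y j) (0≤* 0≤ε 0≤ν) 0≤Y (nonneg i) (nonneg j) (r≤1 i) (r≤1 j)
              (calm-Y i) (calm-Y j))
      final : ∀ ε X Y k FG W e e′ → # 2 * (# 3072 * (X * Y)) ≡ # 2 * (k * FG) +
        (k * (W - # 2 * FG) + (# 1536 * Y * e + (# 1536 * X * e′ + 0ℚ) - k * W)
        + (# 1536 * Y * (# 2 * ((1ℚ - ε) * X) - e) + # 1536 * X * (# 2 * ((1ℚ - ε) * Y) - e′)
        + # 6144 * (ε * (X * Y))))
      final = solve-∀ ring

    0<sum-calm : 0ℚ < sum (calm P)
    0<sum-calm = ℚ.*-cancelˡ-<-nonNeg (# 2) (subst (_< # 2 * sum (calm P)) (sym (ℚ.*-zeroʳ (# 2)))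
      (ℚ.<-≤-trans 0<ν (ℚ.≤-trans core-large (≤-by (0≤* (0≤# 2) (0≤- (sum-mono core≤r)))
        (lemma (sum (calm P)) (sum core))))))
      where
      open Calm (calm-Calm P)
      lemma : ∀ s t → # 2 * s ≡ # 2 * t + # 2 * (s - t)
      lemma = solve-∀ ring

    -- Both variances exceed a quarter of `ε X` and `ε Y`, so `calm-spreads` yields
    -- `ε³ ν < 16 · 3072`.
    ε³n-bounded : ¬ (# 49152 ≤ ε * ε * ε * card n)
    ε³n-bounded large = absurd-by
      (0<+ (0<* (0<* 0<ε 0<ν) (0<* F-large G-large))
        (0≤+ (0≤* (0≤* 0≤ε 0≤ν) (0≤+ (0≤* (0≤* 0≤ε 0≤Y) (ℚ.<⇒≤ F-large)) (0≤* (0≤* 0≤ε 0≤X) (ℚ.<⇒≤ G-large))))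
        (0≤+ (0≤* (0≤* 0≤X 0≤Y) (0≤- large))
             (0≤* (0≤# 16) (0≤- (calm-spreads c d mean-x mean-y))))))
      (final ε ν X Y (spread (calm P) x c) (spread (calm P) y d))
      where
      meanX = mean-exists (calm P) x 0<sum-calm
      meanY = mean-exists (calm P) y 0<sum-calm
      c = proj₁ meanX
      d = proj₁ meanY
      mean-x = proj₂ meanX
      mean-y = proj₂ meanY
      F-large : 0ℚ < # 4 * spread (calm P) x c - ε * X
      F-large = 0<- (ℚ.≰⇒> (not-concentrated (calm-Calm P) c mean-x))
      G-large : 0ℚ < # 4 * spread (calm P) y d - ε * Y
      G-large = 0<- (ℚ.≰⇒> (not-concentrated (Calm-swap (calm-Calm P)) d mean-y))
      final : ∀ ε ν X Y F G → ε * ν * ((# 4 * F - ε * X) * (# 4 * G - ε * Y)) +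
        (ε * ν * (ε * Y * (# 4 * F - ε * X) + ε * X * (# 4 * G - ε * Y))
        + (X * Y * (ε * ε * ε * ν - # 49152) + # 16 * (# 3072 * (X * Y) - ε * ν * (F * G)))) ≡ 0ℚ
      final = solve-∀ ring

-- The Laplacian as an operator, its quadratic form and recentring.

module LaplacianForm where
  open Arithmetic
  open Energy

  lap : ∀ {n} → (Fin n → Fin n → Bool) → Vector ℚ n → Vector ℚ n
  lap {n} e v i = ∑[ j < n ] (χ (e i j) * (v i - v j))

  lap-matrix : ∀ {n} (e : Fin n → Fin n → Bool) (v : Vector ℚ n) i →
    ∑[ j < n ] (([ i Fin.≟ j ] * (∑[ k < n ] χ (e i k)) - χ (e i j)) * v j) ≡ lap e v i
  lap-matrix {n} e v i = trans
    (sum-≡ (deg Vec.∷ - 1ℚ Vec.∷ Vec.[])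
      ((λ j → [ i Fin.≟ j ] * v j) Vec.∷ (λ j → χ (e i j) * v j) Vec.∷ Vec.[])
      λ j → lemma [ i Fin.≟ j ] deg (χ (e i j)) (v j))
    (trans (cong (λ t → deg * t + (- 1ℚ * rest + 0ℚ)) (sum-select i v))
      (trans (rearrange deg (v i) rest) (sym
        (sum-≡ (v i Vec.∷ - 1ℚ Vec.∷ Vec.[]) ((λ j → χ (e i j)) Vec.∷ (λ j → χ (e i j) * v j) Vec.∷ Vec.[])
          λ j → lemma′ (χ (e i j)) (v i) (v j)))))
    where
    deg = ∑[ k < n ] χ (e i k)
    rest = ∑[ j < n ] (χ (e i j) * v j)
    lemma : ∀ s d a w → (s * d - a) * w ≡ d * (s * w) + (- 1ℚ * (a * w) + 0ℚ)
    lemma = solve-∀ ring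
    lemma′ : ∀ a v w → a * (v - w) ≡ v * a + (- 1ℚ * (a * w) + 0ℚ)
    lemma′ = solve-∀ ring
    rearrange : ∀ d v r → d * v + (- 1ℚ * r + 0ℚ) ≡ v * d + (- 1ℚ * r + 0ℚ)
    rearrange = solve-∀ ring

  module _ {n} (e : Fin n → Fin n → Bool) (e-sym : ∀ i j → e i j ≡ e j i) (v : Vector ℚ n) where

    private
      antisymmetric : ∀ (g : Fin n → Fin n → ℚ) → (∀ i j → g i j ≡ - g j i) →
        ∑[ i < n ] ∑[ j < n ] g i j ≡ 0ℚ
      antisymmetric g g-anti = halve (∑[ i < n ] ∑[ j < n ] g i j) (trans (∑-comm g)
        (trans (sum-cong-≗ λ j → sum-cong-≗ λ i → g-anti i j)
          (sum-≡ (- 1ℚ Vec.∷ Vec.[]) ((λ j → sum (g j)) Vec.∷ Vec.[])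
            λ j → sum-≡ (- 1ℚ Vec.∷ Vec.[]) (g j Vec.∷ Vec.[]) λ i → lemma (g j i))))
        where
        lemma : ∀ p → - p ≡ - 1ℚ * p + 0ℚ
        lemma = solve-∀ ring
        halve : ∀ s → s ≡ - 1ℚ * s + 0ℚ → s ≡ 0ℚ
        halve s eq = trans (lemma₁ s) (trans (cong (λ t → ℚ.½ * (s + t)) eq) (lemma₂ s))
          where
          lemma₁ : ∀ s → s ≡ ℚ.½ * (s + s)
          lemma₁ = solve-∀ ring
          lemma₂ : ∀ s → ℚ.½ * (s + (- 1ℚ * s + 0ℚ)) ≡ 0ℚ
          lemma₂ = solve-∀ ring

    sum-lap : sum (lap e v) ≡ 0ℚ
    sum-lap = antisymmetric (λ i j → χ (e i j) * (v i - v j)) λ i j →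
      trans (cong (λ b → χ b * (v i - v j)) (e-sym i j)) (lemma (χ (e j i)) (v i) (v j))
      where
      lemma : ∀ a p q → a * (p - q) ≡ - (a * (q - p))
      lemma = solve-∀ ring

    -- `(p - q)² = 2 p (p - q) - (p - q) (p + q)`, and the last product is antisymmetric, so it
    -- cancels in the double sum.
    energy-lap : energy e v ≡ # 2 * ∑[ i < n ] (v i * lap e v i)
    energy-lap = trans
      (sum-≡ (# 2 Vec.∷ 1ℚ Vec.∷ Vec.[])
        ((λ i → v i * lap e v i) Vec.∷ (λ i → ∑[ j < n ] (- (χ (e i j) * ((v i - v j) * (v i + v j))))) Vec.∷ Vec.[])
        λ i → trans
          (sum-≡ (# 2 * v i Vec.∷ 1ℚ Vec.∷ Vec.[])
            ((λ j → χ (e i j) * (v i - v j)) Vec.∷ (λ j → - (χ (e i j) * ((v i - v j) * (v i + v j)))) Vec.∷ Vec.[])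
            λ j → expand (χ (e i j)) (v i) (v j))
          (regroup (v i) (lap e v i) (∑[ j < n ] (- (χ (e i j) * ((v i - v j) * (v i + v j)))))))
      (trans (cong (λ t → # 2 * ∑[ i < n ] (v i * lap e v i) + (1ℚ * t + 0ℚ))
          (antisymmetric (λ i j → - (χ (e i j) * ((v i - v j) * (v i + v j)))) λ i j →
            trans (cong (λ b → - (χ b * ((v i - v j) * (v i + v j)))) (e-sym i j)) (anti (χ (e j i)) (v i) (v j))))
        (collapse (∑[ i < n ] (v i * lap e v i))))
      where
      expand : ∀ a p q → a * ((p - q) * (p - q)) ≡
        # 2 * p * (a * (p - q)) + (1ℚ * (- (a * ((p - q) * (p + q)))) + 0ℚ)
      expand = solve-∀ ring
      regroup : ∀ v l t → # 2 * v * l + (1ℚ * t + 0ℚ) ≡ # 2 * (v * l) + (1ℚ * t + 0ℚ)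
      regroup = solve-∀ ring
      anti : ∀ a p q → - (a * ((p - q) * (p + q))) ≡ - (- (a * ((q - p) * (q + p))))
      anti = solve-∀ ring
      collapse : ∀ s → # 2 * s + (1ℚ * 0ℚ + 0ℚ) ≡ # 2 * s
      collapse = solve-∀ ring

  lap-linear : ∀ {n} (e : Fin n → Fin n → Bool) (p q : ℚ) (u v : Vector ℚ n) i →
    lap e (λ j → p * u j + q * v j) i ≡ p * lap e u i + q * lap e v i
  lap-linear {n} e p q u v i = trans
    (sum-≡ (p Vec.∷ q Vec.∷ Vec.[])
      ((λ j → χ (e i j) * (u i - u j)) Vec.∷ (λ j → χ (e i j) * (v i - v j)) Vec.∷ Vec.[])
      λ j → lemma p q (χ (e i j)) (u i) (u j) (v i) (v j))
    (cong (p * lap e u i +_) (ℚ.+-identityʳ (q * lap e v i)))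
    where
    lemma : ∀ p q a u u′ v v′ → a * ((p * u + q * v) - (p * u′ + q * v′)) ≡
      p * (a * (u - u′)) + (q * (a * (v - v′)) + 0ℚ)
    lemma = solve-∀ ring

  -- n times the projection of v to the complement of the constant vectors.
  centre : ∀ {n} → Vector ℚ n → Vector ℚ n
  centre {n} v i = card n * v i - sum v

  sum-centre : ∀ {n} (v : Vector ℚ n) → sum (centre v) ≡ 0ℚ
  sum-centre {n} v = trans
    (sum-≡ (card n Vec.∷ - sum v Vec.∷ Vec.[]) (v Vec.∷ (λ _ → 1ℚ) Vec.∷ Vec.[]) λ i → lemma (card n) (v i) (sum v))
    (final (card n) (sum v))
    where
    lemma : ∀ k p s → k * p - s ≡ k * p + (- s * 1ℚ + 0ℚ)
    lemma = solve-∀ ring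
    final : ∀ k s → k * s + (- s * k + 0ℚ) ≡ 0ℚ
    final = solve-∀ ring

  norm²-centre : ∀ {n} (v : Vector ℚ n) →
    norm² (centre v) ≡ card n * (card n * norm² v - sum v * sum v)
  norm²-centre {n} v = trans
    (sum-≡ (card n * card n Vec.∷ - (# 2 * card n * sum v) Vec.∷ sum v * sum v Vec.∷ Vec.[])
      ((λ i → v i * v i) Vec.∷ v Vec.∷ (λ _ → 1ℚ) Vec.∷ Vec.[]) λ i → lemma (card n) (v i) (sum v))
    (final (card n) (sum v) (norm² v))
    where
    lemma : ∀ k p s → (k * p - s) * (k * p - s) ≡
      k * k * (p * p) + (- (# 2 * k * s) * p + (s * s * 1ℚ + 0ℚ))
    lemma = solve-∀ ring
    final : ∀ k s N → k * k * N + (- (# 2 * k * s) * s + (s * s * k + 0ℚ)) ≡ k * (k * N - s * s)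
    final = solve-∀ ring

  energy-centre : ∀ {n} (e : Fin n → Fin n → Bool) (v : Vector ℚ n) →
    energy e (centre v) ≡ card n * card n * energy e v
  energy-centre {n} e v = trans
    (sum-≡ (card n * card n Vec.∷ Vec.[]) ((λ i → ∑[ j < n ] (χ (e i j) * ((v i - v j) * (v i - v j)))) Vec.∷ Vec.[])
      λ i → sum-≡ (card n * card n Vec.∷ Vec.[]) ((λ j → χ (e i j) * ((v i - v j) * (v i - v j))) Vec.∷ Vec.[])
        λ j → lemma (χ (e i j)) (card n) (v i) (v j) (sum v))
    (ℚ.+-identityʳ (card n * card n * energy e v))
    where
    lemma : ∀ a k p q s → a * (((k * p - s) - (k * q - s)) * ((k * p - s) - (k * q - s))) ≡
      k * k * (a * ((p - q) * (p - q))) + 0ℚ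
    lemma = solve-∀ ring

  -- Allows the negated adjacency relation, which has loops, to replace the complement graph.
  energy-off-diagonal : ∀ {n} {e e′ : Fin n → Fin n → Bool} (v : Vector ℚ n) →
    (∀ i j → i ≢ j → e i j ≡ e′ i j) → energy e v ≡ energy e′ v
  energy-off-diagonal {n} {e} {e′} v agree = sum-cong-≗ λ i → sum-cong-≗ λ j → term i j (i Fin.≟ j)
    where
    diagonal : ∀ a b p → a * ((p - p) * (p - p)) ≡ b * ((p - p) * (p - p))
    diagonal = solve-∀ ring
    term : ∀ i j → Dec (i ≡ j) → χ (e i j) * ((v i - v j) * (v i - v j)) ≡ χ (e′ i j) * ((v i - v j) * (v i - v j))
    term i .i (yes refl) = diagonal (χ (e i i)) (χ (e′ i i)) (v i)
    term i j (no i≢j) = cong (λ b → χ b * ((v i - v j) * (v i - v j))) (agree i j i≢j)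

  card≡# : ∀ n → card n ≡ # n
  card≡# zero    = refl
  card≡# (suc n) = trans (cong (1ℚ +_) (trans (card≡# n) (ℚ.↥p/↧p≡p integer)))
    (cong (ℚ._/ 1) (trans (cong (λ z → ℤ.+ 1 ℤ.+ z) (ℤ.*-identityʳ (ℤ.+ n))) refl))
    where
    integer : ℚ
    integer = ℚ.mkℚ (ℤ.+ n) 0 (Coprime.sym (Coprime.1-coprimeTo n))

-- Rational estimates behind the real-number lemmas.

module RationalBounds where
  open Arithmetic

  halved : ∀ {ε} → 0ℚ < ε → 0ℚ < ℚ.½ * ε
  halved = 0<* (ℚ.positive⁻¹ ℚ.½)

  p≤∣p∣ : ∀ p → p ≤ ℚ.∣ p ∣
  p≤∣p∣ p with ℚ.≤-total 0ℚ p
  ... | inj₁ 0≤p = ℚ.≤-reflexive (sym (ℚ.0≤p⇒∣p∣≡p 0≤p))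
  ... | inj₂ p≤0 = ℚ.≤-trans p≤0 (ℚ.0≤∣p∣ p)

  ∣-∣<⇒<+ : ∀ p q {ε} → ℚ.∣ p - q ∣ < ε → 0ℚ < q + ε - p
  ∣-∣<⇒<+ p q {ε} h = subst (0ℚ <_) (lemma p q ε) (0<- (ℚ.≤-<-trans (p≤∣p∣ (p - q)) h))
    where
    lemma : ∀ p q ε → ε - (p - q) ≡ q + ε - p
    lemma = solve-∀ ring

  -- The occurrences of `0ℚ` are the shapes to which `_≤_` and `_≈_` unfold at `0ℝ`.
  sq<sq⇒∣∣< : ∀ {p ε} → 0ℚ < ε → p * p < 0ℚ + ε * ε → ℚ.∣ p - 0ℚ ∣ < ε
  sq<sq⇒∣∣< {p} {ε} 0<ε p²<ε² = ℚ.≰⇒> λ ε≤ → absurd-by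
    (0<+ (0<- p²<ε²) (0≤+ (0≤* (ℚ.<⇒≤ 0<ε) (0≤- ε≤)) (0≤* (ℚ.0≤∣p∣ (p - 0ℚ)) (0≤- ε≤))))
    (final ε (p * p) ℚ.∣ p - 0ℚ ∣ abs²)
    where
    abs² : ℚ.∣ p - 0ℚ ∣ * ℚ.∣ p - 0ℚ ∣ ≡ p * p
    abs² = trans (sym (ℚ.∣p*q∣≡∣p∣*∣q∣ (p - 0ℚ) (p - 0ℚ)))
      (trans (ℚ.0≤p⇒∣p∣≡p (0≤sq (p - 0ℚ))) (lemma p))
      where
      lemma : ∀ p → (p - 0ℚ) * (p - 0ℚ) ≡ p * p
      lemma = solve-∀ ring
    final : ∀ ε s a → a * a ≡ s → (0ℚ + ε * ε - s) + (ε * (a - ε) + a * (a - ε)) ≡ 0ℚ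
    final ε .(a * a) a refl = solve (ε ∷ a ∷ []) ring

  -- Passing from index k₀ to index k costs at most ε / 8 on either side.
  <-transfer : ∀ {x₀ y₀ x y ε} → 0ℚ < ε →
    ℚ.∣ x - x₀ ∣ < ℚ.½ * (ℚ.½ * (ℚ.½ * ε)) → ℚ.∣ y₀ - y ∣ < ℚ.½ * (ℚ.½ * (ℚ.½ * ε)) →
    x₀ < y₀ + ℚ.½ * ε → x < y + ε
  <-transfer {x₀} {y₀} {x} {y} {ε} 0<ε hx hy h = <-by
    (0<+ (0<+ (0<- h) (ℚ.<⇒≤ (halved (halved 0<ε)))) (0≤+ (ℚ.<⇒≤ (∣-∣<⇒<+ x x₀ hx)) (ℚ.<⇒≤ (∣-∣<⇒<+ y₀ y hy))))
    (solve (x₀ ∷ y₀ ∷ x ∷ y ∷ ε ∷ []) ring)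

  >-transfer : ∀ {x₀ y₀ x y ε} →
    ℚ.∣ x₀ - x ∣ < ℚ.½ * (ℚ.½ * (ℚ.½ * ε)) → ℚ.∣ y - y₀ ∣ < ℚ.½ * (ℚ.½ * (ℚ.½ * ε)) →
    y₀ + ℚ.½ * ε ≤ x₀ → y + ℚ.½ * (ℚ.½ * ε) < x
  >-transfer {x₀} {y₀} {x} {y} {ε} hx hy h = <-by
    (0<+ (∣-∣<⇒<+ x₀ x hx) (0≤+ (ℚ.<⇒≤ (∣-∣<⇒<+ y y₀ hy)) (0≤- h)))
    (solve (x₀ ∷ y₀ ∷ x ∷ y ∷ ε ∷ []) ring)

  *-lower : ∀ {p q u v} → 0ℚ < p → 0ℚ < q → 0ℚ + p < u → 0ℚ + q < v → 0ℚ + p * q < u * v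
  *-lower {p} {q} {u} {v} 0<p 0<q p<u q<v = <-by
    (0<+ (0<* (0<- p<u) (0<- q<v))
      (0≤+ (0≤* (ℚ.<⇒≤ 0<p) (ℚ.<⇒≤ (0<- q<v))) (0≤* (ℚ.<⇒≤ 0<q) (ℚ.<⇒≤ (0<- p<u)))))
    (solve (p ∷ q ∷ u ∷ v ∷ []) ring)

  near-lower : ∀ {u v δ} → ℚ.∣ u - v ∣ < ℚ.½ * δ → 0ℚ + δ < u → 0ℚ + ℚ.½ * δ < v
  near-lower {u} {v} {δ} h δ<u = <-by (0<+ (∣-∣<⇒<+ u v h) (ℚ.<⇒≤ (0<- δ<u)))
    (solve (u ∷ v ∷ δ ∷ []) ring)

  gap-trans : ∀ {p q r δ} → p < q + ℚ.½ * δ → q + δ < r → p + ℚ.½ * δ < r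
  gap-trans {p} {q} {r} {δ} h h′ = <-by (0<+ (0<- h) (ℚ.<⇒≤ (0<- h′))) (solve (p ∷ q ∷ r ∷ δ ∷ []) ring)

  gap-difference : ∀ {p q δ} → p + δ < q → 0ℚ + δ < q - p
  gap-difference {p} {q} {δ} h = <-by (0<- h) (solve (p ∷ q ∷ δ ∷ []) ring)

  cubic-positive : ∀ {ν q} → 0ℚ ≤ ν → ℚ.∣ 1ℚ - ν * (q * q * q) ∣ < ℚ.½ → 0ℚ < q
  cubic-positive {ν} {q} 0≤ν h = ℚ.≰⇒> λ q≤0 → absurd-by
    (0<+ (∣-∣<⇒<+ 1ℚ (ν * (q * q * q)) h) (0≤+ (ℚ.<⇒≤ (ℚ.positive⁻¹ ℚ.½)) (0≤* (0≤* 0≤ν (0≤sq q)) (0≤- q≤0))))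
    (final ν q)
    where
    final : ∀ ν q → (ν * (q * q * q) + ℚ.½ - 1ℚ) + (ℚ.½ + ν * (q * q) * (0ℚ - q)) ≡ 0ℚ
    final = solve-∀ ring

  -- The origin of the constant 50: since `ν q³ > 1 / 2`, the right-hand side exceeds
  -- `50³ / 2 = 62500 = 49152 + 13348`.
  cubic-large : ∀ {ν q} → ℚ.∣ 1ℚ - ν * (q * q * q) ∣ < ℚ.½ →
    # 49152 ≤ # 50 * q * (# 50 * q) * (# 50 * q) * ν
  cubic-large {ν} {q} h = ≤-by
    (0≤+ (0≤* (0≤# 125000) (ℚ.<⇒≤ (∣-∣<⇒<+ 1ℚ (ν * (q * q * q)) h))) (0≤# 13348)) (final ν q)
    where
    final : ∀ ν q → # 50 * q * (# 50 * q) * (# 50 * q) * ν ≡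
      # 49152 + (# 125000 * (ν * (q * q * q) + ℚ.½ - 1ℚ) + # 13348)
    final = solve-∀ ring

-- Constructive reals: order, stability and indexwise computation.

open import Defs

open Arithmetic
  using (#_; χ; [_]; sum; sum-≡; sum-cong-≗; term≤sum; ring; *-distribˡ-sum; sum-replicate-zero)
open Energy using (energy; norm²; card)
open LowPairs using (ε³n-bounded)
open LaplacianForm
open RationalBounds

both : ∀ {P Q : ℕ → Set} → Eventually P → Eventually Q → Eventually λ k → P k × Q k
both (N , p) (M , q) = N ℕ.⊔ M , λ k ≤k →
  p k (ℕ.m⊔n≤o⇒m≤o N M ≤k) , q k (ℕ.m⊔n≤o⇒n≤o N M ≤k)

map-eventually : ∀ {P Q : ℕ → Set} → (∀ k → P k → Q k) → Eventually P → Eventually Q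
map-eventually f (N , p) = N , λ k N≤k → f k (p k N≤k)

-- Compare rationals at one index `K` after which both sequences have settled: if `x` is below
-- `y + ε / 2` there, it stays below `y + ε`; otherwise a gap of `ε / 4` persists and gives `y < x`.
-- This permits arguing by contradiction for `_≤_`.
≤-stable : ∀ x y → ¬ (y < x) → x ≤ y
≤-stable x y y≮x ε 0<ε = decide (seq x K ℚ.<? seq y K ℚ.+ ℚ.½ ℚ.* ε)
  where
  δ = ℚ.½ ℚ.* (ℚ.½ ℚ.* (ℚ.½ ℚ.* ε))
  0<δ : 0ℚ ℚ.< δ
  0<δ = halved (halved (halved 0<ε))
  settled : ∀ z → Eventually λ k → ∀ l → k ℕ.≤ l →
    ℚ.∣ seq z k ℚ.- seq z l ∣ ℚ.< δ × ℚ.∣ seq z l ℚ.- seq z k ∣ ℚ.< δ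
  settled z with cauchy z δ 0<δ
  ... | N , c = N , λ k N≤k l k≤l →
    c k l N≤k (ℕ.≤-trans N≤k k≤l) , c l k (ℕ.≤-trans N≤k k≤l) N≤k
  close = both (settled x) (settled y)
  K = proj₁ close
  at-K = proj₂ close K ℕ.≤-refl
  decide : Dec (seq x K ℚ.< seq y K ℚ.+ ℚ.½ ℚ.* ε) → Eventually λ k → seq x k ℚ.< seq y k ℚ.+ ε
  decide (yes below) = K , λ k K≤k → <-transfer {seq x K} {seq y K} {seq x k} {seq y k} {ε} 0<ε
    (proj₂ (proj₁ at-K k K≤k)) (proj₁ (proj₂ at-K k K≤k)) below
  decide (no above) = contradiction
    (ℚ.½ ℚ.* (ℚ.½ ℚ.* ε) , halved (halved 0<ε) , K , λ k K≤k →
      >-transfer {seq x K} {seq y K} {seq x k} {seq y k} {ε}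
        (proj₁ (proj₁ at-K k K≤k)) (proj₂ (proj₂ at-K k K≤k)) (ℚ.≮⇒≥ above))
    y≮x

<-irrefl : ∀ x → ¬ (x < x)
<-irrefl x (δ , 0<δ , N , h) = ℚ.<-irrefl refl (ℚ.<-trans (below (seq x N)) (h N ℕ.≤-refl))
  where
  below : ∀ p → p ℚ.< p ℚ.+ δ
  below p = subst (ℚ._< p ℚ.+ δ) (ℚ.+-identityʳ p) (ℚ.+-monoʳ-< p 0<δ)

≤-<-trans : ∀ x y z → x ≤ y → y < z → x < z
≤-<-trans x y z x≤y (δ , 0<δ , y<z) = ℚ.½ ℚ.* δ , halved 0<δ ,
  map-eventually (λ k (p , q) → gap-trans {seq x k} {seq y k} {seq z k} {δ} p q)
    (both (x≤y (ℚ.½ ℚ.* δ) (halved 0<δ)) y<z)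

<⇒0<- : ∀ x y → x < y → 0ℝ < y - x
<⇒0<- x y (δ , 0<δ , x<y) = δ , 0<δ ,
  map-eventually (λ k → gap-difference {seq x k} {seq y k} {δ}) x<y

0<-* : ∀ x y → 0ℝ < x → 0ℝ < y → 0ℝ < x * y
0<-* x y (δ , 0<δ , p) (δ′ , 0<δ′ , q) = δ ℚ.* δ′ , Arithmetic.0<* 0<δ 0<δ′ ,
  map-eventually (λ k (p , q) → *-lower {δ} {δ′} {seq x k} {seq y k} 0<δ 0<δ′ p q) (both p q)

0<-resp-≈ : ∀ x y → x ≈ y → 0ℝ < x → 0ℝ < y
0<-resp-≈ x y x≈y (δ , 0<δ , p) = ℚ.½ ℚ.* δ , halved 0<δ ,
  map-eventually (λ k (c , p) → near-lower {seq x k} {seq y k} {δ} c p) (both (x≈y (ℚ.½ ℚ.* δ) (halved 0<δ)) p)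

-- By `≤-stable` such an `N` is at most zero, so `x²` drops below every `ε²`. With `N` a squared
-- norm, a nonzero vector thus has positive norm up to double negation.
≈0-from-bound : ∀ x N → (∀ k → seq x k ℚ.* seq x k ℚ.≤ seq N k) → ¬ (0ℝ < N) → x ≈ 0ℝ
≈0-from-bound x N x²≤N N≯0 ε 0<ε = map-eventually
  (λ k N<ε² → sq<sq⇒∣∣< {seq x k} 0<ε (ℚ.≤-<-trans (x²≤N k) N<ε²))
  (≤-stable N 0ℝ N≯0 (ε ℚ.* ε) (Arithmetic.0<* 0<ε 0<ε))

-- Constructively only the double negation of x ≈ 0 ⊎ y ≈ 0 is available.
*-integral : ∀ x y → x * y ≈ 0ℝ → ¬ (x ≈ 0ℝ) → ¬ (y ≈ 0ℝ) → ⊥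
*-integral x y xy≈0 x≉0 y≉0 =
  x≉0 (≈0-from-bound x (x * x) (λ _ → ℚ.≤-refl) λ 0<x² →
  y≉0 (≈0-from-bound y (y * y) (λ _ → ℚ.≤-refl) λ 0<y² →
  <-irrefl 0ℝ (0<-resp-≈ ((x * x) * (y * y)) 0ℝ
    (≈-trans {(x * x) * (y * y)} {(x * y) * (x * y)} {0ℝ}
      (≈-pointwise {(x * x) * (y * y)} {(x * y) * (x * y)} λ k → lemma (seq x k) (seq y k))
      (≈-trans {(x * y) * (x * y)} {0ℝ * 0ℝ} {0ℝ}
        (*-cong {x * y} {0ℝ} {x * y} {0ℝ} xy≈0 xy≈0)
        (≈-pointwise {0ℝ * 0ℝ} {0ℝ} λ _ → refl)))
    (0<-* (x * x) (y * y) 0<x² 0<y²))))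
  where
  lemma : ∀ p q → (p ℚ.* p) ℚ.* (q ℚ.* q) ≡ (p ℚ.* q) ℚ.* (p ℚ.* q)
  lemma = solve-∀ ring

-- Real operations act index by index, so algebraic identities are checked over the rationals and
-- lifted by `≈-pointwise`.
seq-∑ : ∀ {n} (f : Vector ℝ n) k → seq (∑[ i < n ] f i) k ≡ sum (λ i → seq (f i) k)
seq-∑ {zero}  f k = refl
seq-∑ {suc n} f k = cong (seq (f zero) k ℚ.+_) (seq-∑ (f ∘ suc) k)

∑-cong : ∀ {n} (f g : Vector ℝ n) → (∀ i → f i ≈ g i) → ∑[ i < n ] f i ≈ ∑[ i < n ] g i
∑-cong {zero}  f g f≈g = ≈-refl {0ℝ}
∑-cong {suc n} f g f≈g = +-cong {f zero} {g zero} {∑[ i < n ] f (suc i)} {∑[ i < n ] g (suc i)}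
  (f≈g zero) (∑-cong (f ∘ suc) (g ∘ suc) (f≈g ∘ suc))

_at_ : ∀ {n} → Vector ℝ n → ℕ → Vector ℚ n
(v at k) i = seq (v i) k

laplacian-at : ∀ {n} (G : SimpleGraph n) (v : Vector ℝ n) k i →
  seq ((laplacian G · v) i) k ≡ lap (adjacent G) (v at k) i
laplacian-at {n} G v k i = trans (seq-∑ (λ j → laplacian G i j * v j) k)
  (trans (sum-cong-≗ λ j → cong (ℚ._* seq (v j) k)
      (cong₂ (λ d a → d ℚ.- a) (degree-at j) (indicator (adjacent G i j))))
    (lap-matrix (adjacent G) (v at k) i))
  where
  indicator : ∀ b → seq (if b then 1ℝ else 0ℝ) k ≡ χ b
  indicator true  = refl
  indicator false = refl
  scaled : ∀ b D → seq (if b then D else 0ℝ) k ≡ χ b ℚ.* seq D k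
  scaled true  D = sym (ℚ.*-identityˡ (seq D k))
  scaled false D = sym (ℚ.*-zeroˡ (seq D k))
  degree-at : ∀ j → seq (degreeMatrix G i j) k ≡
    [ i Fin.≟ j ] ℚ.* sum (λ l → χ (adjacent G i l))
  degree-at j = trans (scaled ⌊ i Fin.≟ j ⌋ (∑[ l < n ] adjacencyMatrix G i l))
    (cong₂ (λ b d → χ b ℚ.* d) (isYes≗does (i Fin.≟ j))
      (trans (seq-∑ (adjacencyMatrix G i) k) (sum-cong-≗ λ l → indicator (adjacent G i l))))

≈-zero-* : ∀ x y → x ≈ 0ℝ → x * y ≈ 0ℝ
≈-zero-* x y x≈0 = ≈-trans {x * y} {0ℝ * y} {0ℝ} (*-cong {x} {0ℝ} {y} {y} x≈0 (≈-refl {y}))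
  (≈-pointwise {0ℝ * y} {0ℝ} λ k → ℚ.*-zeroˡ (seq y k))

-- From real eigenvectors to rational low-energy vectors.

record IsLow {n} (e : Fin n → Fin n → Bool) (τ : ℚ) (v : Vector ℚ n) : Set where
  field
    centred  : sum v ≡ 0ℚ
    positive : 0ℚ ℚ.< norm² v
    low      : energy e v ℚ.≤ # 2 ℚ.* (τ ℚ.* norm² v)

-- Each index carries its own vector and the approximation `seq t k` of the bound; the combinatorial
-- argument later looks at a single index.
record LowVectors {n} (G : SimpleGraph n) (t : ℝ) : Set where
  field
    vector     : ℕ → Vector ℚ n
    eventually : Eventually λ k → IsLow (adjacent G) (seq t k) (vector k)

module _ {m} (G : SimpleGraph (suc m)) (t : ℝ) where

  private
    n = suc m
    L = laplacian G

  -- The approximations of an eigenvector are recentred, so that they have sum exactly zero.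
  eigenvector-low : (x : Vector ℝ n) (θ : ℝ) → (∀ i → (L · x) i ≈ θ * x i) →
    ∑[ i < n ] x i ≈ 0ℝ → ¬ (∀ i → x i ≈ 0ℝ) → θ < t → ¬ ¬ LowVectors G t
  eigenvector-low x θ eigen sum≈0 x≉0 θ<t ¬low =
    x≉0 λ i → ≈0-from-bound (x i) N (below i) λ 0<N → ¬low (recentred (0<M 0<N) (0<D 0<N))
    where
    -- `M` is the squared norm of the recentred vector and `2 D` the slack in its energy bound. Both
    -- are positive once `N` is, since `s ≈ 0` and `Q ≈ θ * N`.
    N Q s ν M D : ℝ
    N = ∑[ i < n ] (x i * x i)
    Q = ∑[ i < n ] (x i * (L · x) i)
    s = ∑[ i < n ] x i
    ν = fromℚ (card n)
    M = ν * (ν * N - s * s)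
    D = t * M - ν * ν * Q
    N-at : ∀ k → seq N k ≡ norm² (x at k)
    N-at k = seq-∑ (λ i → x i * x i) k
    Q-at : ∀ k → seq Q k ≡ sum (λ i → (x at k) i ℚ.* lap (adjacent G) (x at k) i)
    Q-at k = trans (seq-∑ (λ i → x i * (L · x) i) k)
      (sum-cong-≗ λ i → cong (seq (x i) k ℚ.*_) (laplacian-at G x k i))
    below : ∀ i k → seq (x i) k ℚ.* seq (x i) k ℚ.≤ seq N k
    below i k = subst (seq (x i) k ℚ.* seq (x i) k ℚ.≤_) (sym (N-at k))
      (term≤sum (λ j → Arithmetic.0≤sq (seq (x j) k)) i)
    Q≈θN : Q ≈ θ * N
    Q≈θN = ≈-trans {Q} {∑[ i < n ] (x i * (θ * x i))} {θ * N}
      (∑-cong (λ i → x i * (L · x) i) (λ i → x i * (θ * x i))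
        λ i → *-cong {x i} {x i} {(L · x) i} {θ * x i} (≈-refl {x i}) (eigen i))
      (≈-pointwise {∑[ i < n ] (x i * (θ * x i))} {θ * N} λ k →
        trans (seq-∑ (λ i → x i * (θ * x i)) k)
        (trans (sum-cong-≗ λ i → swap-factors (seq (x i) k) (seq θ k))
        (trans (sym (*-distribˡ-sum (seq θ k) (λ i → seq (x i) k ℚ.* seq (x i) k)))
          (cong (seq θ k ℚ.*_) (sym (N-at k))))))
      where
      swap-factors : ∀ p q → p ℚ.* (q ℚ.* p) ≡ q ℚ.* (p ℚ.* p)
      swap-factors = solve-∀ ring
    M≈ : M ≈ ν * (ν * N)
    M≈ = ≈-trans {M} {ν * (ν * N - 0ℝ)} {ν * (ν * N)}
      (*-cong {ν} {ν} {ν * N - s * s} {ν * N - 0ℝ} (≈-refl {ν})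
        (+-cong {ν * N} {ν * N} { - (s * s)} { - 0ℝ} (≈-refl {ν * N})
          (-‿cong {s * s} {0ℝ} (≈-zero-* s s sum≈0))))
      (≈-pointwise {ν * (ν * N - 0ℝ)} {ν * (ν * N)} λ k → lemma (card n) (seq N k))
      where
      lemma : ∀ p q → p ℚ.* (p ℚ.* q ℚ.- 0ℚ) ≡ p ℚ.* (p ℚ.* q)
      lemma = solve-∀ ring
    D≈ : ν * ν * ((t - θ) * N) ≈ D
    D≈ = ≈-sym {D} {ν * ν * ((t - θ) * N)}
      (≈-trans {D} {t * (ν * (ν * N)) - ν * ν * (θ * N)} {ν * ν * ((t - θ) * N)}
        (+-cong {t * M} {t * (ν * (ν * N))} { - (ν * ν * Q)} { - (ν * ν * (θ * N))}
          (*-cong {t} {t} {M} {ν * (ν * N)} (≈-refl {t}) M≈)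
          (-‿cong {ν * ν * Q} {ν * ν * (θ * N)}
            (*-cong {ν * ν} {ν * ν} {Q} {θ * N} (≈-refl {ν * ν}) Q≈θN)))
        (≈-pointwise {t * (ν * (ν * N)) - ν * ν * (θ * N)} {ν * ν * ((t - θ) * N)} λ k →
          lemma (card n) (seq N k) (seq t k) (seq θ k)))
      where
      lemma : ∀ ν N t θ → t ℚ.* (ν ℚ.* (ν ℚ.* N)) ℚ.- ν ℚ.* ν ℚ.* (θ ℚ.* N) ≡
        ν ℚ.* ν ℚ.* ((t ℚ.- θ) ℚ.* N)
      lemma = solve-∀ ring
    0<ν : 0ℝ < ν
    0<ν = ℚ.½ , ℚ.positive⁻¹ ℚ.½ , 0 , λ _ _ → ℚ.<-≤-trans {ℚ.½} {1ℚ}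
      (Arithmetic.<-by {r = ℚ.½} (ℚ.positive⁻¹ ℚ.½) refl)
      (Arithmetic.≤-by (Energy.0≤card m) refl)
    0<M : 0ℝ < N → 0ℝ < M
    0<M 0<N = 0<-resp-≈ (ν * (ν * N)) M (≈-sym {M} {ν * (ν * N)} M≈)
      (0<-* ν (ν * N) 0<ν (0<-* ν N 0<ν 0<N))
    0<D : 0ℝ < N → 0ℝ < D
    0<D 0<N = 0<-resp-≈ (ν * ν * ((t - θ) * N)) D D≈
      (0<-* (ν * ν) ((t - θ) * N) (0<-* ν ν 0<ν 0<ν) (0<-* (t - θ) N (<⇒0<- θ t θ<t) 0<N))
    recentred : 0ℝ < M → 0ℝ < D → LowVectors G t
    recentred (δ , 0<δ , δ<M) (δ′ , 0<δ′ , δ′<D) = record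
      { vector = λ k → centre (x at k)
      ; eventually = map-eventually is-low
          (both {λ k → 0ℚ ℚ.+ δ ℚ.< seq M k} {λ k → 0ℚ ℚ.+ δ′ ℚ.< seq D k} δ<M δ′<D) }
      where
      M-at : ∀ k → seq M k ≡ norm² (centre (x at k))
      M-at k = trans (cong₂ (λ N s → card n ℚ.* (card n ℚ.* N ℚ.- s ℚ.* s)) (N-at k) (seq-∑ x k))
        (sym (norm²-centre (x at k)))
      positive : ∀ {δ p} → 0ℚ ℚ.< δ → 0ℚ ℚ.+ δ ℚ.< p → 0ℚ ℚ.< p
      positive {δ} {p} 0<δ h = ℚ.<-trans (subst (0ℚ ℚ.<_) (sym (ℚ.+-identityˡ δ)) 0<δ) h
      norm-positive : ∀ k → 0ℚ ℚ.+ δ ℚ.< seq M k → 0ℚ ℚ.< norm² (centre (x at k))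
      norm-positive k h = subst (0ℚ ℚ.<_) (M-at k) (positive 0<δ h)
      energy-low : ∀ k → 0ℚ ℚ.+ δ′ ℚ.< seq D k →
        energy (adjacent G) (centre (x at k)) ℚ.≤ # 2 ℚ.* (seq t k ℚ.* norm² (centre (x at k)))
      energy-low k h = Arithmetic.≤-by
        (Arithmetic.0≤* (Arithmetic.0≤# 2) (ℚ.<⇒≤ (positive 0<δ′ h)))
        (trans (lemma (card n) (seq t k) (norm² (centre (x at k))) (seq M k) (M-at k) (seq Q k))
          (cong (ℚ._+ # 2 ℚ.* seq D k) (sym energy≡)))
        where
        energy≡ : energy (adjacent G) (centre (x at k)) ≡ card n ℚ.* card n ℚ.* (# 2 ℚ.* seq Q k)
        energy≡ = trans (energy-centre (adjacent G) (x at k)) (cong (card n ℚ.* card n ℚ.*_)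
          (trans (energy-lap (adjacent G) (symmetric G) (x at k)) (cong (# 2 ℚ.*_) (sym (Q-at k)))))
        lemma : ∀ ν t Z M → M ≡ Z → ∀ Q → # 2 ℚ.* (t ℚ.* Z) ≡
          ν ℚ.* ν ℚ.* (# 2 ℚ.* Q) ℚ.+ # 2 ℚ.* (t ℚ.* M ℚ.- ν ℚ.* ν ℚ.* Q)
        lemma ν t Z .Z refl Q = solve (ν ∷ t ∷ Z ∷ Q ∷ []) ring
      is-low : ∀ k → (0ℚ ℚ.+ δ ℚ.< seq M k) × (0ℚ ℚ.+ δ′ ℚ.< seq D k) →
        IsLow (adjacent G) (seq t k) (centre (x at k))
      is-low k (h , h′) = record
        { centred = sum-centre (x at k) ; positive = norm-positive k h ; low = energy-low k h′ }

-- Low vectors from the second eigenvalue.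

module _ {m} (G : SimpleGraph (suc (suc m))) (σ : Spectrum (laplacian G)) where
  open Spectrum σ

  private
    n : ℕ
    n = suc (suc m)
    L = laplacian G

  total : Fin n → ℝ
  total i = ∑[ k < n ] eigenvector i k

  -- The entries of `L · v` sum to zero for every `v`; apply this to the eigenvalue equation.
  eigenvalue*total≈0 : ∀ i → eigenvalue i * total i ≈ 0ℝ
  eigenvalue*total≈0 i = ≈-trans {θ * total i} {∑[ k < n ] (θ * v k)} {0ℝ}
    (≈-pointwise {θ * total i} {∑[ k < n ] (θ * v k)} λ k →
      trans (cong (seq θ k ℚ.*_) (seq-∑ v k))
        (trans (*-distribˡ-sum (seq θ k) (v at k)) (sym (seq-∑ (λ j → θ * v j) k))))
    (≈-trans {∑[ k < n ] (θ * v k)} {∑[ k < n ] (L · v) k} {0ℝ}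
      (∑-cong (λ k → θ * v k) (L · v) λ k → ≈-sym {(L · v) k} {θ * v k} (isEigen i k))
      (≈-pointwise {∑[ k < n ] (L · v) k} {0ℝ} λ k →
        trans (seq-∑ (L · v) k) (trans (sum-cong-≗ (laplacian-at G v k))
          (sum-lap (adjacent G) (symmetric G) (v at k)))))
    where
    θ = eigenvalue i
    v = eigenvector i

  θ₀ θ₁ s₀ s₁ : ℝ
  v₀ v₁ : Vector ℝ n
  θ₀ = eigenvalue zero
  θ₁ = eigenvalue (suc zero)
  s₀ = total zero
  s₁ = total (suc zero)
  v₀ = eigenvector zero
  v₁ = eigenvector (suc zero)

  independent₂ : ∀ c d → (∀ k → c * v₀ k + d * v₁ k ≈ 0ℝ) → (c ≈ 0ℝ) × (d ≈ 0ℝ)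
  independent₂ c d combination≈0 = coefficients≈0 zero , coefficients≈0 (suc zero)
    where
    coefficient : Vector ℝ n
    coefficient = c Vec.∷ d Vec.∷ λ _ → 0ℝ
    coefficients≈0 = independent coefficient λ k →
      ≈-trans {∑[ i < n ] (coefficient i * eigenvector i k)} {c * v₀ k + d * v₁ k} {0ℝ}
        (≈-pointwise {∑[ i < n ] (coefficient i * eigenvector i k)} {c * v₀ k + d * v₁ k} λ l →
          trans (cong (λ r → seq c l ℚ.* seq (v₀ k) l ℚ.+ (seq d l ℚ.* seq (v₁ k) l ℚ.+ r)) (rest k l))
            (lemma (seq c l ℚ.* seq (v₀ k) l) (seq d l ℚ.* seq (v₁ k) l)))
        (combination≈0 k)
      where
      rest : ∀ k l → seq (∑[ i < m ] (0ℝ * eigenvector (suc (suc i)) k)) l ≡ 0ℚ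
      rest k l = trans (seq-∑ (λ i → 0ℝ * eigenvector (suc (suc i)) k) l)
        (trans (sum-cong-≗ λ i → ℚ.*-zeroˡ (seq (eigenvector (suc (suc i)) k) l)) (sum-replicate-zero m))
      lemma : ∀ p q → p ℚ.+ (q ℚ.+ 0ℚ) ≡ p ℚ.+ q
      lemma = solve-∀ ring

  1≉0 : ¬ (1ℝ ≈ 0ℝ)
  1≉0 1≈0 = <-irrefl 0ℝ (0<-resp-≈ 1ℝ 0ℝ 1≈0
    (ℚ.½ , ℚ.positive⁻¹ ℚ.½ , 0 , λ _ _ → Arithmetic.<-by {r = ℚ.½} (ℚ.positive⁻¹ ℚ.½) refl))

  v₀≉0 : ¬ (∀ k → v₀ k ≈ 0ℝ)
  v₀≉0 v₀≈0 = 1≉0 (proj₁ (independent₂ 1ℝ 0ℝ λ k →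
    ≈-trans {1ℝ * v₀ k + 0ℝ * v₁ k} {v₀ k} {0ℝ}
      (≈-pointwise {1ℝ * v₀ k + 0ℝ * v₁ k} {v₀ k} λ l → lemma (seq (v₀ k) l) (seq (v₁ k) l)) (v₀≈0 k)))
    where
    lemma : ∀ p q → 1ℚ ℚ.* p ℚ.+ 0ℚ ℚ.* q ≡ p
    lemma = solve-∀ ring

  v₁≉0 : ¬ (∀ k → v₁ k ≈ 0ℝ)
  v₁≉0 v₁≈0 = 1≉0 (proj₂ (independent₂ 0ℝ 1ℝ λ k →
    ≈-trans {0ℝ * v₀ k + 1ℝ * v₁ k} {v₁ k} {0ℝ}
      (≈-pointwise {0ℝ * v₀ k + 1ℝ * v₁ k} {v₁ k} λ l → lemma (seq (v₀ k) l) (seq (v₁ k) l)) (v₁≈0 k)))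
    where
    lemma : ∀ p q → 0ℚ ℚ.* p ℚ.+ 1ℚ ℚ.* q ≡ q
    lemma = solve-∀ ring

  c₀ c₁ : ℝ
  c₀ = (s₀ * s₁) * s₁
  c₁ = - ((s₀ * s₁) * s₀)

  -- If neither v₀ nor v₁ is orthogonal to the constant vectors, then both eigenvalues vanish. The
  -- factor s₀ s₁ lets θ₀ s₀ ≈ 0 and θ₁ s₁ ≈ 0 be used without dividing by s₀ and s₁.
  mixed : Vector ℝ n
  mixed k = c₀ * v₀ k + c₁ * v₁ k

  private
    killed : ∀ p q → θ₀ * s₀ * p + θ₁ * s₁ * q ≈ 0ℝ
    killed p q = ≈-trans {θ₀ * s₀ * p + θ₁ * s₁ * q} {0ℝ + 0ℝ} {0ℝ}
      (+-cong {θ₀ * s₀ * p} {0ℝ} {θ₁ * s₁ * q} {0ℝ}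
        (≈-zero-* (θ₀ * s₀) p (eigenvalue*total≈0 zero))
        (≈-zero-* (θ₁ * s₁) q (eigenvalue*total≈0 (suc zero))))
      (≈-pointwise {0ℝ + 0ℝ} {0ℝ} λ _ → refl)

  L·mixed≈0 : ∀ i → (L · mixed) i ≈ 0ℝ
  L·mixed≈0 i = ≈-trans {(L · mixed) i} {c₀ * (L · v₀) i + c₁ * (L · v₁) i} {0ℝ}
    (≈-pointwise {(L · mixed) i} {c₀ * (L · v₀) i + c₁ * (L · v₁) i} λ k →
      trans (laplacian-at G mixed k i)
        (trans (lap-linear (adjacent G) (seq c₀ k) (seq c₁ k) (v₀ at k) (v₁ at k) i)
          (sym (cong₂ (λ p q → seq c₀ k ℚ.* p ℚ.+ seq c₁ k ℚ.* q)
            (laplacian-at G v₀ k i) (laplacian-at G v₁ k i)))))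
    (≈-trans {c₀ * (L · v₀) i + c₁ * (L · v₁) i} {c₀ * (θ₀ * v₀ i) + c₁ * (θ₁ * v₁ i)} {0ℝ}
      (+-cong {c₀ * (L · v₀) i} {c₀ * (θ₀ * v₀ i)} {c₁ * (L · v₁) i} {c₁ * (θ₁ * v₁ i)}
        (*-cong {c₀} {c₀} {(L · v₀) i} {θ₀ * v₀ i} (≈-refl {c₀}) (isEigen zero i))
        (*-cong {c₁} {c₁} {(L · v₁) i} {θ₁ * v₁ i} (≈-refl {c₁}) (isEigen (suc zero) i)))
      (≈-trans {c₀ * (θ₀ * v₀ i) + c₁ * (θ₁ * v₁ i)}
        {θ₀ * s₀ * (s₁ * s₁ * v₀ i) + θ₁ * s₁ * (- (s₀ * s₀ * v₁ i))} {0ℝ}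
        (≈-pointwise {c₀ * (θ₀ * v₀ i) + c₁ * (θ₁ * v₁ i)}
          {θ₀ * s₀ * (s₁ * s₁ * v₀ i) + θ₁ * s₁ * (- (s₀ * s₀ * v₁ i))} λ k →
          lemma (seq s₀ k) (seq s₁ k) (seq θ₀ k) (seq θ₁ k) (seq (v₀ i) k) (seq (v₁ i) k))
        (killed (s₁ * s₁ * v₀ i) (- (s₀ * s₀ * v₁ i)))))
    where
    lemma : ∀ s₀ s₁ θ₀ θ₁ v₀ v₁ →
      ((s₀ ℚ.* s₁) ℚ.* s₁) ℚ.* (θ₀ ℚ.* v₀) ℚ.+ (ℚ.- ((s₀ ℚ.* s₁) ℚ.* s₀)) ℚ.* (θ₁ ℚ.* v₁) ≡
      θ₀ ℚ.* s₀ ℚ.* (s₁ ℚ.* s₁ ℚ.* v₀) ℚ.+ θ₁ ℚ.* s₁ ℚ.* (ℚ.- (s₀ ℚ.* s₀ ℚ.* v₁))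
    lemma = solve-∀ ring

  -- Both coefficients `c₀` and `c₁` contain the factor `s₁`. Together with `L·mixed≈0` this makes
  -- `mixed` satisfy the eigenvalue equation for `θ₁`, without deciding whether `θ₁` vanishes.
  θ₁*mixed≈0 : ∀ i → θ₁ * mixed i ≈ 0ℝ
  θ₁*mixed≈0 i = ≈-trans {θ₁ * mixed i}
    {θ₀ * s₀ * 0ℝ + θ₁ * s₁ * (s₀ * s₁ * v₀ i - s₀ * s₀ * v₁ i)} {0ℝ}
    (≈-pointwise {θ₁ * mixed i} {θ₀ * s₀ * 0ℝ + θ₁ * s₁ * (s₀ * s₁ * v₀ i - s₀ * s₀ * v₁ i)} λ k →
      lemma (seq s₀ k) (seq s₁ k) (seq θ₀ k) (seq θ₁ k) (seq (v₀ i) k) (seq (v₁ i) k))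
    (killed 0ℝ (s₀ * s₁ * v₀ i - s₀ * s₀ * v₁ i))
    where
    lemma : ∀ s₀ s₁ θ₀ θ₁ v₀ v₁ →
      θ₁ ℚ.* (((s₀ ℚ.* s₁) ℚ.* s₁) ℚ.* v₀ ℚ.+ (ℚ.- ((s₀ ℚ.* s₁) ℚ.* s₀)) ℚ.* v₁) ≡
      θ₀ ℚ.* s₀ ℚ.* 0ℚ ℚ.+ θ₁ ℚ.* s₁ ℚ.* (s₀ ℚ.* s₁ ℚ.* v₀ ℚ.- s₀ ℚ.* s₀ ℚ.* v₁)
    lemma = solve-∀ ring

  mixed-total : ∑[ k < n ] mixed k ≈ 0ℝ
  mixed-total = ≈-pointwise {∑[ k < n ] mixed k} {0ℝ} λ k →
    trans (seq-∑ mixed k)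
      (trans (sum-≡ (seq c₀ k Vec.∷ seq c₁ k Vec.∷ Vec.[]) ((v₀ at k) Vec.∷ (v₁ at k) Vec.∷ Vec.[])
          λ i → cong (seq c₀ k ℚ.* seq (v₀ i) k ℚ.+_) (sym (ℚ.+-identityʳ (seq c₁ k ℚ.* seq (v₁ i) k))))
        (trans (sym (cong₂ (λ p q → seq c₀ k ℚ.* p ℚ.+ (seq c₁ k ℚ.* q ℚ.+ 0ℚ)) (seq-∑ v₀ k) (seq-∑ v₁ k)))
          (lemma (seq s₀ k) (seq s₁ k))))
    where
    lemma : ∀ p q → ((p ℚ.* q) ℚ.* q) ℚ.* p ℚ.+ ((ℚ.- ((p ℚ.* q) ℚ.* p)) ℚ.* q ℚ.+ 0ℚ) ≡ 0ℚ
    lemma = solve-∀ ring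

  -- The spectrum supplies independent eigenvectors that need not be orthogonal to the constants. If
  -- `s₁` vanishes take `v₁`; if `s₀` does, take `v₀`, whose eigenvalue is no larger; otherwise take
  -- `mixed`, nonzero by independence. The cases are undecidable for reals, hence the double
  -- negation.
  connectivity-low : ∀ t → θ₁ < t → ¬ ¬ LowVectors G t
  connectivity-low t θ₁<t ¬low =
    eigenvector-low G t mixed θ₁
      (λ i → ≈-trans {(L · mixed) i} {0ℝ} {θ₁ * mixed i} (L·mixed≈0 i)
        (≈-sym {θ₁ * mixed i} {0ℝ} (θ₁*mixed≈0 i)))
      mixed-total mixed≉0 θ₁<t ¬low
    where
    s₁≉0 : ¬ (s₁ ≈ 0ℝ)
    s₁≉0 s₁≈0 = eigenvector-low G t v₁ θ₁ (isEigen (suc zero)) s₁≈0 v₁≉0 θ₁<t ¬low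
    s₀≉0 : ¬ (s₀ ≈ 0ℝ)
    s₀≉0 s₀≈0 = eigenvector-low G t v₀ θ₀ (isEigen zero) s₀≈0 v₀≉0
      (≤-<-trans θ₀ θ₁ t (sorted zero (suc zero) ℕ.z≤n) θ₁<t) ¬low
    mixed≉0 : ¬ (∀ k → mixed k ≈ 0ℝ)
    mixed≉0 mixed≈0 = *-integral (s₀ * s₁) s₁ (proj₁ (independent₂ c₀ c₁ mixed≈0))
      (λ s₀s₁≈0 → *-integral s₀ s₁ s₀s₁≈0 s₀≉0 s₁≉0) s₁≉0

-- The complement graph and the final contradiction.

complement-energy : ∀ {n} (G : SimpleGraph n) (v : Vector ℚ n) →
  energy (λ i j → not (adjacent G i j)) v ≡ energy (adjacent (complement G)) v
complement-energy G v = energy-off-diagonal v λ i j i≢j → off-diagonal (adjacent G i j) (i Fin.≟ j) i≢j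
  where
  off-diagonal : ∀ {i j : Fin _} b (d : Dec (i ≡ j)) → i ≢ j → not b ≡ not b Bool.∧ not ⌊ d ⌋
  off-diagonal b (yes i≡j) i≢j = contradiction i≡j i≢j
  off-diagonal b (no _)    _   = sym (Bool.∧-identityʳ (not b))

⊔<⇒< : ∀ x y z → x ⊔ y < z → (x < z) × (y < z)
⊔<⇒< x y z (δ , 0<δ , h) =
  (δ , 0<δ , map-eventually (λ k → ℚ.≤-<-trans (ℚ.+-monoˡ-≤ δ (ℚ.p≤p⊔q (seq x k) (seq y k)))) h) ,
  (δ , 0<δ , map-eventually (λ k → ℚ.≤-<-trans (ℚ.+-monoˡ-≤ δ (ℚ.p≤q⊔p (seq x k) (seq y k)))) h)

constant : ℝ
constant = fromℚ (# 50)

low-vectors-incompatible : ∀ m (G : SimpleGraph (suc m)) (let t = 1ℝ - constant * suc m ^-⅓) →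
  LowVectors G t → ¬ LowVectors (complement G) t
low-vectors-incompatible m G low low̄ = ε³n-bounded pair (cubic-large {card n} {q k} near)
  where
  open LowVectors
  n : ℕ
  n = suc m
  q = seq (n ^-⅓)
  -- Precision one half is enough: it gives `q k > 0` and `n q³ > 1 / 2`.
  root : Eventually λ k → ℚ.∣ 1ℚ ℚ.- # n ℚ.* (q k ℚ.* q k ℚ.* q k) ∣ ℚ.< ℚ.½
  root = ≈-sym {fromℕ n * (n ^-⅓ * n ^-⅓ * n ^-⅓)} {1ℝ} (^-⅓-cubed m) ℚ.½ (ℚ.positive⁻¹ ℚ.½)
  joint = both (eventually low) (both (eventually low̄) root)
  k = proj₁ joint
  common = proj₂ joint k ℕ.≤-refl
  near : ℚ.∣ 1ℚ ℚ.- card n ℚ.* (q k ℚ.* q k ℚ.* q k) ∣ ℚ.< ℚ.½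
  near = subst (λ ν → ℚ.∣ 1ℚ ℚ.- ν ℚ.* (q k ℚ.* q k ℚ.* q k) ∣ ℚ.< ℚ.½) (sym (card≡# n))
    (proj₂ (proj₂ common))
  module X = IsLow (proj₁ common)
  module Y = IsLow (proj₁ (proj₂ common))
  pair : Energy.LowPair n
  pair = record
    { edge = adjacent G ; edge-sym = symmetric G
    ; x = vector low k ; y = vector low̄ k
    -- With this choice `seq t k` computes to `1 - ε`, so the bounds of the two low vectors have the
    -- form required of a low pair.
    ; ε = # 50 ℚ.* q k
    ; 0<ε = Arithmetic.0<* (Arithmetic.0<#suc 49)
        (cubic-positive {card n} {q k} (Energy.0≤card n) near)
    ; sum-x = X.centred ; sum-y = Y.centred
    ; 0<norm-x = X.positive ; 0<norm-y = Y.positive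
    ; energy-x = X.low
    ; energy-y = subst (ℚ._≤ # 2 ℚ.* ((1ℚ ℚ.- # 50 ℚ.* q k) ℚ.* norm² (vector low̄ k)))
        (sym (complement-energy G (vector low̄ k))) Y.low }

theorem2 : ∃[ C ] (0ℝ < C ×
    (∀ (n : ℕ) (2≤n : 2 ℕ.≤ n) (G : SimpleGraph n)
    (σ : Spectrum (laplacian G)) (σ̄ : Spectrum (laplacian (complement G))) →
    1ℝ - C * n ^-⅓ ≤ algebraicConnectivity G 2≤n σ ⊔ algebraicConnectivity (complement G) 2≤n σ̄))
theorem2 = constant ,
  (1ℚ , ℚ.positive⁻¹ 1ℚ , 0 , λ _ _ → Arithmetic.<-by (Arithmetic.0<#suc 48) refl) ,
  bound
  where
  bound : ∀ (n : ℕ) (2≤n : 2 ℕ.≤ n) (G : SimpleGraph n)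
    (σ : Spectrum (laplacian G)) (σ̄ : Spectrum (laplacian (complement G))) →
    1ℝ - constant * n ^-⅓ ≤ algebraicConnectivity G 2≤n σ ⊔ algebraicConnectivity (complement G) 2≤n σ̄
  -- After `≤-stable` the goal is a contradiction, so the doubly negated low vectors can be used as
  -- if they were given.
  bound n@(suc (suc m)) (ℕ.s≤s (ℕ.s≤s ℕ.z≤n)) G σ σ̄ = ≤-stable t (θ ⊔ θ̄) λ below →
    connectivity-low G σ t (proj₁ (⊔<⇒< θ θ̄ t below)) λ low →
    connectivity-low (complement G) σ̄ t (proj₂ (⊔<⇒< θ θ̄ t below)) λ low̄ →
    low-vectors-incompatible (suc m) G low low̄
    where
    t = 1ℝ - constant * n ^-⅓
    θ = Spectrum.eigenvalue σ (suc zero)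
    θ̄ = Spectrum.eigenvalue σ̄ (suc zero)
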